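{- Let $q$ be a prime power and $\varepsilon\in\{ -1,+1\}$. Then, as formal power series in $x$, $$\Big(1+\sum_{n^-\geq1}\Big[\sum_{\lambda^-\vdash n^- }\prod_{d^-\in B(\lambda^-)}\binom{\varepsilon\,\mathrm{SDIM}^-_{d^- }(q)}{ -E(\lambda^-,d^-)}\Big]x^{n^- }\Big)\Big(1+\sum_{n^+\geq1}\Big[\sum_{\lambda^+\vdash n^+}\prod_{d^+\in B(\lambda^+)}\binom{\varepsilon\,\mathrm{SDIM}^+_{d^+}(q)}{ -E(\lambda^+,d^+)}\Big]x^{2n^+}\Big)=\Big(\frac{1-qx}{1+x}\Big)^{\varepsilon}.$$
   Context: For a monic polynomial $f(x)=\sum_{i=0}^d a_ix^i\in\mathbf{F}_{q^2}[x]$ of degree $d$ with $a_0\neq0$, its dual is $\tilde f(x)=\bar a_0^{ -1}x^d\bar f(x^{ -1})$, where $\bar f$ is obtained by applying $a\mapsto a^q$ to the coefficients; $f$ is self-dual if $\tilde f=f$. $\mathrm{SDIM}^-_d(q)$ is the number of self-dual irreducible monic polynomials of degree $d$ over $\mathbf{F}_{q^2}$, and $\mathrm{SDIM}^+_d(q)$ the number of unordered pairs $\{f,\tilde f\}$ of non-self-dual irreducible monic polynomials of degree $d$ over $\mathbf{F}_{q^2}$ with $f(0)\neq0$. For a partition $\lambda$, $B(\lambda)$ is its set of distinct parts and $E(\lambda,d)$ the multiplicity of $d$. For $m\in\mathbf{Q}$ (or $\mathbf{Q}[q]$) and $k\geq0$, $\binom{m}{k}=m(m-1)\cdots(m-k+1)/k!$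 and $\binom{m}{ -k}=(-1)^k\binom{m}{k}$. -}

module Defs where

open import Level using (Level; _⊔_) renaming (suc to lsuc)
open import Data.Bool using (Bool; true; false; not; _∧_; _∨_; if_then_else_)
open import Data.Nat as ℕ using (ℕ; zero; suc; _≡ᵇ_; _≤ᵇ_)
open import Data.Nat.Properties using (_!≢0)
open import Data.Nat.Primality using (Prime)
open import Data.Nat.Combinatorics using ()
open import Data.Integer as ℤ using (ℤ; _◃_)
open import Data.Sign using (Sign)
open import Data.Rational as ℚ using (ℚ; 0ℚ; 1ℚ)
open import Data.List using (List; []; _∷_; _++_; [_]; map; concatMap; length; filterᵇ; upTo; reverse; foldr; zipWith; deduplicate)
open import Data.Bool.ListAction using (any)
open import Data.Vec as Vec using (Vec)
open import Data.Product using (Σ; _×_; _,_)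
open import Data.List.Relation.Unary.Any using (Any)
open import Data.List.Relation.Unary.AllPairs using (AllPairs)
open import Relation.Nullary using (¬_; ⌊_⌋)
open import Relation.Binary using (Decidable)
open import Relation.Binary.PropositionalEquality using (_≡_)
open import Algebra.Bundles using (CommutativeRing)

IsPrimePower : ℕ → Set
IsPrimePower q = Σ ℕ λ p → Σ ℕ λ k → Prime p × (1 ℕ.≤ k) × (q ≡ p ℕ.^ k)

record FiniteField (c ℓ : Level) : Set (lsuc (c ⊔ ℓ)) where
  field
    commRing : CommutativeRing c ℓ
  open CommutativeRing commRing public
  field
    _≟_      : Decidable _≈_
    0≉1      : ¬ (0# ≈ 1#)
    _⁻¹      : Carrier → Carrier
    inverse  : ∀ x → ¬ (x ≈ 0#) → (x * (x ⁻¹)) ≈ 1#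
    elements : List Carrier
    complete : ∀ x → Any (x ≈_) elements
    distinct : AllPairs (λ a b → ¬ (a ≈ b)) elements

  order : ℕ
  order = length elements

-- Polynomials over a finite field F = F_{q^2}, with q given.
-- A monic polynomial of degree d is represented by the vector
-- (a_0, ..., a_{d-1}) of its non-leading coefficients; its full
-- coefficient list (lowest degree first) is a_0, ..., a_{d-1}, 1.

module Poly {c ℓ} (F : FiniteField c ℓ) (q : ℕ) where
  open FiniteField F

  _==_ : Carrier → Carrier → Bool
  a == b = ⌊ a ≟ b ⌋

  listEq : List Carrier → List Carrier → Bool
  listEq [] [] = true
  listEq (a ∷ as) (b ∷ bs) = (a == b) ∧ listEq as bs
  listEq _ _ = false

  addP : List Carrier → List Carrier → List Carrier
  addP [] bs = bs
  addP as [] = as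
  addP (a ∷ as) (b ∷ bs) = (a + b) ∷ addP as bs

  mulP : List Carrier → List Carrier → List Carrier
  mulP [] bs = []
  mulP (a ∷ as) bs = addP (map (a *_) bs) (0# ∷ mulP as bs)

  full : ∀ {d} → Vec Carrier d → List Carrier
  full v = Vec.toList v ++ [ 1# ]

  monics : (d : ℕ) → List (Vec Carrier d)
  monics zero = Vec.[] ∷ []
  monics (suc d) = concatMap (λ a → map (a Vec.∷_) (monics d)) elements

  reducible : ∀ {d} → Vec Carrier d → Bool
  reducible {d} f =
    any (λ a → (1 ≤ᵇ a) ∧
        any (λ g → any (λ h → listEq (mulP (full g) (full h)) (full f))
                       (monics (d ℕ.∸ a)))
            (monics a))
        (upTo d)

  irreducible : ∀ {d} → Vec Carrier d → Bool
  irreducible {d} f = (1 ≤ᵇ d) ∧ not (reducible f)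

  const : ∀ {d} → Vec Carrier d → Carrier
  const {zero} v = 1#
  const {suc d} v = Vec.head v

  nonzeroConst : ∀ {d} → Vec Carrier d → Bool
  nonzeroConst f = not (const f == 0#)

  pow : Carrier → ℕ → Carrier
  pow a zero = 1#
  pow a (suc n) = a * pow a n

  bar : Carrier → Carrier
  bar a = pow a q

  -- dual  f~(x) = (bar a_0)^{-1} x^d fbar(1/x), as a full coefficient list
  dual : ∀ {d} → Vec Carrier d → List Carrier
  dual f = map (λ b → (bar (const f) ⁻¹) * b) (reverse (map bar (full f)))

  selfDual : ∀ {d} → Vec Carrier d → Bool
  selfDual f = listEq (dual f) (full f)

  SDIM⁻ : ℕ → ℕ
  SDIM⁻ d = length (filterᵇ (λ f → irreducible f ∧ nonzeroConst f ∧ selfDual f) (monics d))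

  -- SDIM^+_d(q): unordered pairs {f, f~} of non-self-dual irreducible monic
  -- polynomials of degree d with f(0) ≠ 0 = (number of such f) / 2
  SDIM⁺ : ℕ → ℕ
  SDIM⁺ d = length (filterᵇ (λ f → irreducible f ∧ nonzeroConst f ∧ not (selfDual f)) (monics d)) ℕ./ 2

listsOver : ℕ → ℕ → List (List ℕ)
listsOver n zero = [] ∷ []
listsOver n (suc k) = concatMap (λ j → map (suc j ∷_) (listsOver n k)) (upTo n)

nonIncreasing : List ℕ → Bool
nonIncreasing [] = true
nonIncreasing (a ∷ []) = true
nonIncreasing (a ∷ b ∷ l) = (b ≤ᵇ a) ∧ nonIncreasing (b ∷ l)

sumℕ : List ℕ → ℕ
sumℕ = foldr ℕ._+_ 0

partitions : ℕ → List (List ℕ)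
partitions n = filterᵇ (λ l → nonIncreasing l ∧ (sumℕ l ≡ᵇ n))
                       (concatMap (listsOver n) (upTo (suc n)))

B : List ℕ → List ℕ
B λ′ = deduplicate ℕ._≟_ λ′

E : List ℕ → ℕ → ℕ
E λ′ d = length (filterᵇ (λ x → x ≡ᵇ d) λ′)

sumℚ : List ℚ → ℚ
sumℚ = foldr ℚ._+_ 0ℚ

prodℚ : List ℚ → ℚ
prodℚ = foldr ℚ._*_ 1ℚ

binom : ℤ → ℕ → ℚ
binom m k = ℚ._*_ (prodℚ (map (λ i → (m ℤ.- ℤ.+ i) ℚ./ 1) (upTo k)))
                  ((ℤ.+ 1 ℚ./ (k ℕ.!)) {{k !≢0}})

-- binomNeg m k = binom(m, -k) = (-1)^k binom(m, k)
signPow : ℕ → ℚ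
signPow zero = 1ℚ
signPow (suc k) = ℚ.- (signPow k)

binomNeg : ℤ → ℕ → ℚ
binomNeg m k = signPow k ℚ.* binom m k

PS : Set
PS = ℕ → ℚ

_⊛_ : PS → PS → PS
(f ⊛ g) n = sumℚ (map (λ i → f i ℚ.* g (n ℕ.∸ i)) (upTo (suc n)))

inX² : PS → PS
inX² a zero = a zero
inX² a (suc zero) = 0ℚ
inX² a (suc (suc n)) = inX² (λ k → a (suc k)) n

linear : ℚ → ℚ → PS
linear c0 c1 zero = c0
linear c0 c1 (suc zero) = c1
linear c0 c1 (suc (suc n)) = 0ℚ

geometric : ℚ → PS
geometric r zero = 1ℚ
geometric r (suc k) = r ℚ.* geometric r k

rhsSeries : ℕ → Sign → PS
rhsSeries q Sign.+ = linear 1ℚ (ℚ.- (ℤ.+ q ℚ./ 1)) ⊛ geometric (ℚ.- 1ℚ)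
rhsSeries q Sign.- = linear 1ℚ 1ℚ ⊛ geometric (ℤ.+ q ℚ./ 1)

partitionSeries : Sign → (ℕ → ℕ) → PS
partitionSeries ε S zero = 1ℚ
partitionSeries ε S (suc n) =
  sumℚ (map (λ λ′ → prodℚ (map (λ d → binomNeg (ε ◃ S d) (E λ′ d)) (B λ′)))
            (partitions (suc n)))

{-# OPTIONS --safe #-}
module Submission where

-- A self-dual polynomial with non-zero constant term factors uniquely into "atoms": self-dual irreducibles, counted by
-- SDIM⁻, and products g g~ with g irreducible and not self-dual, counted by SDIM⁺.  Sieving the self-dual polynomials by
-- one atom of degree s multiplies their generating function A by 1 - x^s (Euclid's lemma), and sieving by all of them
-- leaves only the polynomial 1.  Hence A ∏ (1 - x^d)^(SDIM⁻ d) (1 - x^(2d))^(SDIM⁺ d) = 1, and the products on the left of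
-- the theorem are the partition sums.  On the other hand there are (q + 1) q^(n-1) self-dual polynomials of degree n ≥ 1:
-- q + 1 constant terms of norm 1, then the coefficients come in pairs determined by either member, except for a middle
-- one confined to a set of q elements; so A = (1 + x) / (1 - q x).

open import Defs
open import Algebra.Bundles using (CommutativeMonoid; CommutativeRing)
open import Data.Bool using (Bool; true; false; not; _∧_; T)
open import Data.Bool.Properties using (T-∧)
open import Data.Empty using (⊥-elim)
open import Data.List using (List; []; _∷_; _++_; [_]; map; length; filter; filterᵇ; foldr; reverse; concatMap; applyUpTo; upTo)
open import Data.List.Properties using (length-map; length-++; length-reverse; unfold-reverse; foldr-++; map-applyUpTo; map-++; map-∘; ∷-injectiveˡ; ∷-injectiveʳ)
open import Data.List.Membership.Propositional using (find; lose)
open import Data.List.Membership.Propositional.Properties using (∈-upTo⁺; ∈-upTo⁻; ∈-map⁺; ∈-map⁻; ∈-++⁺ˡ; ∈-++⁺ʳ; ∈-++⁻; ∈-filter⁺; ∈-filter⁻; ∈-concatMap⁺; ∈-concatMap⁻; ∈-deduplicate⁺; ∈-deduplicate⁻)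
open import Data.List.Relation.Unary.All as All using (All; []; _∷_; reduce)
import Data.List.Relation.Unary.All.Properties as AllP
open import Data.List.Relation.Unary.AllPairs as AllPairs using (AllPairs; []; _∷_)
import Data.List.Relation.Unary.AllPairs.Properties as AllPairsP
open import Data.List.Relation.Unary.Any as Any using (Any; here; there; satisfied; _─_)
import Data.List.Relation.Unary.Any.Properties as AnyP
open import Data.Nat as ℕ using (ℕ; zero; suc; _≤_; _<_; z≤n; s≤s)
open import Data.Nat.DivMod using (m*n/n≡m)
open import Data.Nat.Induction using (<-rec)
import Data.Nat.Properties as ℕP
open import Data.Product using (Σ; ∃; ∃₂; _×_; _,_; proj₁; proj₂)
open import Data.Rational as ℚ using (ℚ; 0ℚ; 1ℚ)
import Data.Rational.Properties as ℚP
open import Data.Sign using (Sign)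
open import Data.Sum as Sum using (_⊎_; inj₁; inj₂)
open import Data.Unit using (⊤; tt)
open import Data.Vec as Vec using (Vec; []; _∷_)
open import Function using (_∘_; id; Equivalence)
open import Level using (Level; _⊔_)
open import Relation.Binary using (IsEquivalence; Rel; Setoid; Tri; tri<; tri≈; tri>)
open import Relation.Binary.PropositionalEquality as ≡ using (_≡_; _≢_)
open import Relation.Nullary using (¬_; Dec; yes; no; ¬?)
open import Relation.Nullary.Decidable using (T?; toWitness; fromWitness; _×-dec_)

-- Unique factorization is never stated. A sieve step only needs that the multiples of an atom among
-- the polynomials left so far correspond, by division, to all polynomials left so far whose degree
-- is lower by the size of the atom. The infinite product is replaced by the atoms whose primes have
-- degree at most M; these determine all coefficients up to M, and coefficient n is compared with
-- the choice M = n. The two signs differ in what can be said directly. For `Sign.+` the partition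
-- sums are products of factors 1 - X^s; for `Sign.-` they are described as inverses of these
-- products, and that case follows from uniqueness of inverses. The counts q + 1 and q avoid the
-- cyclic structure of the unit group. A monic polynomial of degree k has at most k roots, which
-- bounds both the fibres and the number of values of a suitable map; the domain is so large that
-- both bounds must be attained.

T-∧⁻ : ∀ {a b} → T (a ∧ b) → T a × T b
T-∧⁻ = Equivalence.to T-∧

T-∧⁺ : ∀ {a b} → T a × T b → T (a ∧ b)
T-∧⁺ = Equivalence.from T-∧

T-not⁺ : ∀ {b} → ¬ T b → T (not b)
T-not⁺ {false} _ = _
T-not⁺ {true} ¬t = ⊥-elim (¬t _)

T-not⁻ : ∀ {b} → T (not b) → ¬ T b
T-not⁻ {false} _ ()

-- Counting the elements of a setoid that have a given property.

module Counting where
  open import Data.Nat using (_+_; _*_)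
  open import Relation.Unary using (Decidable)

  private
    variable
      a b c ℓ ℓ₁ ℓ₂ p r s : Level

  -- Equality is that of the setoid and `P` is not assumed to respect it: listed elements satisfy
  -- `P`, and anything satisfying `P` is equal to a listed one.
  record Card (S : Setoid a ℓ) (P : Setoid.Carrier S → Set p) (n : ℕ) : Set (a ⊔ ℓ ⊔ p) where
    constructor card
    open Setoid S
    field
      list     : List Carrier
      size     : length list ≡ n
      unique   : AllPairs (λ x y → ¬ x ≈ y) list
      sound    : All P list
      complete : ∀ {x} → P x → Any (x ≈_) list

  length-─ : {A : Set a} {Q : A → Set p} {xs : List A} (x∈xs : Any Q xs) → length xs ≡ suc (length (xs ─ x∈xs))
  length-─ {xs = x ∷ xs} (here _) = ≡.refl
  length-─ {xs = x ∷ xs} (there q) = ≡.cong suc (length-─ q)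

  All-─ : {A : Set a} {P : A → Set p} {Q : A → Set r} {xs : List A} (x∈xs : Any Q xs) → All P xs → All P (xs ─ x∈xs)
  All-─ (here _) (_ ∷ ps) = ps
  All-─ (there q) (px ∷ ps) = px ∷ All-─ q ps

  AllPairs-─ : {A : Set a} {R : Rel A p} {Q : A → Set r} {xs : List A} (x∈xs : Any Q xs) → AllPairs R xs → AllPairs R (xs ─ x∈xs)
  AllPairs-─ (here _) (_ ∷ ps) = ps
  AllPairs-─ (there q) (px ∷ ps) = All-─ q px ∷ AllPairs-─ q ps

  length-filter-split : {A : Set a} {D : A → Set p} (D? : Decidable D) (xs : List A) →
    length (filter D? xs) + length (filter (¬? ∘ D?) xs) ≡ length xs
  length-filter-split D? [] = ≡.refl
  length-filter-split D? (x ∷ xs) with D? x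
  ... | yes _ = ≡.cong suc (length-filter-split D? xs)
  ... | no _ = ≡.trans (ℕP.+-suc _ _) (≡.cong suc (length-filter-split D? xs))

  module _ (S : Setoid a ℓ) where
    open Setoid S

    Unique : List Carrier → Set _
    Unique = AllPairs (λ x y → ¬ x ≈ y)

    ∈-─ : ∀ {x y ys} (x∈ys : Any (x ≈_) ys) → Any (y ≈_) ys → y ≈ x ⊎ Any (y ≈_) (ys ─ x∈ys)
    ∈-─ (here x≈z) (here y≈z) = inj₁ (trans y≈z (sym x≈z))
    ∈-─ (here x≈z) (there y∈) = inj₂ y∈
    ∈-─ (there x∈) (here y≈z) = inj₂ (here y≈z)
    ∈-─ (there x∈) (there y∈) = Sum.map₂ there (∈-─ x∈ y∈)

    ∉-─ : ∀ {x ys} (x∈ys : Any (x ≈_) ys) → Unique ys → All (λ y → ¬ x ≈ y) (ys ─ x∈ys)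
    ∉-─ (here x≈y) (y∉ys ∷ _) = All.map (λ y≉z x≈z → y≉z (trans (sym x≈y) x≈z)) y∉ys
    ∉-─ (there x∈) (y∉ys ∷ uys) = (λ x≈y → AllP.All¬⇒¬Any y∉ys (Any.map (trans (sym x≈y)) x∈)) ∷ ∉-─ x∈ uys

    ⊆-─ : ∀ {x xs ys} (x∈ys : Any (x ≈_) ys) → All (λ y → ¬ x ≈ y) xs → All (λ y → Any (y ≈_) ys) xs →
      All (λ y → Any (y ≈_) (ys ─ x∈ys)) xs
    ⊆-─ {x} {xs} {ys} x∈ys x∉xs xs⊆ys = All.zipWith keep (x∉xs , xs⊆ys)
      where
      keep : ∀ {y} → (¬ x ≈ y) × Any (y ≈_) ys → Any (y ≈_) (ys ─ x∈ys)
      keep (x≉y , y∈ys) with ∈-─ x∈ys y∈ys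
      ... | inj₁ y≈x = ⊥-elim (x≉y (sym y≈x))
      ... | inj₂ y∈zs = y∈zs

    -- Pigeonhole: the head of `xs` uses up its occurrence in `ys`, and the rest of `xs` lies in
    -- what remains because it avoids the head.
    unique-⊆-length : ∀ {xs ys} → Unique xs → All (λ x → Any (x ≈_) ys) xs → length xs ≤ length ys
    unique-⊆-length [] [] = z≤n
    unique-⊆-length {x ∷ xs} (x∉xs ∷ uxs) (x∈ys ∷ xs⊆ys) =
      ≡.subst (suc (length xs) ≤_) (≡.sym (length-─ x∈ys)) (s≤s (unique-⊆-length uxs (⊆-─ x∈ys x∉xs xs⊆ys)))

    module _ {P : Carrier → Set p} where

      card-unique : ∀ {m n} → Card S P m → Card S P n → m ≡ n
      card-unique A B = ℕP.≤-antisym (le A B) (le B A)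
        where
        le : ∀ {m n} → Card S P m → Card S P n → m ≤ n
        le (card xs ≡.refl uxs sxs _) (card ys ≡.refl _ _ cys) = unique-⊆-length uxs (All.map cys sxs)

      card-⇔ : ∀ {Q : Carrier → Set r} {n} → (∀ {x} → P x → Q x) → (∀ {x} → Q x → P x) → Card S P n → Card S Q n
      card-⇔ to from (card xs s u sd c) = card xs s u (All.map to sd) (c ∘ from)

      card-∅ : (∀ {x} → ¬ P x) → Card S P 0
      card-∅ empty = card [] ≡.refl [] [] (⊥-elim ∘ empty)

      card-singleton : ∀ {x} → P x → (∀ {y} → P y → y ≈ x) → Card S P 1
      card-singleton {x} px only = card (x ∷ []) ≡.refl ([] ∷ []) (px ∷ []) (here ∘ only)

      card-split : ∀ {D : Carrier → Set r} {n} → Decidable D → (∀ {x y} → x ≈ y → D x → D y) → Card S P n →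
        ∃₂ λ k l → Card S (λ x → P x × D x) k × Card S (λ x → P x × ¬ D x) l × (k + l ≡ n)
      card-split {D = D} D? resp (card xs ≡.refl u s c) = _ , _ ,
        card (filter D? xs) ≡.refl (AllPairsP.filter⁺ D? u) (All.zip (AllP.filter⁺ D? s , AllP.all-filter D? xs))
          (λ (px , dx) → Sum.[ id , ⊥-elim ∘ ¬any dx ]′ (AnyP.filter⁺ D? (c px))) ,
        card (filter (¬? ∘ D?) xs) ≡.refl (AllPairsP.filter⁺ (¬? ∘ D?) u)
          (All.zip (AllP.filter⁺ (¬? ∘ D?) s , AllP.all-filter (¬? ∘ D?) xs))
          (λ (px , ¬dx) → Sum.[ id , ⊥-elim ∘ ¬any′ ¬dx ]′ (AnyP.filter⁺ (¬? ∘ D?) (c px))) ,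
        length-filter-split D? xs
        where
        ¬any : ∀ {x} {q : Any (x ≈_) xs} → D x → ¬ ¬ D (Any.lookup q)
        ¬any {q = q} dx ¬d = ¬d (resp (AnyP.lookup-result q) dx)
        ¬any′ : ∀ {x} {q : Any (x ≈_) xs} → ¬ D x → ¬ ¬ ¬ D (Any.lookup q)
        ¬any′ {q = q} ¬dx ¬¬d = ¬¬d (λ d → ¬dx (resp (sym (AnyP.lookup-result q)) d))

      -- Every orbit of an involution without fixed points has two elements, so one representative
      -- per orbit halves the count. The last component says that distinct representatives lie in
      -- distinct orbits.
      involution-representatives : ∀ {n} (τ : Carrier → Carrier) → (∀ {x} → P x → P (τ x)) →
        (∀ {x y} → P x → P y → x ≈ y → τ x ≈ τ y) → (∀ {x} → P x → τ (τ x) ≈ x) → (∀ {x} → P x → ¬ τ x ≈ x) →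
        Card S P n →
        ∃ λ rs → (n ≡ length rs + length rs) × All P rs × (∀ {x} → P x → Any (λ z → x ≈ z ⊎ x ≈ τ z) rs) ×
          AllPairs (λ x y → (¬ y ≈ x) × (¬ y ≈ τ x)) rs
      involution-representatives {n} τ τ-P τ-cong τ-inv τ-free (card xs ≡.refl u s c) =
        let (rs , len , prs , covers , sep , _) = go n xs u s (All.map (c ∘ τ-P) s) ℕP.≤-refl
        in rs , len , prs , (λ px → covers px (c px)) , sep
        where
        Reps : List Carrier → Set _
        Reps xs = ∃ λ rs → (length xs ≡ length rs + length rs) × All P rs ×
          (∀ {x} → P x → Any (x ≈_) xs → Any (λ z → x ≈ z ⊎ x ≈ τ z) rs) ×
          AllPairs (λ x y → (¬ y ≈ x) × (¬ y ≈ τ x)) rs ×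
          All (λ z → Any (z ≈_) xs) rs

        -- `k` bounds the length of the list, which shrinks by two at each step: a representative
        -- and its image leave together, so what remains is again closed under `τ`.
        go : ∀ k xs → Unique xs → All P xs → All (λ x → Any (τ x ≈_) xs) xs → length xs ≤ k → Reps xs
        go _ [] _ _ _ _ = [] , ≡.refl , [] , (λ _ ()) , [] , []
        go (suc k) (x ∷ xs) (x∉ ∷ u) (px ∷ ps) (τx∈ ∷ τxs∈) (s≤s le) = reps τx∈
          where
          reps : Any (τ x ≈_) (x ∷ xs) → Reps (x ∷ xs)
          reps (here τx≈x) = ⊥-elim (τ-free px τx≈x)
          reps (there τx∈xs) =
            x ∷ rs , ≡.cong suc (≡.trans (length-─ τx∈xs) (≡.trans (≡.cong suc len) (≡.sym (ℕP.+-suc _ _)))) , px ∷ prs ,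
            cov , All.map fresh mem ∷ sep ,
            here refl ∷ All.map (there ∘ weaken) mem
            where
            ys = xs ─ τx∈xs
            weaken : ∀ {z} → Any (z ≈_) ys → Any (z ≈_) xs
            weaken = un τx∈xs
              where
              un : ∀ {z w xs} (q : Any (w ≈_) xs) → Any (z ≈_) (xs ─ q) → Any (z ≈_) xs
              un (here _) m = there m
              un (there q) (here e) = here e
              un (there q) (there m) = there (un q m)
            x∉ys : All (λ y → ¬ x ≈ y) ys
            x∉ys = All-─ τx∈xs x∉
            τx∉ys : All (λ y → ¬ τ x ≈ y) ys
            τx∉ys = ∉-─ τx∈xs u
            closed : ∀ {y} → P y × Any (τ y ≈_) (x ∷ xs) × (¬ x ≈ y) × (¬ τ x ≈ y) → Any (τ y ≈_) ys
            closed (py , here τy≈x , _ , τx≉y) = ⊥-elim (τx≉y (trans (τ-cong px (τ-P py) (sym τy≈x)) (τ-inv py)))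
            closed (py , there τy∈ , x≉y , _) with ∈-─ τx∈xs τy∈
            ... | inj₁ τy≈τx = ⊥-elim (x≉y (trans (sym (τ-inv px)) (trans (τ-cong (τ-P px) (τ-P py) (sym τy≈τx)) (τ-inv py))))
            ... | inj₂ m = m
            rec : Reps ys
            rec = go k ys (AllPairs-─ τx∈xs u) (All-─ τx∈xs ps)
              (All.map closed (All.zip (All-─ τx∈xs ps , All.zip (All-─ τx∈xs τxs∈ , All.zip (x∉ys , τx∉ys)))))
              (ℕP.≤-trans (ℕP.n≤1+n _) (≡.subst (_≤ k) (length-─ τx∈xs) le))
            rs = proj₁ rec
            len = proj₁ (proj₂ rec)
            prs = proj₁ (proj₂ (proj₂ rec))
            sep = proj₁ (proj₂ (proj₂ (proj₂ (proj₂ rec))))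
            mem = proj₂ (proj₂ (proj₂ (proj₂ (proj₂ rec))))
            cov : ∀ {y} → P y → Any (y ≈_) (x ∷ xs) → Any (λ z → y ≈ z ⊎ y ≈ τ z) (x ∷ rs)
            cov py (here y≈x) = here (inj₁ y≈x)
            cov py (there y∈) with ∈-─ τx∈xs y∈
            ... | inj₁ y≈τx = here (inj₂ y≈τx)
            ... | inj₂ m = there (proj₁ (proj₂ (proj₂ (proj₂ rec))) py m)
            notIn : ∀ {w z} → All (λ y → ¬ w ≈ y) ys → Any (z ≈_) ys → ¬ z ≈ w
            notIn none m z≈w = AllP.All¬⇒¬Any none (Any.map (trans (sym z≈w)) m)
            fresh : ∀ {z} → Any (z ≈_) ys → (¬ z ≈ x) × (¬ z ≈ τ x)
            fresh i = notIn x∉ys i , notIn τx∉ys i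

  module _ (S : Setoid a ℓ) (T : Setoid b ℓ₁) where
    private
      module S = Setoid S
      module T = Setoid T

    card-map : ∀ {P : S.Carrier → Set p} {Q : T.Carrier → Set r} {n} (f : S.Carrier → T.Carrier) →
      (∀ {x y} → P x → P y → x S.≈ y → f x T.≈ f y) → (∀ {x y} → P x → P y → f x T.≈ f y → x S.≈ y) →
      (∀ {x y} → x S.≈ y → P x → P y) →
      (∀ {x} → P x → Q (f x)) → (∀ {y} → Q y → ∃ λ x → P x × y T.≈ f x) →
      Card S P n → Card T Q n
    card-map {P = P} f f-cong f-inj resp f-sound f-onto (card xs ≡.refl u s c) =
      card (map f xs) (length-map f xs) (uniq u s) (AllP.map⁺ (All.map f-sound s))
        (λ qy → let (x , px , y≈fx) = f-onto qy in AnyP.map⁺ (Any.map (λ x≈z → T.trans y≈fx (f-cong px (resp x≈z px) x≈z)) (c px)))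
      where
      uniq : ∀ {xs} → Unique S xs → All P xs → Unique T (map f xs)
      uniq [] [] = []
      uniq (x∉ ∷ u) (px ∷ ps) = AllP.map⁺ (All.zipWith (λ (x≉y , py) e → x≉y (f-inj px py e)) (x∉ , ps)) ∷ uniq u ps

    -- If the fibres of f have at most k points and f takes at most m values,
    -- then m * k points can only be accommodated when every fibre is full.
    module _ (T? : ∀ x y → Dec (x T.≈ y)) {P : S.Carrier → Set p} (f : S.Carrier → T.Carrier)
      (f-cong : ∀ {x y} → x S.≈ y → f x T.≈ f y) (k : ℕ)
      (bound : ∀ z ys → Unique S ys → All (λ y → P y × f y T.≈ z) ys → length ys ≤ k)
      where

      fibre-bound : ∀ zs xs → Unique S xs → All P xs → All (λ x → Any (f x T.≈_) zs) xs → length xs ≤ length zs * k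
      fibre-bound [] [] _ _ _ = z≤n
      fibre-bound [] (x ∷ xs) _ _ (() ∷ _)
      fibre-bound (z ∷ zs) xs u ps m = ≡.subst (_≤ k + length zs * k) (length-filter-split D? xs)
        (ℕP.+-mono-≤ (bound z _ (AllPairsP.filter⁺ D? u) (All.zip (AllP.filter⁺ D? ps , AllP.all-filter D? xs)))
          (fibre-bound zs _ (AllPairsP.filter⁺ ¬D? u) (AllP.filter⁺ ¬D? ps)
            (All.zipWith keep (AllP.filter⁺ ¬D? m , AllP.all-filter ¬D? xs))))
        where
        D? = λ x → T? (f x) z
        ¬D? = ¬? ∘ D?
        keep : ∀ {x} → Any (f x T.≈_) (z ∷ zs) × (¬ f x T.≈ z) → Any (f x T.≈_) zs
        keep (here e , ne) = ⊥-elim (ne e)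
        keep (there q , _) = q

      fibre-full : ∀ {m} y₀ zs → suc (length zs) ≤ m → (∀ {x} → P x → f x T.≈ y₀ ⊎ Any (f x T.≈_) zs) →
        Card S P (m * k) → Card S (λ x → P x × f x T.≈ y₀) k
      fibre-full {m} y₀ zs le values C
        with card-split S (λ x → T? (f x) y₀) (λ x≈y e → T.trans (f-cong (S.sym x≈y)) e) C
      ... | k′ , l , C₁ , C₂ , k′+l≡mk = ≡.subst (Card S _) (ℕP.≤-antisym k′≤k k≤k′) C₁
        where
        open Card
        k′≤k : k′ ≤ k
        k′≤k = ≡.subst (_≤ k) (size C₁) (bound y₀ (list C₁) (unique C₁) (sound C₁))
        other : ∀ {x} → P x × (¬ f x T.≈ y₀) → Any (f x T.≈_) zs
        other (px , ne) = Sum.[ ⊥-elim ∘ ne , id ]′ (values px)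
        l≤ : l ≤ length zs * k
        l≤ = ≡.subst (_≤ length zs * k) (size C₂)
          (fibre-bound zs (list C₂) (unique C₂) (All.map proj₁ (sound C₂)) (All.map other (sound C₂)))
        k≤k′ : k ≤ k′
        k≤k′ = ℕP.+-cancelʳ-≤ (length zs * k) k k′ (begin
          k + length zs * k  ≤⟨ ℕP.*-monoˡ-≤ k le ⟩
          m * k              ≡⟨ k′+l≡mk ⟨
          k′ + l             ≤⟨ ℕP.+-monoʳ-≤ k′ l≤ ⟩
          k′ + length zs * k ∎)
          where open ℕP.≤-Reasoning

    module _ (U : Setoid c ℓ₂) where
      private module U = Setoid U

      -- All fibres have the same size `m`, so concatenating their images gives n * m elements;
      -- injectivity of `φ` in its first argument keeps the images of different fibres apart.
      card-Σ : ∀ {P : S.Carrier → Set p} {Q : S.Carrier → T.Carrier → Set r} {R : U.Carrier → Set s} {n m}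
        (φ : S.Carrier → T.Carrier → U.Carrier) →
        (∀ {x x′ y y′} → x S.≈ x′ → y T.≈ y′ → φ x y U.≈ φ x′ y′) →
        (∀ {x x′ y y′} → P x → Q x y → P x′ → Q x′ y′ → φ x y U.≈ φ x′ y′ → x S.≈ x′ × y T.≈ y′) →
        (∀ {x x′ y} → x S.≈ x′ → Q x y → Q x′ y) →
        (∀ {x y} → P x → Q x y → R (φ x y)) →
        (∀ {z} → R z → ∃₂ λ x y → P x × Q x y × z U.≈ φ x y) →
        Card S P n → (∀ {x} → P x → Card T (Q x) m) → Card U R (n * m)
      card-Σ {P = P} {Q} {R} {m = m} φ φ-cong φ-inj resp φ-sound φ-onto (card xs ≡.refl u s c) fib =
        card (pairs xs s) (len xs s) (uniq xs s u) (snd xs s)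
          (λ rz → let (x , y , px , qxy , e) = φ-onto rz in cmp xs s e qxy (c px))
        where
        open Card
        pairs : ∀ xs → All P xs → List U.Carrier
        pairs [] [] = []
        pairs (x ∷ xs) (px ∷ ps) = map (φ x) (list (fib px)) ++ pairs xs ps

        len : ∀ xs ps → length (pairs xs ps) ≡ length xs * m
        len [] [] = ≡.refl
        len (x ∷ xs) (px ∷ ps) = ≡.trans (length-++ (map (φ x) (list (fib px))))
          (≡.cong₂ _+_ (≡.trans (length-map (φ x) (list (fib px))) (size (fib px))) (len xs ps))

        snd : ∀ xs ps → All R (pairs xs ps)
        snd [] [] = []
        snd (x ∷ xs) (px ∷ ps) = AllP.++⁺ (AllP.map⁺ (All.map (φ-sound px) (sound (fib px)))) (snd xs ps)

        apart : ∀ {x y} → P x → Q x y → ∀ xs ps → All (λ x′ → ¬ x S.≈ x′) xs → All (λ z → ¬ φ x y U.≈ z) (pairs xs ps)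
        apart px qxy [] [] [] = []
        apart px qxy (x′ ∷ xs) (px′ ∷ ps) (x≉ ∷ nes) = AllP.++⁺
          (AllP.map⁺ (All.map (λ q e → x≉ (proj₁ (φ-inj px qxy px′ q e))) (sound (fib px′)))) (apart px qxy xs ps nes)

        row : ∀ {x} → P x → ∀ {ys} → Unique T ys → All (Q x) ys → Unique U (map (φ x) ys)
        row px [] [] = []
        row px (y∉ ∷ uys) (q ∷ qs) =
          AllP.map⁺ (All.zipWith (λ (ne , q′) e → ne (proj₂ (φ-inj px q px q′ e))) (y∉ , qs)) ∷ row px uys qs

        uniq : ∀ xs ps → Unique S xs → Unique U (pairs xs ps)
        uniq [] [] [] = []
        uniq (x ∷ xs) (px ∷ ps) (x∉ ∷ uxs) = AllPairsP.++⁺ (row px (unique (fib px)) (sound (fib px))) (uniq xs ps uxs)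
          (AllP.map⁺ (All.map (λ q → apart px q xs ps x∉) (sound (fib px))))

        cmp : ∀ {x y z} xs ps → z U.≈ φ x y → Q x y → Any (x S.≈_) xs → Any (z U.≈_) (pairs xs ps)
        cmp (x′ ∷ xs) (px′ ∷ ps) e q (here x≈x′) =
          AnyP.++⁺ˡ (AnyP.map⁺ (Any.map (λ y≈y′ → U.trans e (φ-cong x≈x′ y≈y′)) (complete (fib px′) (resp x≈x′ q))))
        cmp (x′ ∷ xs) (px′ ∷ ps) e q (there x∈) = AnyP.++⁺ʳ (map (φ x′) (list (fib px′))) (cmp xs ps e q x∈)

  module _ (M : CommutativeMonoid a ℓ) where
    open CommutativeMonoid M
    open import Relation.Binary.Reasoning.Setoid setoid
    open import Algebra.Properties.CommutativeSemigroup commutativeSemigroup using (x∙yz≈y∙xz)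

    fold-─ : ∀ {x ys} (x∈ys : Any (x ≈_) ys) → foldr _∙_ ε ys ≈ x ∙ foldr _∙_ ε (ys ─ x∈ys)
    fold-─ (here x≈y) = ∙-congʳ (sym x≈y)
    fold-─ {x} {y ∷ ys} (there q) = trans (∙-congˡ (fold-─ q)) (x∙yz≈y∙xz y x _)

    -- A list without repetitions inside one of equal length is a rearrangement of it. Applied to
    -- the translates of all field elements and to the multiples of all units.
    fold-unique-⊆ : ∀ {xs ys} → Unique setoid xs → All (λ x → Any (x ≈_) ys) xs → length ys ≡ length xs →
      foldr _∙_ ε xs ≈ foldr _∙_ ε ys
    fold-unique-⊆ {[]} {[]} _ _ _ = refl
    fold-unique-⊆ {x ∷ xs} {ys} (x∉ ∷ u) (x∈ys ∷ xs⊆ys) len = begin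
      x ∙ foldr _∙_ ε xs            ≈⟨ ∙-congˡ (fold-unique-⊆ u (⊆-─ setoid x∈ys x∉ xs⊆ys)
                                         (ℕP.suc-injective (≡.trans (≡.sym (length-─ x∈ys)) len))) ⟩
      x ∙ foldr _∙_ ε (ys ─ x∈ys)   ≈⟨ fold-─ x∈ys ⟨
      foldr _∙_ ε ys                ∎

    module _ {A : Set b} (w : A → Carrier) where
      private ∑ = λ xs → foldr _∙_ ε (map w xs)

      fold-map-─ : ∀ {x ys} (x∈ys : Any (x ≡_) ys) → ∑ ys ≈ w x ∙ ∑ (ys ─ x∈ys)
      fold-map-─ (here ≡.refl) = refl
      fold-map-─ {x} {y ∷ ys} (there q) = trans (∙-congˡ (fold-map-─ q)) (x∙yz≈y∙xz (w y) (w x) _)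

      -- Entries of `ys` outside `xs` contribute the neutral element. This extends a product over
      -- the distinct parts of a partition to all sizes up to a bound, and it also compares two
      -- enumerations of the partitions.
      fold-map-support : ∀ xs ys → Unique (≡.setoid A) xs → Unique (≡.setoid A) ys → All (λ x → Any (x ≡_) ys) xs →
        All (λ y → Any (y ≡_) xs ⊎ w y ≈ ε) ys → ∑ xs ≈ ∑ ys
      fold-map-support [] ys _ _ _ triv = sym (go triv)
        where
        go : ∀ {ys} → All (λ y → Any (y ≡_) [] ⊎ w y ≈ ε) ys → ∑ ys ≈ ε
        go [] = refl
        go (inj₂ e ∷ es) = trans (∙-cong e (go es)) (identityˡ ε)
      fold-map-support (x ∷ xs) ys (x∉ ∷ uxs) uys (x∈ys ∷ xs⊆ys) triv = begin
        w x ∙ ∑ xs           ≈⟨ ∙-congˡ (fold-map-support xs (ys ─ x∈ys) uxs (AllPairs-─ x∈ys uys) (⊆-─ (≡.setoid A) x∈ys x∉ xs⊆ys)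
                                  (All.zipWith drop (∉-─ (≡.setoid A) x∈ys uys , All-─ x∈ys triv))) ⟩
        w x ∙ ∑ (ys ─ x∈ys)  ≈⟨ fold-map-─ x∈ys ⟨
        ∑ ys                 ∎
        where
        drop : ∀ {y} → (¬ x ≡ y) × (Any (y ≡_) (x ∷ xs) ⊎ w y ≈ ε) → Any (y ≡_) xs ⊎ w y ≈ ε
        drop (x≢y , inj₁ (here y≡x)) = ⊥-elim (x≢y (≡.sym y≡x))
        drop (x≢y , inj₁ (there i)) = inj₁ i
        drop (x≢y , inj₂ e) = inj₂ e

module RingLemmas {c ℓ} (R : CommutativeRing c ℓ) where
  open CommutativeRing R
  open import Algebra.Solver.Ring.NaturalCoefficients.Default commutativeSemiring using (solve; _:=_; _:+_)

  regroup₅ : ∀ a b c d e → a + b + c + (d + e) ≈ (b + d) + ((a + c) + e)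
  regroup₅ = solve 5 (λ a b c d e → a :+ b :+ c :+ (d :+ e) := (b :+ d) :+ ((a :+ c) :+ e)) refl

  regroup₃ : ∀ x y z → y + (x + z) ≈ (x + y) + z
  regroup₃ = solve 3 (λ x y z → y :+ (x :+ z) := (x :+ y) :+ z) refl

-- Formal power series over a commutative ring.

module Series {c ℓ} (R : CommutativeRing c ℓ) where
  open CommutativeRing R hiding (zero)
  open import Relation.Binary.Reasoning.Setoid setoid
  open import Algebra.Properties.Ring ring using (-0#≈0#)
  open import Algebra.Solver.Ring.NaturalCoefficients.Default commutativeSemiring using (solve; _:=_; _:+_; _:*_)

  infix 4 _≋_
  infixl 7 _✶_ _∙_
  infixl 6 _⊕_

  Series : Set c
  Series = ℕ → Carrier

  record _≋_ (f g : Series) : Set ℓ where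
    constructor mk
    field at : ∀ n → f n ≈ g n
  open _≋_ public

  tail : Series → Series
  tail f n = f (suc n)

  _⊕_ : Series → Series → Series
  (f ⊕ g) n = f n + g n

  ⊖_ : Series → Series
  (⊖ f) n = - f n

  𝟘 𝟙 : Series
  𝟘 _ = 0#
  𝟙 zero = 1#
  𝟙 (suc _) = 0#

  _∙_ : Carrier → Series → Series
  (a ∙ f) n = a * f n

  X : Series → Series
  X f zero = 0#
  X f (suc n) = f n

  X^ : ℕ → Series → Series
  X^ zero f = f
  X^ (suc k) f = X (X^ k f)

  -- The Cauchy product through f = f 0 + X · `tail f`, a form suited to induction; `⊛≡✶` relates it
  -- to the convolution of the statement.
  _✶_ : Series → Series → Series
  (f ✶ g) zero = f zero * g zero
  (f ✶ g) (suc n) = f zero * g (suc n) + (tail f ✶ g) n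

  ≋-isEquivalence : IsEquivalence _≋_
  ≋-isEquivalence = record
    { refl = mk λ _ → refl
    ; sym = λ e → mk λ n → sym (at e n)
    ; trans = λ e e′ → mk λ n → trans (at e n) (at e′ n)
    }

  -- Only coefficients up to `n` enter the n-th coefficient of a product, so infinite products may
  -- be cut off at level `n`.
  ✶-local : ∀ {f f′ g g′} n → (∀ m → m ≤ n → f m ≈ f′ m) → (∀ m → m ≤ n → g m ≈ g′ m) → (f ✶ g) n ≈ (f′ ✶ g′) n
  ✶-local zero e e′ = *-cong (e 0 z≤n) (e′ 0 z≤n)
  ✶-local (suc n) e e′ = +-cong (*-cong (e 0 z≤n) (e′ (suc n) ℕP.≤-refl))
    (✶-local n (λ m m≤n → e (suc m) (s≤s m≤n)) (λ m m≤n → e′ m (ℕP.m≤n⇒m≤1+n m≤n)))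

  ✶-cong : ∀ {f f′ g g′} → f ≋ f′ → g ≋ g′ → f ✶ g ≋ f′ ✶ g′
  ✶-cong e e′ = mk λ n → ✶-local n (λ m _ → at e m) (λ m _ → at e′ m)

  ✶-distribʳ : ∀ h f g → (f ⊕ g) ✶ h ≋ f ✶ h ⊕ g ✶ h
  ✶-distribʳ h f g = mk (go f g)
    where
    go : ∀ f g n → ((f ⊕ g) ✶ h) n ≈ (f ✶ h ⊕ g ✶ h) n
    go f g zero = distribʳ _ _ _
    go f g (suc n) = trans (+-congˡ (go (tail f) (tail g) n))
      (solve 5 (λ a b c x y → (a :+ b) :* c :+ (x :+ y) := (a :* c :+ x) :+ (b :* c :+ y)) refl (f 0) (g 0) (h (suc n)) _ _)

  ∙-✶ : ∀ a f g → a ∙ f ✶ g ≋ a ∙ (f ✶ g)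
  ∙-✶ a f g = mk (go f)
    where
    go : ∀ f n → (a ∙ f ✶ g) n ≈ (a ∙ (f ✶ g)) n
    go f zero = *-assoc _ _ _
    go f (suc n) = trans (+-cong (*-assoc _ _ _) (go (tail f) n)) (sym (distribˡ _ _ _))

  X-✶ : ∀ f g → X f ✶ g ≋ X (f ✶ g)
  X-✶ f g = mk λ where
    zero → zeroˡ _
    (suc n) → trans (+-congʳ (zeroˡ _)) (+-identityˡ _)

  ✶-comm : ∀ f g → f ✶ g ≋ g ✶ f
  ✶-comm f g = mk (comm f g)
    where
    -- The product also unfolds through the constant term of the second factor; commutativity
    -- follows by matching the two recursions.
    right : ∀ f g n → (f ✶ g) (suc n) ≈ f (suc n) * g 0 + (f ✶ tail g) n
    right f g zero = +-comm _ _
    right f g (suc n) = trans (+-congˡ (right (tail f) g n))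
      (solve 3 (λ x y z → x :+ (y :+ z) := y :+ (x :+ z)) refl (f 0 * g (suc (suc n))) _ _)
    comm : ∀ f g n → (f ✶ g) n ≈ (g ✶ f) n
    comm f g zero = *-comm _ _
    comm f g (suc n) = trans (+-cong (*-comm _ _) (comm (tail f) g n)) (sym (right g f n))

  ✶-assoc : ∀ f g h → (f ✶ g) ✶ h ≋ f ✶ (g ✶ h)
  ✶-assoc f g h = mk (go f)
    where
    go : ∀ f n → ((f ✶ g) ✶ h) n ≈ (f ✶ (g ✶ h)) n
    go f zero = *-assoc _ _ _
    go f (suc n) = begin
      f 0 * g 0 * h (suc n) + ((f 0 ∙ tail g ⊕ tail f ✶ g) ✶ h) n
        ≈⟨ +-congˡ (trans (at (✶-distribʳ h _ _) n) (+-cong (at (∙-✶ (f 0) (tail g) h) n) (go (tail f) n))) ⟩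
      f 0 * g 0 * h (suc n) + (f 0 * (tail g ✶ h) n + (tail f ✶ (g ✶ h)) n)
        ≈⟨ solve 5 (λ a b c x y → a :* b :* c :+ (a :* x :+ y) := a :* (b :* c :+ x) :+ y) refl (f 0) (g 0) (h (suc n)) _ _ ⟩
      f 0 * (g 0 * h (suc n) + (tail g ✶ h) n) + (tail f ✶ (g ✶ h)) n ∎

  𝟘-✶ : ∀ f → 𝟘 ✶ f ≋ 𝟘
  𝟘-✶ f = mk go
    where
    go : ∀ n → (𝟘 ✶ f) n ≈ 0#
    go zero = zeroˡ _
    go (suc n) = trans (+-cong (zeroˡ _) (go n)) (+-identityˡ _)

  ✶-identityˡ : ∀ f → 𝟙 ✶ f ≋ f
  ✶-identityˡ f = mk λ where
    zero → *-identityˡ _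
    (suc n) → trans (+-cong (*-identityˡ _) (at (𝟘-✶ f) n)) (+-identityʳ _)

  seriesRing : CommutativeRing c ℓ
  seriesRing = record
    { Carrier = Series ; _≈_ = _≋_ ; _+_ = _⊕_ ; _*_ = _✶_ ; -_ = ⊖_ ; 0# = 𝟘 ; 1# = 𝟙
    ; isCommutativeRing = record
      { isRing = record
        { +-isAbelianGroup = record
          { isGroup = record
            { isMonoid = record
              { isSemigroup = record
                { isMagma = record
                  { isEquivalence = ≋-isEquivalence
                  ; ∙-cong = λ e e′ → mk λ n → +-cong (at e n) (at e′ n) }
                ; assoc = λ _ _ _ → mk λ _ → +-assoc _ _ _ }
              ; identity = (λ _ → mk λ _ → +-identityˡ _) , (λ _ → mk λ _ → +-identityʳ _) }
            ; inverse = (λ _ → mk λ _ → -‿inverseˡ _) , (λ _ → mk λ _ → -‿inverseʳ _)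
            ; ⁻¹-cong = λ e → mk λ n → -‿cong (at e n) }
          ; comm = λ _ _ → mk λ _ → +-comm _ _ }
        ; *-cong = ✶-cong
        ; *-assoc = ✶-assoc
        ; *-identity = ✶-identityˡ , (λ f → ≋-trans (✶-comm f 𝟙) (✶-identityˡ f))
        ; distrib = (λ h f g → ≋-trans (✶-comm h _)
                      (≋-trans (✶-distribʳ h f g) (mk λ n → +-cong (at (✶-comm f h) n) (at (✶-comm g h) n))))
                  , ✶-distribʳ }
      ; *-comm = ✶-comm } }
    where ≋-trans = IsEquivalence.trans ≋-isEquivalence

  module S = CommutativeRing seriesRing

  X-cong : ∀ {f g} → f ≋ g → X f ≋ X g
  X-cong e = mk λ where
    zero → refl
    (suc n) → at e n

  X^-cong : ∀ k {f g} → f ≋ g → X^ k f ≋ X^ k g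
  X^-cong zero e = e
  X^-cong (suc k) e = X-cong (X^-cong k e)

  X^-✶ : ∀ k f g → X^ k f ✶ g ≋ X^ k (f ✶ g)
  X^-✶ zero f g = S.refl
  X^-✶ (suc k) f g = S.trans (X-✶ (X^ k f) g) (X-cong (X^-✶ k f g))

  ∙-cong : ∀ {a b f g} → a ≈ b → f ≋ g → a ∙ f ≋ b ∙ g
  ∙-cong e e′ = mk λ n → *-cong e (at e′ n)

  ✶-∙ : ∀ a f g → f ✶ (a ∙ g) ≋ a ∙ (f ✶ g)
  ✶-∙ a f g = S.trans (✶-comm f (a ∙ g)) (S.trans (∙-✶ a g f) (∙-cong refl (✶-comm g f)))

  X^-< : ∀ {k n} f → n ℕ.< k → X^ k f n ≈ 0#
  X^-< {suc k} {zero} f _ = refl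
  X^-< {suc k} {suc n} f (s≤s n<k) = X^-< f n<k

  X^-+ : ∀ k f n → X^ k f (k ℕ.+ n) ≈ f n
  X^-+ zero f n = refl
  X^-+ (suc k) f n = X^-+ k f n

  open import Algebra.Properties.Ring S.ring using (-‿distribˡ-*)

  -- Multiplication by 1 - X^s, written as a difference so that it reads directly as the removal of
  -- the multiples of one atom of degree s.
  δ : ℕ → Series → Series
  δ s f = f ⊕ ⊖ X^ s f

  δ-cong : ∀ s {f g} → f ≋ g → δ s f ≋ δ s g
  δ-cong s e = S.+-cong e (S.-‿cong (X^-cong s e))

  δ-✶ˡ : ∀ s f g → δ s f ✶ g ≋ δ s (f ✶ g)
  δ-✶ˡ s f g = S.trans (✶-distribʳ g f (⊖ X^ s f))
    (S.+-congˡ (S.trans (S.sym (-‿distribˡ-* (X^ s f) g)) (S.-‿cong (X^-✶ s f g))))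

  δ^ : ℕ → ℕ → Series → Series
  δ^ zero s f = f
  δ^ (suc k) s f = δ s (δ^ k s f)

  δ^-cong : ∀ k s {f g} → f ≋ g → δ^ k s f ≋ δ^ k s g
  δ^-cong zero s e = e
  δ^-cong (suc k) s e = δ-cong s (δ^-cong k s e)

  δ^-✶ˡ : ∀ k s f g → δ^ k s f ✶ g ≋ δ^ k s (f ✶ g)
  δ^-✶ˡ zero s f g = S.refl
  δ^-✶ˡ (suc k) s f g = S.trans (δ-✶ˡ s (δ^ k s f) g) (δ-cong s (δ^-✶ˡ k s f g))

  δ^-✶ʳ : ∀ k s f g → f ✶ δ^ k s g ≋ δ^ k s (f ✶ g)
  δ^-✶ʳ k s f g = S.trans (✶-comm f (δ^ k s g)) (S.trans (δ^-✶ˡ k s g f) (δ^-cong k s (✶-comm g f)))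

  -- spread e f j is X^j f(X^(e+1)).
  spread : ℕ → Series → ℕ → Series
  spread e f zero zero = f 0
  spread e f zero (suc n) = spread e (tail f) e n
  spread e f (suc j) zero = 0#
  spread e f (suc j) (suc n) = spread e f j n

  dilate : ℕ → Series → Series
  dilate e f = spread e f 0

  spread≋X^ : ∀ e f j → spread e f j ≋ X^ j (dilate e f)
  spread≋X^ e f j = mk (go j)
    where
    go : ∀ j n → spread e f j n ≈ X^ j (dilate e f) n
    go zero n = refl
    go (suc j) zero = refl
    go (suc j) (suc n) = go j n

  spread-cong : ∀ e {f g} j → f ≋ g → spread e f j ≋ spread e g j
  spread-cong e j eq = mk (go eq j)
    where
    go : ∀ {f g} → f ≋ g → ∀ j n → spread e f j n ≈ spread e g j n
    go eq zero zero = at eq 0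
    go eq zero (suc n) = go (mk λ n → at eq (suc n)) e n
    go eq (suc j) zero = refl
    go eq (suc j) (suc n) = go eq j n

  dilate-⊕ : ∀ e f g → dilate e (f ⊕ g) ≋ dilate e f ⊕ dilate e g
  dilate-⊕ e f g = mk (go f g 0)
    where
    go : ∀ f g j n → spread e (f ⊕ g) j n ≈ spread e f j n + spread e g j n
    go f g zero zero = refl
    go f g zero (suc n) = go (tail f) (tail g) e n
    go f g (suc j) zero = sym (+-identityˡ _)
    go f g (suc j) (suc n) = go f g j n

  dilate-⊖ : ∀ e f → dilate e (⊖ f) ≋ ⊖ dilate e f
  dilate-⊖ e f = mk (go f 0)
    where
    go : ∀ f j n → spread e (⊖ f) j n ≈ - spread e f j n
    go f zero zero = refl
    go f zero (suc n) = go (tail f) e n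
    go f (suc j) zero = sym -0#≈0#
    go f (suc j) (suc n) = go f j n

  dilate-tail : ∀ e f → dilate e f ≋ f 0 ∙ 𝟙 ⊕ X^ (suc e) (dilate e (tail f))
  dilate-tail e f = mk λ where
    zero → sym (trans (+-identityʳ _) (*-identityʳ _))
    (suc n) → trans (at (spread≋X^ e (tail f) e) n) (sym (trans (+-congʳ (zeroʳ _)) (+-identityˡ _)))

  dilate-X : ∀ e f → dilate e (X f) ≋ X^ (suc e) (dilate e f)
  dilate-X e f = S.trans (dilate-tail e (X f)) (S.trans (S.+-congʳ {X^ (suc e) (dilate e f)} (mk λ n → zeroˡ _)) (S.+-identityˡ _))

  -- Substituting X^(e+1) for X turns the factor 1 - X into 1 - X^(e+1).
  dilate-δ : ∀ e f → dilate e (δ 1 f) ≋ δ (suc e) (dilate e f)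
  dilate-δ e f = S.trans (dilate-⊕ e f (⊖ X f)) (S.+-congˡ (S.trans (dilate-⊖ e (X f)) (S.-‿cong (dilate-X e f))))

  dilate-𝟙 : ∀ e → dilate e 𝟙 ≋ 𝟙
  dilate-𝟙 e = S.trans (dilate-tail e 𝟙) (S.trans (S.+-cong (mk λ n → *-identityˡ _)
    (S.trans (X^-cong (suc e) dilate-𝟘) (X^-𝟘 {suc e}))) (S.+-identityʳ 𝟙))
    where
    dilate-𝟘 : dilate e 𝟘 ≋ 𝟘
    dilate-𝟘 = mk (go 0)
      where
      go : ∀ j n → spread e 𝟘 j n ≈ 0#
      go zero zero = refl
      go zero (suc n) = go e n
      go (suc j) zero = refl
      go (suc j) (suc n) = go j n
    X^-𝟘 : ∀ {k} → X^ k 𝟘 ≋ 𝟘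
    X^-𝟘 {zero} = S.refl
    X^-𝟘 {suc k} = S.trans (X-cong (X^-𝟘 {k})) (mk λ where
      zero → refl
      (suc n) → refl)

-- Arithmetic of finite fields: powers, Frobenius, roots of polynomials.

module Field {c ℓ} (F : FiniteField c ℓ) where
  open Counting
  open import Data.Fin as Fin using (Fin)
  import Data.Fin.Properties as FinP
  open import Data.Nat.Combinatorics using (_C_; nCk+nC[k+1]≡[n+1]C[k+1]; nCn≡1; k>n⇒nCk≡0)
  open import Data.Nat.Divisibility using (_∣_; divides; ∣⇒≤)
  open import Data.Nat.Primality using (Prime; euclidsLemma)
  import Data.Nat.Solver as ℕSolver
  import Data.Vec.Functional as VecF
  open FiniteField F hiding (zero)
  open import Algebra.Properties.Group +-group using (∙-cancelˡ; ∙-cancelʳ)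
  open import Algebra.Properties.Semiring.Exp semiring using (_^_; ^-congʳ)
  open import Algebra.Properties.Semiring.Mult semiring using (×-assoc-*; ×-congʳ; ×-assocˡ) renaming (_×_ to _⋆_)
  open import Algebra.Properties.Monoid.Sum +-monoid using (sum; sum-cong-≋; sum-init-last; sum-replicate-zero)
  open import Algebra.Properties.CommutativeSemiring.Binomial commutativeSemiring using (binomialTerm) renaming (theorem to binomial-theorem)
  open import Algebra.Solver.Ring.NaturalCoefficients.Default commutativeSemiring using (solve; _:=_; _:+_; _:*_)
  open import Relation.Binary.Reasoning.Setoid setoid

  *-cancelˡ-≉0 : ∀ a {x y} → ¬ a ≈ 0# → a * x ≈ a * y → x ≈ y
  *-cancelˡ-≉0 a {x} {y} a≉0 e = begin
    x              ≈⟨ lem x ⟨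
    a ⁻¹ * (a * x) ≈⟨ *-congˡ e ⟩
    a ⁻¹ * (a * y) ≈⟨ lem y ⟩
    y              ∎
    where
    lem : ∀ z → a ⁻¹ * (a * z) ≈ z
    lem z = trans (sym (*-assoc _ _ _)) (trans (*-congʳ (trans (*-comm _ _) (inverse a a≉0))) (*-identityˡ z))

  *-≉0 : ∀ {x y} → ¬ x ≈ 0# → ¬ y ≈ 0# → ¬ x * y ≈ 0#
  *-≉0 {x} x≉0 y≉0 e = y≉0 (*-cancelˡ-≉0 x x≉0 (trans e (sym (zeroʳ x))))

  1≉0 : ¬ 1# ≈ 0#
  1≉0 = 0≉1 ∘ sym

  ^-≉0 : ∀ {x} n → ¬ x ≈ 0# → ¬ x ^ n ≈ 0#
  ^-≉0 zero x≉0 = 1≉0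
  ^-≉0 (suc n) x≉0 = *-≉0 x≉0 (^-≉0 n x≉0)

  unit≉0 : ∀ {x y} → x * y ≈ 1# → ¬ x ≈ 0#
  unit≉0 e x≈0 = 1≉0 (trans (sym e) (trans (*-congʳ x≈0) (zeroˡ _)))

  card-F : Card setoid (λ _ → ⊤) order
  card-F = card elements ≡.refl distinct (All.universal (λ _ → tt) elements) (λ {x} _ → complete x)

  -- Adding 1 permutes the elements, so comparing their sums gives order ⋆ 1 = 0.
  order⋆1≈0 : order ⋆ 1# ≈ 0#
  order⋆1≈0 = ∙-cancelʳ (foldr _+_ 0# elements) (order ⋆ 1#) 0# (begin
    order ⋆ 1# + foldr _+_ 0# elements   ≈⟨ fold-translate elements ⟨
    foldr _+_ 0# (map (1# +_) elements)  ≈⟨ fold-unique-⊆ +-commutativeMonoid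
                                              (AllPairsP.map⁺ (AllPairs.map (λ ne e → ne (cancel e)) distinct))
                                              (All.universal complete _) (≡.sym (length-map (1# +_) elements)) ⟩
    foldr _+_ 0# elements                ≈⟨ +-identityˡ _ ⟨
    0# + foldr _+_ 0# elements           ∎)
    where
    cancel : ∀ {x y} → 1# + x ≈ 1# + y → x ≈ y
    cancel = ∙-cancelˡ 1# _ _
    fold-translate : ∀ xs → foldr _+_ 0# (map (1# +_) xs) ≈ length xs ⋆ 1# + foldr _+_ 0# xs
    fold-translate [] = sym (+-identityˡ _)
    fold-translate (x ∷ xs) = trans (+-congˡ (fold-translate xs))
      (solve 4 (λ o x a b → (o :+ x) :+ (a :+ b) := (o :+ a) :+ (x :+ b)) refl 1# x _ _)

  -- Multiplication by `a` permutes the nonzero elements. Their product Π is therefore equal to a^N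
  -- Π, and Π can be cancelled because it is nonzero.
  fermat : ∀ {N} → suc N ≡ order → ∀ a → ¬ a ≈ 0# → a ^ N ≈ 1#
  fermat {N} 1+N≡order a a≉0 with card-split setoid (_≟ 0#) (λ e e′ → trans (sym e) e′) card-F
  ... | k , l , C₀ , C≉0 , k+l≡order = trans (^-congʳ a N≡l) (*-cancelˡ-≉0 Π Π≉0 (begin
    Π * a ^ l                     ≈⟨ *-comm _ _ ⟩
    a ^ l * Π                     ≈⟨ *-congʳ (^-congʳ a (Card.size C≉0)) ⟨
    a ^ length xs * Π             ≈⟨ fold-scale xs ⟨
    foldr _*_ 1# (map (a *_) xs)  ≈⟨ fold-unique-⊆ *-commutativeMonoid
                                       (AllPairsP.map⁺ (AllPairs.map (λ ne e → ne (*-cancelˡ-≉0 a a≉0 e)) (Card.unique C≉0)))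
                                       (AllP.map⁺ (All.map (λ (_ , x≉0) → Card.complete C≉0 (tt , *-≉0 a≉0 x≉0)) (Card.sound C≉0)))
                                       (≡.sym (length-map (a *_) xs)) ⟩
    Π                             ≈⟨ *-identityʳ Π ⟨
    Π * 1#                        ∎))
    where
    xs = Card.list C≉0
    Π = foldr _*_ 1# xs
    N≡l : N ≡ l
    N≡l = ℕP.suc-injective (≡.trans 1+N≡order (≡.trans (≡.sym k+l≡order)
      (≡.cong (ℕ._+ l) (card-unique setoid C₀ (card-singleton setoid (tt , refl) proj₂)))))
    prod≉0 : ∀ {xs} → All (λ x → ⊤ × (¬ x ≈ 0#)) xs → ¬ foldr _*_ 1# xs ≈ 0#
    prod≉0 [] = 1≉0
    prod≉0 ((_ , x≉0) ∷ nz) = *-≉0 x≉0 (prod≉0 nz)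
    Π≉0 = prod≉0 (Card.sound C≉0)
    fold-scale : ∀ xs → foldr _*_ 1# (map (a *_) xs) ≈ a ^ length xs * foldr _*_ 1# xs
    fold-scale [] = sym (*-identityˡ _)
    fold-scale (x ∷ xs) = trans (*-congˡ (fold-scale xs))
      (solve 4 (λ o x a b → (o :* x) :* (a :* b) := (o :* a) :* (x :* b)) refl a x _ _)

  -- An induction over Pascal's triangle. It exhibits a multiple of n + 1 with the binomial
  -- coefficient as a factor, ready for Euclid's lemma.
  absorption : ∀ n k → suc k ℕ.* (suc n C suc k) ≡ suc n ℕ.* (n C k)
  absorption zero zero = ≡.refl
  absorption zero (suc k) = ≡.trans (≡.cong (suc (suc k) ℕ.*_) (k>n⇒nCk≡0 {1} {suc (suc k)} (s≤s (s≤s z≤n))))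
    (ℕP.*-zeroʳ (suc (suc k)))
  absorption (suc n) zero = ≡.trans (≡.cong (1 ℕ.*_) (≡.sym (nCk+nC[k+1]≡[n+1]C[k+1] (suc n) 0)))
    (≡.trans (≡.cong (λ z → 1 ℕ.* (1 ℕ.+ z)) (≡.trans (≡.sym (ℕP.*-identityˡ _)) (absorption n 0)))
      (solveℕ 1 (λ n → con 1 :*ℕ (con 1 :+ℕ (con 1 :+ℕ n) :*ℕ con 1) :=ℕ (con 2 :+ℕ n) :*ℕ con 1) ≡.refl n))
    where open ℕSolver.+-*-Solver using (con) renaming (solve to solveℕ; _:*_ to _:*ℕ_; _:+_ to _:+ℕ_; _:=_ to _:=ℕ_)
  absorption (suc n) (suc k) = R.begin
    suc (suc k) ℕ.* (suc (suc n) C suc (suc k))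
      R.≡⟨ ≡.cong (suc (suc k) ℕ.*_) (nCk+nC[k+1]≡[n+1]C[k+1] (suc n) (suc k)) ⟨
    suc (suc k) ℕ.* (x ℕ.+ y)
      R.≡⟨ solveℕ 3 (λ k a b → (con 2 :+ℕ k) :*ℕ (a :+ℕ b) :=ℕ a :+ℕ ((con 1 :+ℕ k) :*ℕ a :+ℕ (con 2 :+ℕ k) :*ℕ b)) ≡.refl k x y ⟩
    x ℕ.+ (suc k ℕ.* x ℕ.+ suc (suc k) ℕ.* y)
      R.≡⟨ ≡.cong (x ℕ.+_) (≡.cong₂ ℕ._+_ (absorption n k) (absorption n (suc k))) ⟩
    x ℕ.+ (suc n ℕ.* (n C k) ℕ.+ suc n ℕ.* (n C suc k))
      R.≡⟨ ≡.cong (x ℕ.+_) (ℕP.*-distribˡ-+ (suc n) (n C k) (n C suc k)) ⟨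
    x ℕ.+ suc n ℕ.* (n C k ℕ.+ n C suc k)
      R.≡⟨ ≡.cong (λ z → x ℕ.+ suc n ℕ.* z) (nCk+nC[k+1]≡[n+1]C[k+1] n k) ⟩
    suc (suc n) ℕ.* x R.∎
    where
    module R = ≡.≡-Reasoning
    x = suc n C suc k
    y = suc n C suc (suc k)
    open ℕSolver.+-*-Solver using (con) renaming (solve to solveℕ; _:*_ to _:*ℕ_; _:+_ to _:+ℕ_; _:=_ to _:=ℕ_)

  -- By `absorption` the prime `suc p` divides k + 1 times the coefficient, and k + 1 is smaller
  -- than the prime.
  prime∣C : ∀ {p k} → Prime (suc p) → k ℕ.< p → suc p ∣ suc p C suc k
  prime∣C {p} {k} pr k<p with euclidsLemma (suc k) (suc p C suc k) pr
    (divides (p C k) (≡.trans (absorption p k) (ℕP.*-comm (suc p) _)))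
  ... | inj₁ p∣k = ⊥-elim (ℕP.<⇒≱ (s≤s k<p) (∣⇒≤ p∣k))
  ... | inj₂ p∣C = p∣C

  -- In the binomial expansion every term but the two extreme ones has a coefficient divisible by
  -- the prime, hence vanishes.
  frobenius-+ : ∀ {p} → Prime p → p ⋆ 1# ≈ 0# → ∀ x y → (x + y) ^ p ≈ x ^ p + y ^ p
  frobenius-+ {suc p} pr p⋆1≈0 x y = begin
    (x + y) ^ suc p                                  ≈⟨ binomial-theorem (suc p) x y ⟩
    t Fin.zero + sum (t ∘ Fin.suc)                   ≈⟨ +-congˡ (sum-init-last (t ∘ Fin.suc)) ⟩
    t Fin.zero + (sum (VecF.init (t ∘ Fin.suc)) + t (Fin.suc (Fin.fromℕ p)))
      ≈⟨ +-cong first (+-cong (trans (sum-cong-≋ middle) (sum-replicate-zero p)) final) ⟩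
    y ^ suc p + (0# + x ^ suc p)                     ≈⟨ trans (+-congˡ (+-identityˡ _)) (+-comm _ _) ⟩
    x ^ suc p + y ^ suc p                            ∎
    where
    t = binomialTerm x y (suc p)
    p⋆≈0 : ∀ z → suc p ⋆ z ≈ 0#
    p⋆≈0 z = trans (×-congʳ (suc p) (sym (*-identityˡ z)))
      (trans (sym (×-assoc-* (suc p) 1# z)) (trans (*-congʳ p⋆1≈0) (zeroˡ z)))
    ∣⋆≈0 : ∀ {m} → suc p ∣ m → ∀ z → m ⋆ z ≈ 0#
    ∣⋆≈0 (divides d ≡.refl) z = trans (reflexive (≡.cong (_⋆ z) (ℕP.*-comm d (suc p))))
      (trans (sym (×-assocˡ z (suc p) d)) (p⋆≈0 (d ⋆ z)))
    first : t Fin.zero ≈ y ^ suc p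
    first = trans (+-identityʳ _) (*-identityˡ _)
    middle : ∀ i → VecF.init (t ∘ Fin.suc) i ≈ 0#
    middle i = ∣⋆≈0 (prime∣C pr (≡.subst (ℕ._< p) (≡.sym (FinP.toℕ-inject₁ i)) (FinP.toℕ<n i))) _
    final : t (Fin.suc (Fin.fromℕ p)) ≈ x ^ suc p
    final = trans (reflexive (≡.cong (λ k → (suc p C suc k) ⋆ (x ^ suc k * y ^ (p ℕ.∸ k))) (FinP.toℕ-fromℕ p)))
      (trans (reflexive (≡.cong₂ (λ a b → a ⋆ (x ^ suc p * y ^ b)) (nCn≡1 (suc p)) (ℕP.n∸n≡0 p)))
        (trans (+-identityʳ _) (*-identityʳ _)))

  -- Horner's scheme for the monic polynomial whose lower coefficients form the vector: the value 1
  -- at the empty vector is the leading coefficient.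
  eval : ∀ {n} → Vec Carrier n → Carrier → Carrier
  eval [] x = 1#
  eval (a ∷ v) x = a + x * eval v x

  -- Division of a monic polynomial v by X - r, with both sides moved so that no subtraction occurs.
  quotient : ∀ {n} (v : Vec Carrier (suc n)) r →
    Σ (Vec Carrier n) λ w → ∀ x → eval v x + r * eval w x ≈ eval v r + x * eval w x
  quotient (a ∷ []) r = [] , λ x → solve 4 (λ a x r e → a :+ x :* e :+ r :* e := a :+ r :* e :+ x :* e) refl a x r 1#
  quotient (a ∷ v@(_ ∷ _)) r with quotient v r
  ... | w , e = eval v r ∷ w , λ x → begin
    a + x * eval v x + r * (eval v r + x * eval w x)
      ≈⟨ solve 6 (λ a x r e f g → a :+ x :* e :+ r :* (f :+ x :* g) := a :+ r :* f :+ x :* (e :+ r :* g)) refl a x r _ _ _ ⟩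
    a + r * eval v r + x * (eval v x + r * eval w x)
      ≈⟨ +-congˡ (*-congˡ (e x)) ⟩
    a + r * eval v r + x * (eval v r + x * eval w x) ∎

  -- Dividing by X - r leaves a monic quotient w of degree one less. At another root x the division
  -- gives w(x) r = w(x) x, so w(x) = 0 since r and x differ.
  roots-≤-degree : ∀ n (v : Vec Carrier n) xs → Unique setoid xs → All (λ x → eval v x ≈ 0#) xs → length xs ≤ n
  roots-≤-degree n v [] _ _ = z≤n
  roots-≤-degree zero [] (x ∷ xs) _ (e ∷ _) = ⊥-elim (1≉0 e)
  roots-≤-degree (suc n) v (r ∷ xs) (r∉ ∷ u) (er ∷ es) with quotient v r
  ... | w , e = s≤s (roots-≤-degree n w xs u (All.zipWith root (r∉ , es)))
    where
    root : ∀ {x} → (¬ r ≈ x) × eval v x ≈ 0# → eval w x ≈ 0#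
    root {x} (r≉x , ex) with eval w x ≟ 0#
    ... | yes z = z
    ... | no nz = ⊥-elim (r≉x (*-cancelˡ-≉0 (eval w x) nz (begin
      eval w x * r                ≈⟨ *-comm _ _ ⟩
      r * eval w x                ≈⟨ +-identityˡ _ ⟨
      0# + r * eval w x           ≈⟨ +-congʳ ex ⟨
      eval v x + r * eval w x     ≈⟨ e x ⟩
      eval v r + x * eval w x     ≈⟨ +-congʳ er ⟩
      0# + x * eval w x           ≈⟨ +-identityˡ _ ⟩
      x * eval w x                ≈⟨ *-comm _ _ ⟩
      eval w x * x                ∎)))

  eval-replicate : ∀ n x → eval (Vec.replicate n 0#) x ≈ x ^ n
  eval-replicate zero x = refl
  eval-replicate (suc n) x = trans (+-identityˡ _) (*-congˡ (eval-replicate n x))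

-- The conjugation x ↦ x^q and two solution counts attached to it.

module Conjugation {c ℓ} (F : FiniteField c ℓ) (q : ℕ) (q-pp : IsPrimePower q) (order≡q² : FiniteField.order F ≡ q ℕ.* q) where
  open Counting
  open Field F
  open import Data.Nat.Primality using (prime⇒nonTrivial; prime⇒nonZero)
  import Data.Nat.Solver as ℕSolver
  open FiniteField F hiding (zero)
  open Poly F q using (pow; bar)
  open import Algebra.Properties.Group +-group using (x∙y⁻¹≈ε⇒x≈y; x≈y⇒x∙y⁻¹≈ε; inverseʳ-unique)
  open import Algebra.Properties.Ring ring using (-‿distribʳ-*; -‿distribˡ-*)
  open import Algebra.Properties.Semiring.Exp semiring using (_^_; ^-assocʳ; ^-congˡ; ^-congʳ)
  open import Algebra.Properties.CommutativeSemiring.Exp commutativeSemiring using (^-distrib-*)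
  open import Algebra.Properties.Semiring.Mult semiring using (×1-homo-*) renaming (_×_ to _⋆_)
  open import Algebra.Solver.Ring.NaturalCoefficients.Default commutativeSemiring using (solve; _:=_; _:+_; _:*_)
  open import Relation.Binary.Reasoning.Setoid setoid

  private
    p = proj₁ q-pp
    e = proj₁ (proj₂ q-pp)
    p-prime = proj₁ (proj₂ (proj₂ q-pp))
    q≡p^e = proj₂ (proj₂ (proj₂ (proj₂ q-pp)))

  2≤q : 2 ≤ q
  2≤q = ≡.subst (2 ≤_) (≡.sym q≡p^e) (ℕP.≤-trans (ℕ.nonTrivial⇒n>1 p {{prime⇒nonTrivial p-prime}}) p≤p^e)
    where
    p≤p^e : p ≤ p ℕ.^ e
    p≤p^e = ≡.subst (_≤ p ℕ.^ e) (ℕP.*-identityʳ p)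
      (ℕP.^-monoʳ-≤ p {{prime⇒nonZero p-prime}} (proj₁ (proj₂ (proj₂ (proj₂ q-pp)))))

  q-2 : ℕ
  q-2 = q ℕ.∸ 2

  q≡2+q-2 : q ≡ suc (suc q-2)
  q≡2+q-2 = ≡.sym (ℕP.m+[n∸m]≡n 2≤q)

  -- The number of elements annihilates 1; it is q², a power of `p`, and a field has no zero
  -- divisors.
  p⋆1≈0 : p ⋆ 1# ≈ 0#
  p⋆1≈0 with (p ⋆ 1#) ≟ 0#
  ... | yes z = z
  ... | no nz = ⊥-elim (*-≉0 q≉0 q≉0 (trans (sym (×1-homo-* q q)) (trans (reflexive (≡.cong (_⋆ 1#) (≡.sym order≡q²))) order⋆1≈0)))
    where
    ^⋆ : ∀ k → (p ℕ.^ k) ⋆ 1# ≈ (p ⋆ 1#) ^ k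
    ^⋆ zero = +-identityʳ _
    ^⋆ (suc k) = trans (×1-homo-* p (p ℕ.^ k)) (*-congˡ (^⋆ k))
    q≉0 : ¬ q ⋆ 1# ≈ 0#
    q≉0 z = ^-≉0 e nz (trans (sym (^⋆ e)) (trans (reflexive (≡.cong (_⋆ 1#) (≡.sym q≡p^e))) z))

  pow≡^ : ∀ x n → pow x n ≡ x ^ n
  pow≡^ x zero = ≡.refl
  pow≡^ x (suc n) = ≡.cong (x *_) (pow≡^ x n)

  bar≡^ : ∀ x → bar x ≡ x ^ q
  bar≡^ x = pow≡^ x q

  bar-≈^ : ∀ x → bar x ≈ x ^ q
  bar-≈^ x = reflexive (bar≡^ x)

  bar-cong : ∀ {x y} → x ≈ y → bar x ≈ bar y
  bar-cong {x} {y} x≈y = trans (bar-≈^ x) (trans (^-congˡ q x≈y) (sym (bar-≈^ y)))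

  bar-* : ∀ x y → bar (x * y) ≈ bar x * bar y
  bar-* x y = trans (bar-≈^ (x * y)) (trans (^-distrib-* x y q) (sym (*-cong (bar-≈^ x) (bar-≈^ y))))

  bar-+ : ∀ x y → bar (x + y) ≈ bar x + bar y
  bar-+ x y = trans (bar-≈^ (x + y)) (trans (≡.subst (λ n → (x + y) ^ n ≈ x ^ n + y ^ n) (≡.sym q≡p^e) (iterate e x y))
    (sym (+-cong (bar-≈^ x) (bar-≈^ y))))
    where
    iterate : ∀ k x y → (x + y) ^ (p ℕ.^ k) ≈ x ^ (p ℕ.^ k) + y ^ (p ℕ.^ k)
    iterate zero x y = trans (*-identityʳ _) (sym (+-cong (*-identityʳ _) (*-identityʳ _)))
    iterate (suc k) x y = begin
      (x + y) ^ (p ℕ.* p ℕ.^ k)                   ≈⟨ ^-assocʳ _ p _ ⟨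
      ((x + y) ^ p) ^ (p ℕ.^ k)                   ≈⟨ ^-congˡ (p ℕ.^ k) (frobenius-+ p-prime p⋆1≈0 x y) ⟩
      (x ^ p + y ^ p) ^ (p ℕ.^ k)                 ≈⟨ iterate k _ _ ⟩
      (x ^ p) ^ (p ℕ.^ k) + (y ^ p) ^ (p ℕ.^ k)   ≈⟨ +-cong (^-assocʳ x p _) (^-assocʳ y p _) ⟩
      x ^ (p ℕ.* p ℕ.^ k) + y ^ (p ℕ.* p ℕ.^ k)   ∎

  bar-0 : bar 0# ≈ 0#
  bar-0 = trans (bar-≈^ 0#) (trans (^-congʳ 0# q≡2+q-2) (zeroˡ _))

  bar-1 : bar 1# ≈ 1#
  bar-1 = trans (bar-≈^ 1#) (one q)
    where
    one : ∀ n → 1# ^ n ≈ 1#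
    one zero = refl
    one (suc n) = trans (*-identityˡ _) (one n)

  bar-neg : ∀ x → bar (- x) ≈ - bar x
  bar-neg x = inverseʳ-unique (bar x) (bar (- x)) (trans (sym (bar-+ x (- x))) (trans (bar-cong (-‿inverseʳ x)) bar-0))

  bar-≉0 : ∀ {x} → ¬ x ≈ 0# → ¬ bar x ≈ 0#
  bar-≉0 {x} nz z = ^-≉0 q nz (trans (sym (bar-≈^ x)) z)

  private
    -- q² - 1 = (q - 1)(q + 1), kept in the factored form in which `fibre-full` uses it.
    N-1 = suc q-2 ℕ.* suc q
    1+N-1≡order : suc N-1 ≡ order
    1+N-1≡order = ≡.sym (≡.trans order≡q² (≡.trans (≡.cong₂ ℕ._*_ q≡2+q-2 q≡2+q-2)
      (≡.trans (ar q-2) (≡.cong (λ z → suc (suc q-2 ℕ.* suc z)) (≡.sym q≡2+q-2)))))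
      where
      open ℕSolver.+-*-Solver using (con) renaming (solve to solveℕ; _:*_ to _:*ℕ_; _:+_ to _:+ℕ_; _:=_ to _:=ℕ_)
      ar : ∀ k → suc (suc k) ℕ.* suc (suc k) ≡ suc (suc k ℕ.* suc (suc (suc k)))
      ar = solveℕ 1 (λ k → (con 2 :+ℕ k) :*ℕ (con 2 :+ℕ k) :=ℕ con 1 :+ℕ (con 1 :+ℕ k) :*ℕ (con 3 :+ℕ k)) ≡.refl

  -- The double conjugate is the power with exponent q² = 1 + (q² - 1); Fermat's theorem disposes of
  -- the second summand for units.
  bar-bar : ∀ x → bar (bar x) ≈ x
  bar-bar x = trans (bar-≈^ (bar x)) (trans (^-congˡ q (bar-≈^ x)) (trans (^-assocʳ x q q)
      (trans (^-congʳ x (≡.trans (≡.sym order≡q²) (≡.sym 1+N-1≡order))) x*x^N-1≈x)))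
    where
    x*x^N-1≈x : x * x ^ N-1 ≈ x
    x*x^N-1≈x with x ≟ 0#
    ... | yes z = trans (*-congʳ z) (trans (zeroˡ _) (sym z))
    ... | no nz = trans (*-congˡ (fermat 1+N-1≡order x nz)) (*-identityʳ x)

  card-≉0 : Card setoid (λ x → ¬ x ≈ 0#) N-1
  card-≉0 with card-split setoid (_≟ 0#) (λ e e′ → trans (sym e) e′) card-F
  ... | k , l , C₀ , C₁ , k+l≡order = ≡.subst (Card setoid _) l≡N-1 (card-⇔ setoid proj₂ (tt ,_) C₁)
    where
    l≡N-1 : l ≡ N-1
    l≡N-1 = ℕP.suc-injective (≡.trans (≡.sym (≡.trans (≡.sym k+l≡order)
      (≡.cong (ℕ._+ l) (card-unique setoid C₀ (card-singleton setoid (tt , refl) proj₂))))) (≡.sym 1+N-1≡order))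

  norm : Carrier → Carrier
  norm x = x * bar x

  norm-cong : ∀ {x y} → x ≈ y → norm x ≈ norm y
  norm-cong e = *-cong e (bar-cong e)

  -- The norm maps the q² - 1 units to the at most q - 1 roots of X^(q-1) - 1, with fibres of at most q + 1 elements.
  card-norm1 : Card setoid (λ x → norm x ≈ 1#) (suc q)
  card-norm1 = card-⇔ setoid proj₂ (λ e → unit≉0 e , e)
      (fibre-full setoid setoid _≟_ norm norm-cong (suc q) bound 1# zs
        (roots-≤-degree (suc q-2) fixpoly (1# ∷ zs)
          (All.map (λ (_ , ne) e → ne (sym e)) (AllP.all-filter D? elements) ∷ AllPairsP.filter⁺ D? distinct)
          (fixpoly-root (one (suc q-2)) ∷ All.map (fixpoly-root ∘ proj₁) (AllP.all-filter D? elements)))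
        values card-≉0)
    where
    one : ∀ n → 1# ^ n ≈ 1#
    one zero = refl
    one (suc n) = trans (*-identityˡ _) (one n)
    -- The roots of X^(q-1) - 1 other than 1. Together with 1 they form a list of roots without
    -- repetitions, so they number at most q - 2, which is what `fibre-full` allows besides the
    -- value 1.
    D? = λ x → ((x ^ suc q-2) ≟ 1#) ×-dec ¬? (x ≟ 1#)
    zs = filter D? elements
    fixpoly : Vec Carrier (suc q-2)
    fixpoly = - 1# ∷ Vec.replicate q-2 0#
    fixpoly-root : ∀ {x} → x ^ suc q-2 ≈ 1# → eval fixpoly x ≈ 0#
    fixpoly-root {x} e = trans (+-congˡ (trans (*-congˡ (eval-replicate q-2 x)) e)) (-‿inverseˡ 1#)
    bound : ∀ z ys → Unique setoid ys → All (λ y → (¬ y ≈ 0#) × norm y ≈ z) ys → length ys ≤ suc q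
    bound z ys u all = roots-≤-degree (suc q) (- z ∷ Vec.replicate q 0#) ys u (All.map root all)
      where
      root : ∀ {y} → (¬ y ≈ 0#) × norm y ≈ z → eval (- z ∷ Vec.replicate q 0#) y ≈ 0#
      root {y} (_ , e) = trans (+-congˡ (trans (*-congˡ (trans (eval-replicate q y) (sym (bar-≈^ y)))) e)) (-‿inverseˡ z)
    values : ∀ {x} → ¬ x ≈ 0# → norm x ≈ 1# ⊎ Any (norm x ≈_) zs
    values {x} nz with norm x ≟ 1#
    ... | yes e = inj₁ e
    ... | no ne = inj₂ (Sum.[ id , (λ ¬d → ⊥-elim (¬d (conds (AnyP.lookup-result i)))) ]′ (AnyP.filter⁺ D? i))
      where
      i = complete (norm x)
      -- A norm is fixed by `bar`, so its q-th power is itself; cancelling one factor makes it a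
      -- root of X^(q-1) - 1.
      fixed : bar (norm x) ≈ norm x
      fixed = trans (bar-* x (bar x)) (trans (*-congˡ (bar-bar x)) (*-comm _ _))
      conds : ∀ {y} → norm x ≈ y → y ^ suc q-2 ≈ 1# × (¬ y ≈ 1#)
      conds e = trans (^-congˡ (suc q-2) (sym e)) (*-cancelˡ-≉0 (norm x) (*-≉0 nz (bar-≉0 nz))
          (trans (reflexive (≡.cong (norm x ^_) (≡.sym q≡2+q-2))) (trans (sym (bar-≈^ (norm x))) (trans fixed (sym (*-identityʳ _))))))
        , λ e′ → ne (trans e e′)

  -- For norm u = 1, the image of x ↦ bar x - u x lies in the kernel of y ↦ bar y + bar u y,
  -- which has at most q elements, just like the fibres.
  card-twisted-fixed : ∀ u → norm u ≈ 1# → Card setoid (λ x → u * x ≈ bar x) q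
  card-twisted-fixed u norm-u = card-⇔ setoid (λ (_ , e) → sym (x∙y⁻¹≈ε⇒x≈y _ _ e)) (λ e → tt , x≈y⇒x∙y⁻¹≈ε (sym e))
      (fibre-full setoid setoid _≟_ f f-cong q bound 0# zs
        (roots-≤q 0# (bar u) (0# ∷ zs)
          (All.map (λ (_ , ne) e → ne (sym e)) (AllP.all-filter D? elements) ∷ AllPairsP.filter⁺ D? distinct)
          (kernel0 ∷ All.map proj₁ (AllP.all-filter D? elements)))
        values (≡.subst (Card setoid _) order≡q² card-F))
    where
    -- The expression is the value of X^q + v X + b, and since 2 ≤ q this is monic of degree q with
    -- lower coefficients b, v and zeros. The fibres and the kernel both have this form.
    roots-≤q : ∀ b v ys → Unique setoid ys → All (λ y → bar y + v * y + b ≈ 0#) ys → length ys ≤ q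
    roots-≤q b v ys uys all = ≡.subst (length ys ≤_) (≡.sym q≡2+q-2)
      (roots-≤-degree (suc (suc q-2)) (b ∷ v ∷ Vec.replicate q-2 0#) ys uys (All.map root all))
      where
      root : ∀ {y} → bar y + v * y + b ≈ 0# → eval (b ∷ v ∷ Vec.replicate q-2 0#) y ≈ 0#
      root {y} e = begin
        b + y * (v + y * eval (Vec.replicate q-2 0#) y) ≈⟨ +-congˡ (*-congˡ (+-congˡ (*-congˡ (eval-replicate q-2 y)))) ⟩
        b + y * (v + y * y ^ q-2)
          ≈⟨ solve 4 (λ b y v z → b :+ y :* (v :+ z) := y :* z :+ v :* y :+ b) refl b y v (y * y ^ q-2) ⟩
        y ^ suc (suc q-2) + v * y + b                   ≈⟨ +-congʳ (+-congʳ (trans (^-congʳ y (≡.sym q≡2+q-2)) (sym (bar-≈^ y)))) ⟩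
        bar y + v * y + b                               ≈⟨ e ⟩
        0#                                              ∎
    f : Carrier → Carrier
    f x = bar x + - (u * x)
    f-cong : ∀ {x y} → x ≈ y → f x ≈ f y
    f-cong e = +-cong (bar-cong e) (-‿cong (*-congˡ e))
    Kernel : Carrier → Set ℓ
    Kernel y = bar y + bar u * y + 0# ≈ 0#
    kernel0 : Kernel 0#
    kernel0 = trans (+-identityʳ _) (trans (+-cong bar-0 (zeroʳ _)) (+-identityʳ _))
    D? = λ y → ((bar y + bar u * y + 0#) ≟ 0#) ×-dec ¬? (y ≟ 0#)
    zs = filter D? elements
    bound : ∀ z ys → Unique setoid ys → All (λ y → ⊤ × f y ≈ z) ys → length ys ≤ q
    bound z ys uys all = roots-≤q (- z) (- u) ys uys (All.map root all)
      where
      root : ∀ {y} → ⊤ × f y ≈ z → bar y + - u * y + - z ≈ 0#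
      root (_ , e) = trans (+-congʳ (trans (+-congˡ (sym (-‿distribˡ-* u _))) e)) (-‿inverseʳ z)
    image : ∀ x → Kernel (f x)
    image x = begin
      bar (bar x + - (u * x)) + bar u * (bar x + - (u * x)) + 0#
        ≈⟨ trans (+-identityʳ _) (+-cong (trans (bar-+ _ _) (+-cong (bar-bar x) (trans (bar-neg _) (-‿cong (bar-* u x)))))
             (trans (distribˡ _ _ _) (+-congˡ (sym (-‿distribʳ-* _ _))))) ⟩
      (x + - (bar u * bar x)) + (bar u * bar x + - (bar u * (u * x)))
        ≈⟨ solve 4 (λ x a b c → (x :+ a) :+ (b :+ c) := (a :+ b) :+ (x :+ c)) refl x _ _ _ ⟩
      (- (bar u * bar x) + bar u * bar x) + (x + - (bar u * (u * x)))
        ≈⟨ +-cong (-‿inverseˡ _) (+-congˡ (-‿cong (trans (sym (*-assoc _ _ _))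
             (trans (*-congʳ (trans (*-comm _ _) norm-u)) (*-identityˡ x))))) ⟩
      0# + (x + - x)
        ≈⟨ trans (+-identityˡ _) (-‿inverseʳ x) ⟩
      0# ∎
    values : ∀ {x} → ⊤ → f x ≈ 0# ⊎ Any (f x ≈_) zs
    values {x} _ with f x ≟ 0#
    ... | yes e = inj₁ e
    ... | no ne = inj₂ (Sum.[ id , (λ ¬d → ⊥-elim (¬d (conds (AnyP.lookup-result i)))) ]′ (AnyP.filter⁺ D? i))
      where
      i = complete (f x)
      conds : ∀ {y} → f x ≈ y → Kernel y × (¬ y ≈ 0#)
      conds e = trans (+-congʳ (+-cong (bar-cong (sym e)) (*-congˡ (sym e)))) (image x) , λ e′ → ne (trans e e′)

-- Polynomials as finitely supported series: division with remainder and Euclid's lemma.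

module Polynomial {c ℓ} (F : FiniteField c ℓ) where
  open Field F using (*-≉0; 1≉0)
  open FiniteField F hiding (zero)
  open Series commRing
  open RingLemmas seriesRing using (regroup₃; regroup₅)
  open import Algebra.Properties.Ring ring using (-0#≈0#)
  open import Algebra.Properties.Group S.+-group using (x∙y⁻¹≈ε⇒x≈y)
  open import Algebra.Properties.Ring S.ring using (-‿distribˡ-*)
  open import Relation.Binary.Reasoning.Setoid S.setoid

  -- Degree is a property of a series and not an index of a type, so that products, quotients and
  -- remainders all live in one ring.
  Deg< : ℕ → Series → Set ℓ
  Deg< n f = ∀ m → n ≤ m → f m ≈ 0#

  Finite : Series → Set ℓ
  Finite f = ∃ λ n → Deg< n f

  Monic : ℕ → Series → Set ℓ
  Monic d f = f d ≈ 1# × Deg< (suc d) f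

  HasDegree : ℕ → Series → Set ℓ
  HasDegree d f = (¬ f d ≈ 0#) × Deg< (suc d) f

  Deg<-cong : ∀ {n f g} → f ≋ g → Deg< n f → Deg< n g
  Deg<-cong f≋g df m le = trans (sym (at f≋g m)) (df m le)

  Deg<-mono : ∀ {m n f} → m ≤ n → Deg< m f → Deg< n f
  Deg<-mono m≤n df k le = df k (ℕP.≤-trans m≤n le)

  Monic-cong : ∀ {d f g} → f ≋ g → Monic d f → Monic d g
  Monic-cong f≋g (lc , df) = trans (sym (at f≋g _)) lc , Deg<-cong f≋g df

  monic⇒degree : ∀ {d f} → Monic d f → HasDegree d f
  monic⇒degree (lc , df) = (λ z → 1≉0 (trans (sym lc) z)) , df

  monic⇒finite : ∀ {d f} → Monic d f → Finite f
  monic⇒finite (_ , df) = _ , df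

  monic0⇒𝟙 : ∀ {f} → Monic 0 f → f ≋ 𝟙
  monic0⇒𝟙 (lc , df) = mk λ where
    zero → lc
    (suc n) → df (suc n) (s≤s z≤n)

  𝟙-monic : Monic 0 𝟙
  𝟙-monic = refl , λ where
    (suc m) _ → refl

  ✶-degree : ∀ {d e f g} → Deg< (suc d) f → Deg< (suc e) g →
    (f ✶ g) (d ℕ.+ e) ≈ f d * g e × Deg< (suc (d ℕ.+ e)) (f ✶ g)
  ✶-degree {zero} {e} {f} {g} df dg = coeff e , λ m le → trans (coeff m) (trans (*-congˡ (dg m le)) (zeroʳ _))
    where
    f≋ : f ≋ f 0 ∙ 𝟙
    f≋ = mk λ where
      zero → sym (*-identityʳ _)
      (suc n) → trans (df (suc n) (s≤s z≤n)) (sym (zeroʳ _))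
    coeff : ∀ m → (f ✶ g) m ≈ f 0 * g m
    coeff m = at (S.trans (✶-cong f≋ S.refl) (S.trans (∙-✶ (f 0) 𝟙 g) (∙-cong refl (✶-identityˡ g)))) m
  ✶-degree {suc d} {e} {f} {g} df dg with ✶-degree {d} {e} {tail f} {g} (λ m le → df (suc m) (s≤s le)) dg
  ... | top , deg =
    trans (+-cong (trans (*-congˡ (dg (suc (d ℕ.+ e)) (s≤s (ℕP.m≤n+m e d)))) (zeroʳ _)) top) (+-identityˡ _) ,
    λ where
      (suc m) (s≤s le) → trans
        (+-cong (trans (*-congˡ (dg (suc m) (s≤s (ℕP.≤-trans (ℕP.m≤n+m e d) (ℕP.≤-trans (ℕP.n≤1+n _) le))))) (zeroʳ _)) (deg m le))
        (+-identityˡ _)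

  monic-✶ : ∀ {d e f g} → Monic d f → Monic e g → Monic (d ℕ.+ e) (f ✶ g)
  monic-✶ (lf , df) (lg , dg) with ✶-degree df dg
  ... | top , deg = trans top (trans (*-cong lf lg) (*-identityˡ _)) , deg

  degree-✶ : ∀ {d e f g} → HasDegree d f → HasDegree e g → HasDegree (d ℕ.+ e) (f ✶ g)
  degree-✶ (lf , df) (lg , dg) with ✶-degree df dg
  ... | top , deg = (λ z → *-≉0 lf lg (trans (sym top) z)) , deg

  finite-✶ : ∀ {f g} → Finite f → Finite g → Finite (f ✶ g)
  finite-✶ (m , df) (n , dg) =
    _ , proj₂ (✶-degree (Deg<-mono (ℕP.n≤1+n m) df) (Deg<-mono (ℕP.n≤1+n n) dg))

  finite-⊕ : ∀ {f g} → Finite f → Finite g → Finite (f ⊕ g)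
  finite-⊕ (m , df) (n , dg) = m ℕ.+ n , λ k le →
    trans (+-cong (df k (ℕP.≤-trans (ℕP.m≤m+n m n) le)) (dg k (ℕP.≤-trans (ℕP.m≤n+m n m) le))) (+-identityˡ _)

  Deg<-⊖ : ∀ {n f} → Deg< n f → Deg< n (⊖ f)
  Deg<-⊖ df k le = trans (-‿cong (df k le)) -0#≈0#

  finite-⊖ : ∀ {f} → Finite f → Finite (⊖ f)
  finite-⊖ (m , df) = m , Deg<-⊖ df

  finite-∙ : ∀ {a f} → Finite f → Finite (a ∙ f)
  finite-∙ (m , df) = m , λ k le → trans (*-congˡ (df k le)) (zeroʳ _)

  finite-X : ∀ {f} → Finite f → Finite (X f)
  finite-X (m , df) = suc m , λ where
    (suc k) (s≤s le) → df k le

  degree? : ∀ n f → Deg< n f → f ≋ 𝟘 ⊎ (∃ λ d → d < n × HasDegree d f)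
  degree? zero f df = inj₁ (mk λ n → df n z≤n)
  degree? (suc n) f df with f n ≟ 0#
  ... | no nz = inj₂ (n , ℕP.≤-refl , nz , df)
  ... | yes z = Sum.map₂ (λ (d , d<n , h) → d , ℕP.m≤n⇒m≤1+n d<n , h) (degree? n f lower)
    where
    lower : Deg< n f
    lower m n≤m with ℕP.m≤n⇒m<n∨m≡n n≤m
    ... | inj₁ n<m = df m n<m
    ... | inj₂ ≡.refl = z

  -- A nonzero multiple of a monic polynomial of degree d has degree at least d. Cancellation and
  -- the decision of divisibility both rest on this.
  small-multiple : ∀ {d k g} → Finite k → Monic d g → Deg< d (k ✶ g) → k ≋ 𝟘
  small-multiple {d} (n , dk) mg small with degree? n _ dk
  ... | inj₁ k≋0 = k≋0
  ... | inj₂ (e , _ , hk) = ⊥-elim (proj₁ (degree-✶ hk (monic⇒degree mg)) (small (e ℕ.+ d) (ℕP.m≤n+m d e)))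

  ✶-cancelʳ : ∀ {d f g h} → Finite f → Finite g → Monic d h → f ✶ h ≋ g ✶ h → f ≋ g
  ✶-cancelʳ {d} {f} {g} {h} ff fg mh e = x∙y⁻¹≈ε⇒x≈y f g (small-multiple (finite-⊕ ff (finite-⊖ fg)) mh λ m _ → at zero′ m)
    where
    zero′ : (f ⊕ ⊖ g) ✶ h ≋ 𝟘
    zero′ = S.trans (✶-distribʳ h f (⊖ g)) (S.trans (S.+-cong e (S.sym (-‿distribˡ-* g h))) (S.-‿inverseʳ (g ✶ h)))

  record Division (d : ℕ) (g f : Series) : Set (c ⊔ ℓ) where
    field
      quot rem    : Series
      quot-finite : Finite quot
      rem-small   : Deg< d rem
      equation    : f ≋ quot ✶ g ⊕ rem

    exact : rem ≋ 𝟘 → f ≋ quot ✶ g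
    exact r≋0 = S.trans equation (S.trans (S.+-congˡ r≋0) (S.+-identityʳ _))

  -- Multiply the division of `tail f` by X and restore `f 0`: the new remainder has degree at most
  -- d, and subtracting `b ∙ g`, with `b` its coefficient at d, brings it below d.
  division-step : ∀ {d g f} → Monic d g → Division d g (tail f) → Division d g f
  division-step {d} {g} {f} (lg , dg) D = record
    { quot = X quot ⊕ b ∙ 𝟙 ; rem = rem′ ⊕ ⊖ (b ∙ g)
    ; quot-finite = finite-⊕ (finite-X quot-finite) (finite-∙ (monic⇒finite 𝟙-monic))
    ; rem-small = small
    ; equation = equation′ }
    where
    open Division D
    rem′ = f 0 ∙ 𝟙 ⊕ X rem
    b = rem′ d
    expand : f ≋ f 0 ∙ 𝟙 ⊕ X (quot ✶ g) ⊕ X rem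
    expand = mk λ where
      zero → sym (trans (+-identityʳ _) (trans (+-identityʳ _) (*-identityʳ _)))
      (suc n) → trans (at equation n) (+-congʳ (sym (trans (+-congʳ (zeroʳ _)) (+-identityˡ _))))
    regroup : ∀ x y z w → x ⊕ y ⊕ z ≋ (y ⊕ w) ⊕ ((x ⊕ z) ⊕ ⊖ w)
    regroup x y z w = S.trans (S.sym (S.trans (S.+-congˡ (S.-‿inverseʳ w)) (S.+-identityʳ _))) (regroup₅ x y z w (⊖ w))
    multiple : (X quot ⊕ b ∙ 𝟙) ✶ g ≋ X (quot ✶ g) ⊕ b ∙ g
    multiple = S.trans (✶-distribʳ g (X quot) (b ∙ 𝟙))
      (S.+-cong (X-✶ quot g) (S.trans (∙-✶ b 𝟙 g) (∙-cong refl (✶-identityˡ g))))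
    equation′ : f ≋ (X quot ⊕ b ∙ 𝟙) ✶ g ⊕ (rem′ ⊕ ⊖ (b ∙ g))
    equation′ = S.trans expand (S.trans (regroup (f 0 ∙ 𝟙) (X (quot ✶ g)) (X rem) (b ∙ g)) (S.+-congʳ (S.sym multiple)))
    small : Deg< d (rem′ ⊕ ⊖ (b ∙ g))
    small m d≤m with ℕP.m≤n⇒m<n∨m≡n d≤m
    ... | inj₂ ≡.refl = trans (+-congˡ (-‿cong (trans (*-congˡ lg) (*-identityʳ b)))) (-‿inverseʳ b)
    small (suc m) _ | inj₁ (s≤s d≤m) = trans (+-cong (trans (+-cong (zeroʳ _) (rem-small m d≤m)) (+-identityˡ _))
      (Deg<-⊖ {n = suc m} {f = b ∙ g} (λ k le → trans (*-congˡ (dg k (ℕP.≤-trans (s≤s d≤m) le))) (zeroʳ b)) (suc m) ℕP.≤-refl)) (+-identityˡ _)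

  divide : ∀ {d g} → Monic d g → ∀ n f → Deg< n f → Division d g f
  divide {d} {g} mg zero f df = record
    { quot = 𝟘 ; rem = 𝟘 ; quot-finite = 0 , (λ _ _ → refl) ; rem-small = λ _ _ → refl
    ; equation = S.trans (mk λ n → df n z≤n) (S.sym (S.trans (S.+-congʳ (𝟘-✶ g)) (S.+-identityˡ 𝟘))) }
  divide mg (suc n) f df = division-step mg (divide mg n (tail f) (λ m le → df (suc m) (s≤s le)))

  infix 4 _∣_
  record _∣_ (g f : Series) : Set (c ⊔ ℓ) where
    constructor divides
    field
      cofactor        : Series
      cofactor-finite : Finite cofactor
      equality        : f ≋ cofactor ✶ g
  open _∣_ public

  ∣-respʳ : ∀ {g f f′} → f ≋ f′ → g ∣ f → g ∣ f′
  ∣-respʳ e (divides k fk eq) = divides k fk (S.trans (S.sym e) eq)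

  ∣-respˡ : ∀ {g g′ f} → g ≋ g′ → g ∣ f → g′ ∣ f
  ∣-respˡ e (divides k fk eq) = divides k fk (S.trans eq (✶-cong S.refl e))

  ∣-refl : ∀ {g} → g ∣ g
  ∣-refl {g} = divides 𝟙 (monic⇒finite 𝟙-monic) (S.sym (✶-identityˡ g))

  ∣-✶ : ∀ {g f} h → Finite h → g ∣ f → g ∣ h ✶ f
  ∣-✶ {g} h fh (divides k fk eq) = divides (h ✶ k) (finite-✶ fh fk) (S.trans (✶-cong S.refl eq) (S.sym (✶-assoc h k g)))

  ∣-✶ʳ : ∀ {g f} h → Finite h → g ∣ f → g ∣ f ✶ h
  ∣-✶ʳ {g} {f} h fh d = ∣-respʳ (✶-comm h f) (∣-✶ h fh d)

  ∣-remainder : ∀ {g x y z} → z ≋ x ⊕ y → g ∣ z → g ∣ x → g ∣ y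
  ∣-remainder {g} {x} {y} {z} z≋ (divides k fk eq) (divides l fl eq′) = divides (k ⊕ ⊖ l) (finite-⊕ fk (finite-⊖ fl)) (begin
    y                       ≈⟨ S.+-identityʳ y ⟨
    y ⊕ 𝟘                   ≈⟨ S.+-congˡ (S.-‿inverseʳ x) ⟨
    y ⊕ (x ⊕ ⊖ x)           ≈⟨ regroup₃ x y (⊖ x) ⟩
    (x ⊕ y) ⊕ ⊖ x           ≈⟨ S.+-cong (S.trans (S.sym z≋) eq) (S.trans (S.-‿cong eq′) (-‿distribˡ-* l g)) ⟩
    k ✶ g ⊕ (⊖ l) ✶ g       ≈⟨ ✶-distribʳ g k (⊖ l) ⟨
    (k ⊕ ⊖ l) ✶ g           ∎)

  ∣? : ∀ {d g f} → Monic d g → Finite f → Dec (g ∣ f)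
  ∣? {d} {g} {f} mg (n , df) = decide (degree? d rem rem-small)
    where
    open Division (divide mg n f df)
    decide : rem ≋ 𝟘 ⊎ (∃ λ e → e < d × HasDegree e rem) → Dec (g ∣ f)
    decide (inj₁ r≋0) = yes (divides quot quot-finite (exact r≋0))
    decide (inj₂ (e , _ , nz , _)) = no λ g∣f →
      let divides k fk eq = ∣-remainder equation g∣f (divides quot quot-finite S.refl)
          k≋0 = small-multiple fk mg (Deg<-cong eq rem-small)
      in nz (at (S.trans eq (S.trans (✶-cong k≋0 S.refl) (𝟘-✶ g))) e)

  -- Divisibility asks only for a finitely supported cofactor; comparing leading coefficients shows
  -- that it is monic and fixes its degree.
  monic-cofactor : ∀ {d n f g} → Monic n f → Monic d g → (g∣f : g ∣ f) → ∃ λ e → (e ℕ.+ d ≡ n) × Monic e (cofactor g∣f)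
  monic-cofactor {d} {n} {f} {g} mf mg (divides k (b , dk) eq) with degree? b k dk
  ... | inj₁ k≋0 = ⊥-elim (proj₁ (monic⇒degree mf) (at (S.trans eq (S.trans (✶-cong k≋0 S.refl) (𝟘-✶ g))) n))
  ... | inj₂ (e , _ , hk) = e , e+d≡n , leading , proj₂ hk
    where
    e+d≡n : e ℕ.+ d ≡ n
    e+d≡n with ℕP.<-cmp (e ℕ.+ d) n
    ... | tri≈ _ eq′ _ = eq′
    ... | tri< lt _ _ = ⊥-elim (proj₁ (monic⇒degree mf) (trans (at eq n) (proj₂ (degree-✶ hk (monic⇒degree mg)) n lt)))
    ... | tri> _ _ gt = ⊥-elim (proj₁ (degree-✶ hk (monic⇒degree mg)) (trans (sym (at eq _)) (proj₂ mf _ gt)))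
    leading : k e ≈ 1#
    leading = trans (sym (*-identityʳ _)) (trans (*-congˡ (sym (proj₁ mg)))
      (trans (sym (proj₁ (✶-degree (proj₂ hk) (proj₂ mg))))
        (trans (sym (at eq _)) (≡.subst (λ m → f m ≈ 1#) (≡.sym e+d≡n) (proj₁ mf)))))

  -- Factors are restricted to monic ones, as in the search by `reducible`; over a field this loses
  -- nothing for monic `g`.
  record Irreducible (d : ℕ) (g : Series) : Set (c ⊔ ℓ) where
    field
      monic       : Monic d g
      positive    : 1 ≤ d
      no-factors  : ∀ {a b h k} → Monic a h → Monic b k → 1 ≤ a → 1 ≤ b → a ℕ.+ b ≡ d → ¬ h ✶ k ≋ g

  module _ {d g} (irr : Irreducible d g) where
    open Irreducible irr

    -- The Euclidean algorithm on g and h: every remainder r again satisfies g ∣ r ✶ b.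
    private
      euclid-small : ∀ b → Finite b → ∀ e h → HasDegree e h → e < d → g ∣ h ✶ b → g ∣ b
      euclid-small b fb = <-rec (λ e → ∀ h → HasDegree e h → e < d → g ∣ h ✶ b → g ∣ b) step
        where
        step : ∀ e → (∀ {e′} → e′ < e → ∀ h → HasDegree e′ h → e′ < d → g ∣ h ✶ b → g ∣ b) →
          ∀ h → HasDegree e h → e < d → g ∣ h ✶ b → g ∣ b
        step e rec h (lh , dh) e<d (divides k fk eq) = cases e ≡.refl
          where
          a = h e
          h′ = a ⁻¹ ∙ h
          mh′ : Monic e h′
          mh′ = trans (*-comm _ _) (inverse a lh) , λ m le → trans (*-congˡ (dh m le)) (zeroʳ _)
          g∣h′b : g ∣ h′ ✶ b
          g∣h′b = divides (a ⁻¹ ∙ k) (finite-∙ fk) (S.trans (∙-✶ _ h b) (S.trans (∙-cong refl eq) (S.sym (∙-✶ _ k g))))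
          cases : ∀ e′ → e′ ≡ e → g ∣ b
          cases zero ≡.refl = ∣-respʳ (S.trans (✶-cong (monic0⇒𝟙 mh′) S.refl) (✶-identityˡ b)) g∣h′b
          cases (suc e′) ≡.refl = conclude (divide mh′ (suc d) g (proj₂ monic))
            where
            conclude : Division e h′ g → g ∣ b
            conclude D = remainder (degree? e rem rem-small)
              where
              open Division D
              remainder : rem ≋ 𝟘 ⊎ (∃ λ e′ → e′ < e × HasDegree e′ rem) → g ∣ b
              -- A zero remainder would split `g` properly: `h′` has positive degree below d, hence
              -- so has the cofactor.
              remainder (inj₁ r≋0) with monic-cofactor monic mh′ (divides quot quot-finite (exact r≋0))
              ... | zero , ≡.refl , _ = ⊥-elim (ℕP.<-irrefl ≡.refl e<d)
              ... | suc e″ , sum , mk′ = ⊥-elim (no-factors mk′ mh′ (s≤s z≤n) (s≤s z≤n) sum (S.sym (exact r≋0)))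
              remainder (inj₂ (e″ , lt , hr)) = rec lt rem hr (ℕP.<-trans lt e<d)
                (∣-remainder {z = g ✶ b} (S.trans (✶-cong equation S.refl) (✶-distribʳ b (quot ✶ h′) rem))
                  (∣-✶ʳ b fb ∣-refl) (∣-respʳ (S.sym (✶-assoc quot h′ b)) (∣-✶ quot quot-finite g∣h′b)))

    -- Reducing `x` modulo `g` leaves a remainder of degree below d whose product with `y` is still
    -- divisible by `g`; unless it vanishes, `euclid-small` applies.
    euclid : ∀ {x y} → Finite x → Finite y → g ∣ x ✶ y → g ∣ x ⊎ g ∣ y
    euclid {x} {y} (n , dx) fy g∣xy = remainder (degree? d rem rem-small)
      where
      open Division (divide monic n x dx)
      remainder : rem ≋ 𝟘 ⊎ (∃ λ e → e < d × HasDegree e rem) → g ∣ x ⊎ g ∣ y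
      remainder (inj₁ r≋0) = inj₁ (divides quot quot-finite (exact r≋0))
      remainder (inj₂ (e , lt , hr)) = inj₂ (euclid-small y fy e rem hr lt
        (∣-remainder (S.trans (✶-cong equation S.refl) (✶-distribʳ y (quot ✶ g) rem)) g∣xy
          (∣-✶ʳ y fy (∣-✶ quot quot-finite ∣-refl))))

  irreducible-∣ : ∀ {d e g h} → Irreducible d g → Irreducible e h → g ∣ h → (d ≡ e) × g ≋ h
  irreducible-∣ {d} {e} {g} {h} ig ih g∣h with monic-cofactor (Irreducible.monic ih) (Irreducible.monic ig) g∣h
  ... | zero , ≡.refl , mk′ = ≡.refl , S.sym (S.trans (equality g∣h) (S.trans (✶-cong (monic0⇒𝟙 mk′) S.refl) (✶-identityˡ g)))
  ... | suc k , sum , mk′ =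
    ⊥-elim (Irreducible.no-factors ih mk′ (Irreducible.monic ig) (s≤s z≤n) (Irreducible.positive ig) sum (S.sym (equality g∣h)))

  irreducible-cong : ∀ {d g h} → g ≋ h → Irreducible d g → Irreducible d h
  irreducible-cong e ig = record
    { monic = Monic-cong e monic ; positive = positive
    ; no-factors = λ ma mb a b s eq → no-factors ma mb a b s (S.trans eq (S.sym e)) }
    where open Irreducible ig

  const-✶-≉0ˡ : ∀ {f g h} → f ≋ g ✶ h → ¬ f 0 ≈ 0# → ¬ g 0 ≈ 0#
  const-✶-≉0ˡ eq nz z = nz (trans (at eq 0) (trans (*-congʳ z) (zeroˡ _)))

  const-✶-≉0ʳ : ∀ {f g h} → f ≋ g ✶ h → ¬ f 0 ≈ 0# → ¬ h 0 ≈ 0#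
  const-✶-≉0ʳ eq nz z = nz (trans (at eq 0) (trans (*-congˡ z) (zeroʳ _)))

-- Integers inside the rationals.

module Rational where
  open import Data.Integer as ℤ using (ℤ; +_)
  import Data.Integer.Properties as ℤP
  open import Data.Rational.Unnormalised as ℚᵘ using (mkℚᵘ; *≡*)
  import Data.Rational.Unnormalised.Properties as ℚᵘP

  fromℤ : ℤ → ℚ
  fromℤ z = z ℚ./ 1

  private
    toℚᵘ-fromℤ : ∀ z → ℚ.toℚᵘ (fromℤ z) ℚᵘ.≃ mkℚᵘ z 0
    toℚᵘ-fromℤ z = ℚP.toℚᵘ-fromℚᵘ (mkℚᵘ z 0)

  fromℤ-+ : ∀ x y → fromℤ (x ℤ.+ y) ≡ fromℤ x ℚ.+ fromℤ y
  fromℤ-+ x y = ℚP.toℚᵘ-injective (ℚᵘP.≃-trans (toℚᵘ-fromℤ (x ℤ.+ y)) (ℚᵘP.≃-sym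
    (ℚᵘP.≃-trans (ℚP.toℚᵘ-homo-+ (fromℤ x) (fromℤ y)) (ℚᵘP.≃-trans (ℚᵘP.+-cong (toℚᵘ-fromℤ x) (toℚᵘ-fromℤ y))
      (*≡* (≡.cong (ℤ._* (+ 1)) (≡.cong₂ ℤ._+_ (ℤP.*-identityʳ x) (ℤP.*-identityʳ y))))))))

  fromℤ-* : ∀ x y → fromℤ (x ℤ.* y) ≡ fromℤ x ℚ.* fromℤ y
  fromℤ-* x y = ℚP.toℚᵘ-injective (ℚᵘP.≃-trans (toℚᵘ-fromℤ (x ℤ.* y)) (ℚᵘP.≃-sym
    (ℚᵘP.≃-trans (ℚP.toℚᵘ-homo-* (fromℤ x) (fromℤ y)) (ℚᵘP.≃-trans (ℚᵘP.*-cong (toℚᵘ-fromℤ x) (toℚᵘ-fromℤ y))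
      (*≡* ≡.refl)))))

  fromℕ : ℕ → ℚ
  fromℕ n = fromℤ (+ n)

  fromℕ-+ : ∀ m n → fromℕ (m ℕ.+ n) ≡ fromℕ m ℚ.+ fromℕ n
  fromℕ-+ m n = fromℤ-+ (+ m) (+ n)

  fromℕ-* : ∀ m n → fromℕ (m ℕ.* n) ≡ fromℕ m ℚ.* fromℕ n
  fromℕ-* m n = ≡.trans (≡.cong fromℤ (ℤP.pos-* m n)) (fromℤ-* (+ m) (+ n))

module Q = Series ℚP.+-*-commutativeRing

-- Duality of polynomials and its multiplicativity.

module SelfDualPolynomials {c ℓ} (F : FiniteField c ℓ) (q : ℕ) (q-pp : IsPrimePower q) (order≡q² : FiniteField.order F ≡ q ℕ.* q) where
  open Counting
  open Field F
  open Conjugation F q q-pp order≡q²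
  open Polynomial F
  open Rational
  open FiniteField F hiding (zero)
  open Poly F q
  open Series commRing
  open import Algebra.Properties.Group S.+-group using (x∙y⁻¹≈ε⇒x≈y; x≈y⇒x∙y⁻¹≈ε)

  conj : Series → Series
  conj f n = bar (f n)

  conj-cong : ∀ {f g} → f ≋ g → conj f ≋ conj g
  conj-cong e = mk λ n → bar-cong (at e n)

  conj-✶ : ∀ f g → conj (f ✶ g) ≋ conj f ✶ conj g
  conj-✶ f g = mk (go f)
    where
    go : ∀ f n → conj (f ✶ g) n ≈ (conj f ✶ conj g) n
    go f zero = bar-* _ _
    go f (suc n) = trans (bar-+ _ _) (+-cong (bar-* _ _) (go (tail f) n))

  conj-∙ : ∀ a f → conj (a ∙ f) ≋ bar a ∙ conj f
  conj-∙ a f = mk λ n → bar-* a (f n)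

  -- This is X^d f(1/X) when f has degree at most d; coefficients of f beyond d are dropped.
  rev : ℕ → Series → Series
  rev d f zero = f d
  rev zero f (suc n) = 0#
  rev (suc d) f (suc n) = rev d f n

  rev-cong : ∀ d {f g} → f ≋ g → rev d f ≋ rev d g
  rev-cong d {f} {g} e = mk (go d)
    where
    go : ∀ d n → rev d f n ≈ rev d g n
    go d zero = at e d
    go zero (suc n) = refl
    go (suc d) (suc n) = go d n

  rev-⊕ : ∀ d f g → rev d (f ⊕ g) ≋ rev d f ⊕ rev d g
  rev-⊕ d f g = mk (go d)
    where
    go : ∀ d n → rev d (f ⊕ g) n ≈ (rev d f ⊕ rev d g) n
    go d zero = refl
    go zero (suc n) = sym (+-identityˡ _)
    go (suc d) (suc n) = go d n

  rev-∙ : ∀ d a f → rev d (a ∙ f) ≋ a ∙ rev d f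
  rev-∙ d a f = mk (go d)
    where
    go : ∀ d n → rev d (a ∙ f) n ≈ (a ∙ rev d f) n
    go d zero = refl
    go zero (suc n) = sym (zeroʳ _)
    go (suc d) (suc n) = go d n

  rev-conj : ∀ d f → rev d (conj f) ≋ conj (rev d f)
  rev-conj d f = mk (go d)
    where
    go : ∀ d n → rev d (conj f) n ≈ conj (rev d f) n
    go d zero = refl
    go zero (suc n) = sym bar-0
    go (suc d) (suc n) = go d n

  rev-X : ∀ d f → rev (suc d) (X f) ≋ rev d f
  rev-X d f = mk λ where
      zero → refl
      (suc n) → go d n
    where
    go : ∀ d n → rev d (X f) n ≈ rev d f (suc n)
    go zero zero = refl
    go zero (suc n) = refl
    go (suc d) zero = refl
    go (suc d) (suc n) = go d n

  rev-pad : ∀ k {e g} → Deg< (suc e) g → rev (k ℕ.+ e) g ≋ X^ k (rev e g)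
  rev-pad zero dg = S.refl
  rev-pad (suc k) {e} dg = mk λ where
    zero → dg _ (s≤s (ℕP.m≤n+m e k))
    (suc n) → at (rev-pad k dg) n

  rev-∸ : ∀ {d n} f → n ≤ d → rev d f n ≡ f (d ℕ.∸ n)
  rev-∸ {d} {zero} f _ = ≡.refl
  rev-∸ {suc d} {suc n} f (s≤s le) = rev-∸ f le

  rev-Deg< : ∀ d f → Deg< (suc d) (rev d f)
  rev-Deg< zero f (suc m) _ = refl
  rev-Deg< (suc d) f (suc m) (s≤s le) = rev-Deg< d f m le

  rev-rev : ∀ {d f} → Deg< (suc d) f → rev d (rev d f) ≋ f
  rev-rev {d} {f} df = mk go
    where
    go : ∀ n → rev d (rev d f) n ≈ f n
    go n with n ℕP.≤? d
    ... | yes n≤d = reflexive (≡.trans (rev-∸ (rev d f) n≤d) (≡.trans (rev-∸ f (ℕP.m∸n≤m d n)) (≡.cong f (ℕP.m∸[m∸n]≡n n≤d))))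
    ... | no n≰d = trans (rev-Deg< d (rev d f) n (ℕP.≰⇒> n≰d)) (sym (df n (ℕP.≰⇒> n≰d)))

  split : ∀ f → f ≋ f 0 ∙ 𝟙 ⊕ X (tail f)
  split f = mk λ where
    zero → sym (trans (+-identityʳ _) (*-identityʳ _))
    (suc n) → sym (trans (+-congʳ (zeroʳ _)) (+-identityˡ _))

  rev-suc : ∀ d f → rev (suc d) f ≋ f 0 ∙ X^ (suc d) 𝟙 ⊕ rev d (tail f)
  rev-suc d f = S.trans (rev-cong (suc d) (split f)) (S.trans (rev-⊕ (suc d) (f 0 ∙ 𝟙) (X (tail f)))
      (S.+-cong (S.trans (rev-∙ (suc d) (f 0) 𝟙) (∙-cong refl rev-𝟙)) (rev-X d (tail f))))
    where
    rev-𝟙 : rev (suc d) 𝟙 ≋ X^ (suc d) 𝟙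
    rev-𝟙 = S.trans (≡.subst (λ m → rev (suc m) 𝟙 ≋ X^ (suc d) (rev 0 𝟙)) (ℕP.+-identityʳ d) (rev-pad (suc d) {0} {𝟙} (proj₂ 𝟙-monic)))
      (X^-cong (suc d) (mk λ where
        zero → refl
        (suc n) → refl))

  const-✶ : ∀ a g → (a ∙ 𝟙) ✶ g ≋ a ∙ g
  const-✶ a g = S.trans (∙-✶ a 𝟙 g) (∙-cong refl (✶-identityˡ g))

  -- As 1/X is no power series, multiplicativity is proved by splitting off the constant term of
  -- `f`, which reversal turns into the top coefficient.
  rev-✶ : ∀ d {e f g} → Deg< (suc d) f → Deg< (suc e) g → rev (d ℕ.+ e) (f ✶ g) ≋ rev d f ✶ rev e g
  rev-✶ zero {e} {f} {g} df dg = S.trans (rev-cong e (S.trans (✶-cong f≋ S.refl) (const-✶ (f 0) g)))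
      (S.trans (rev-∙ e (f 0) g) (S.sym (S.trans (✶-cong rev≋ S.refl) (const-✶ (f 0) (rev e g)))))
    where
    f≋ : f ≋ f 0 ∙ 𝟙
    f≋ = S.trans (split f) (S.trans (S.+-congˡ {x = f 0 ∙ 𝟙} (mk λ where
      zero → refl
      (suc n) → df (suc n) (s≤s z≤n))) (S.+-identityʳ _))
    rev≋ : rev 0 f ≋ f 0 ∙ 𝟙
    rev≋ = mk λ where
      zero → sym (*-identityʳ _)
      (suc n) → sym (zeroʳ _)
  rev-✶ (suc d) {e} {f} {g} df dg = S.trans left (S.sym right)
    where
    df′ : Deg< (suc d) (tail f)
    df′ m le = df (suc m) (s≤s le)
    common = f 0 ∙ X^ (suc d) (rev e g) ⊕ rev d (tail f) ✶ rev e g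
    left : rev (suc d ℕ.+ e) (f ✶ g) ≋ common
    left = S.trans (rev-cong (suc d ℕ.+ e) (S.trans (✶-cong (split f) S.refl) (S.trans (✶-distribʳ g (f 0 ∙ 𝟙) (X (tail f)))
        (S.+-cong (const-✶ (f 0) g) (X-✶ (tail f) g)))))
      (S.trans (rev-⊕ (suc d ℕ.+ e) (f 0 ∙ g) (X (tail f ✶ g)))
        (S.+-cong (S.trans (rev-∙ (suc d ℕ.+ e) (f 0) g) (∙-cong refl (rev-pad (suc d) dg)))
          (S.trans (rev-X (d ℕ.+ e) (tail f ✶ g)) (rev-✶ d df′ dg))))
    right : rev (suc d) f ✶ rev e g ≋ common
    right = S.trans (✶-cong (rev-suc d f) S.refl)
      (S.trans (✶-distribʳ (rev e g) (f 0 ∙ X^ (suc d) 𝟙) (rev d (tail f)))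
        (S.+-congʳ (S.trans (∙-✶ (f 0) (X^ (suc d) 𝟙) (rev e g))
          (∙-cong refl (S.trans (X^-✶ (suc d) 𝟙 (rev e g)) (X^-cong (suc d) (✶-identityˡ (rev e g))))))))

  -- The definition of the dual with the inverse of `bar (f 0)` cleared, which makes the relation
  -- visibly multiplicative; `star` is the explicit dual.
  IsDual : ℕ → Series → Series → Set ℓ
  IsDual d f g = bar (f 0) ∙ g ≋ conj (rev d f)

  dual-✶ : ∀ {d e f f′ g g′} → Deg< (suc d) f → Deg< (suc e) g → IsDual d f f′ → IsDual e g g′ →
    IsDual (d ℕ.+ e) (f ✶ g) (f′ ✶ g′)
  dual-✶ {d} {e} {f} {f′} {g} {g′} df dg D E =
    S.trans (S.trans (mk λ n → trans (*-congʳ (bar-* (f 0) (g 0))) (*-assoc _ _ _))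
      (S.trans (∙-cong refl (S.sym (✶-∙ (bar (g 0)) f′ g′))) (S.sym (∙-✶ (bar (f 0)) f′ (bar (g 0) ∙ g′)))))
    (S.trans (✶-cong D E) (S.sym (S.trans (conj-cong (rev-✶ d df dg)) (conj-✶ (rev d f) (rev e g)))))

  dual-unique : ∀ {d f g h} → ¬ f 0 ≈ 0# → IsDual d f g → IsDual d f h → g ≋ h
  dual-unique nz D E = mk λ n → *-cancelˡ-≉0 _ (bar-≉0 nz) (trans (at D n) (sym (at E n)))

  dual-cong : ∀ {d f f′ g g′} → f ≋ f′ → g ≋ g′ → IsDual d f g → IsDual d f′ g′
  dual-cong {d} e e′ D = S.trans (∙-cong (bar-cong (sym (at e 0))) (S.sym e′)) (S.trans D (conj-cong (rev-cong d e)))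

  dual-const : ∀ {d f g} → Monic d f → IsDual d f g → bar (f 0) * g 0 ≈ 1#
  dual-const (lf , _) D = trans (at D 0) (trans (bar-cong lf) bar-1)

  dual-const-≉0 : ∀ {d f g} → Monic d f → IsDual d f g → ¬ g 0 ≈ 0#
  dual-const-≉0 mf D = unit≉0 (trans (*-comm _ _) (dual-const mf D))

  dual-monic : ∀ {d f g} → ¬ f 0 ≈ 0# → Monic d f → IsDual d f g → Monic d g
  dual-monic {d} {f} {g} nz mf D =
    *-cancelˡ-≉0 _ (bar-≉0 nz) (trans (at D d) (trans
      (bar-cong (reflexive (≡.trans (rev-∸ f (ℕP.≤-refl {d})) (≡.cong f (ℕP.n∸n≡0 d))))) (sym (*-identityʳ _)))) ,
    λ m le → *-cancelˡ-≉0 _ (bar-≉0 nz) (trans (at D m) (trans (bar-cong (rev-Deg< d f m le)) (trans bar-0 (sym (zeroʳ _)))))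

  -- Reversing and conjugating twice is the identity up to constants, and these cancel because
  -- `bar (f 0) * g 0` is 1.
  dual-sym : ∀ {d f g} → Monic d f → IsDual d f g → IsDual d g f
  dual-sym {d} {f} {g} mf D = S.sym (mk λ n → trans (sym (trans (*-congʳ unit) (*-identityˡ _))) (trans (*-assoc _ _ _) (*-congˡ (at e n))))
    where
    unit : bar (g 0) * f 0 ≈ 1#
    unit = trans (*-congˡ (sym (bar-bar (f 0)))) (trans (*-comm _ _) (trans (sym (bar-* _ _)) (trans (bar-cong (dual-const mf D)) bar-1)))
    e : f 0 ∙ conj (rev d g) ≋ f
    e = S.trans (∙-cong (sym (bar-bar (f 0))) S.refl) (S.trans (S.sym (conj-∙ (bar (f 0)) (rev d g)))
      (S.trans (conj-cong (S.trans (S.sym (rev-∙ d (bar (f 0)) g)) (S.trans (rev-cong d D) (rev-conj d (rev d f)))))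
        (S.trans (mk λ n → bar-bar _) (rev-rev (proj₂ mf)))))

  star : ℕ → Series → Series
  star d f = (bar (f 0) ⁻¹) ∙ conj (rev d f)

  star-dual : ∀ d {f} → ¬ f 0 ≈ 0# → IsDual d f (star d f)
  star-dual d nz = mk λ n → trans (sym (*-assoc _ _ _)) (trans (*-congʳ (inverse _ (bar-≉0 nz))) (*-identityˡ _))

  SelfDual : ℕ → Series → Set ℓ
  SelfDual n f = Monic n f × (¬ f 0 ≈ 0#) × IsDual n f f

  selfDual-cong : ∀ {n f g} → f ≋ g → SelfDual n f → SelfDual n g
  selfDual-cong e (mf , nz , D) = Monic-cong e mf , (λ z → nz (trans (at e 0) z)) , dual-cong e e D

  selfDual-✶ : ∀ {m n f g} → SelfDual m f → SelfDual n g → SelfDual (m ℕ.+ n) (f ✶ g)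
  selfDual-✶ (mf , nf , D) (mg , ng , E) = monic-✶ mf mg , *-≉0 nf ng , dual-✶ (proj₂ mf) (proj₂ mg) D E

  -- If f = k g, the dual of `k` times `g` is the dual of `f`, that is k g again; cancelling `g`
  -- shows that `k` is self-dual.
  selfDual-cofactor : ∀ {d n f g} → SelfDual n f → SelfDual d g → (g∣f : g ∣ f) →
    ∃ λ e → (e ℕ.+ d ≡ n) × SelfDual e (cofactor g∣f)
  selfDual-cofactor {d} {n} {f} {g} (mf , nf , D) (mg , ng , E) g∣f@(divides k fk eq) with monic-cofactor mf mg g∣f
  ... | e , ≡.refl , mk′ = e , ≡.refl , mk′ , nk , dual-cong S.refl k*≋k (star-dual e nk)
    where
    nk = const-✶-≉0ˡ eq nf
    mk* = dual-monic nk mk′ (star-dual e nk)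
    k*≋k : star e k ≋ k
    k*≋k = ✶-cancelʳ (monic⇒finite mk*) fk mg (S.trans
      (dual-unique nf (dual-cong (S.sym eq) S.refl (dual-✶ (proj₂ mk′) (proj₂ mg) (star-dual e nk) E)) D) eq)

  -- Duality is multiplicative and fixes `f`, so a factorization f = k g dualizes to one with the
  -- factor `h`.
  dual-∣ : ∀ {d n f g h} → SelfDual n f → Monic d g → IsDual d g h → g ∣ f → h ∣ f
  dual-∣ {d} {n} {f} {g} {h} (mf , nf , D) mg E g∣f@(divides k fk eq) with monic-cofactor mf mg g∣f
  ... | e , ≡.refl , mk′ = divides (star e k) (monic⇒finite (dual-monic nk mk′ (star-dual e nk)))
      (dual-unique nf D (dual-cong (S.sym eq) S.refl (dual-✶ (proj₂ mk′) (proj₂ mg) (star-dual e nk) E)))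
    where nk = const-✶-≉0ˡ eq nf

  -- A proper factorization of the dual would dualize back to one of `f`, with the same degrees.
  dual-irreducible : ∀ {d f g} → ¬ f 0 ≈ 0# → Irreducible d f → IsDual d f g → Irreducible d g
  dual-irreducible {d} {f} {g} nf If D = record
    { monic = mg ; positive = positive
    ; no-factors = λ {a} {b} {h} {k} mh mk′ 1≤a 1≤b a+b≡d hk≋g →
        let nh = const-✶-≉0ˡ (S.sym hk≋g) ng
            nk = const-✶-≉0ʳ (S.sym hk≋g) ng
        in no-factors (dual-monic nh mh (star-dual a nh)) (dual-monic nk mk′ (star-dual b nk)) 1≤a 1≤b a+b≡d
            (dual-unique ng (≡.subst (λ n → IsDual n g _) a+b≡d
              (dual-cong hk≋g S.refl (dual-✶ (proj₂ mh) (proj₂ mk′) (star-dual a nh) (star-dual b nk)))) (dual-sym monic D)) }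
    where
    open Irreducible If
    mg = dual-monic nf monic D
    ng = dual-const-≉0 monic D

  -- Counting self-dual polynomials by their coefficients.

  snoc : ℕ → Series → Carrier → Series
  snoc zero w z zero = z
  snoc zero w z (suc i) = 0#
  snoc (suc m) w z zero = w 0
  snoc (suc m) w z (suc i) = snoc m (tail w) z i

  snoc-< : ∀ {m i} w z → i < m → snoc m w z i ≡ w i
  snoc-< {suc m} {zero} w z _ = ≡.refl
  snoc-< {suc m} {suc i} w z (s≤s lt) = snoc-< (tail w) z lt

  snoc-top : ∀ m w z → snoc m w z m ≡ z
  snoc-top zero w z = ≡.refl
  snoc-top (suc m) w z = snoc-top m (tail w) z

  snoc-Deg< : ∀ m w z → Deg< (suc m) (snoc m w z)
  snoc-Deg< zero w z (suc i) _ = refl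
  snoc-Deg< (suc m) w z (suc i) (s≤s le) = snoc-Deg< m (tail w) z i le

  snoc-cong : ∀ m {w w′ z z′} → w ≋ w′ → z ≈ z′ → snoc m w z ≋ snoc m w′ z′
  snoc-cong m e e′ = mk (go m e e′)
    where
    go : ∀ m {w w′ z z′} → w ≋ w′ → z ≈ z′ → ∀ i → snoc m w z i ≈ snoc m w′ z′ i
    go zero e e′ zero = e′
    go zero e e′ (suc i) = refl
    go (suc m) e e′ zero = at e 0
    go (suc m) e e′ (suc i) = go m (mk λ n → at e (suc n)) e′ i

  truncate : ℕ → Series → Series
  truncate m w = snoc m w 0#

  truncate-Deg< : ∀ m w → Deg< m (truncate m w)
  truncate-Deg< m w i m≤i with ℕP.m≤n⇒m<n∨m≡n m≤i
  ... | inj₁ m<i = snoc-Deg< m w 0# i m<i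
  ... | inj₂ ≡.refl = reflexive (snoc-top m w 0#)

  -- A block of m coefficients between two outer ones. Duality links the outer two to each other,
  -- which allows counting from the outside inwards.
  glue : ℕ → Carrier → Series → Carrier → Series
  glue m a w z zero = a
  glue m a w z (suc i) = snoc m w z i

  glue-cong : ∀ m {a a′ w w′ z z′} → a ≈ a′ → w ≋ w′ → z ≈ z′ → glue m a w z ≋ glue m a′ w′ z′
  glue-cong m e e′ e″ = mk λ where
    zero → e
    (suc i) → at (snoc-cong m e′ e″) i

  glue-inj : ∀ {m a a′ w w′ z z′} → Deg< m w → Deg< m w′ → glue m a w z ≋ glue m a′ w′ z′ → a ≈ a′ × w ≋ w′
  glue-inj {m} {a} {a′} {w} {w′} {z} {z′} dw dw′ e = at e 0 , mk go
    where
    go : ∀ i → w i ≈ w′ i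
    go i with i ℕP.<? m
    ... | yes i<m = trans (reflexive (≡.sym (snoc-< w z i<m))) (trans (at e (suc i)) (reflexive (snoc-< w′ z′ i<m)))
    ... | no i≮m = trans (dw i (ℕP.≮⇒≥ i≮m)) (sym (dw′ i (ℕP.≮⇒≥ i≮m)))

  unglue : ∀ {m f} → Deg< (suc (suc m)) f → f ≋ glue m (f 0) (truncate m (tail f)) (f (suc m))
  unglue {m} {f} df = mk λ where
      zero → refl
      (suc i) → go i (ℕP.<-cmp i m)
    where
    go : ∀ i → Tri (i < m) (i ≡ m) (m < i) → f (suc i) ≈ snoc m (truncate m (tail f)) (f (suc m)) i
    go i (tri< i<m _ _) = reflexive (≡.sym (≡.trans (snoc-< _ _ i<m) (snoc-< _ _ i<m)))
    go i (tri≈ _ ≡.refl _) = reflexive (≡.sym (snoc-top m _ _))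
    go i (tri> _ _ m<i) = trans (df (suc i) (s≤s m<i)) (sym (snoc-Deg< m _ _ i m<i))

  private
    i<m : ∀ {i j m} → suc (i ℕ.+ j) ≡ m → i < m
    i<m {i} {j} ≡.refl = s≤s (ℕP.m≤m+n i j)
    j<m : ∀ {i j m} → suc (i ℕ.+ j) ≡ m → j < m
    j<m {i} {j} ≡.refl = s≤s (ℕP.m≤n+m j i)

  -- The mirror condition of duality on a block of m coefficients, position i facing position m - 1
  -- - i. The parameter `u` stays the same when the ends are removed; for a self-dual `f` it is
  -- `bar (f 0)`.
  Twisted : Carrier → ℕ → Series → Set ℓ
  Twisted u m w = Deg< m w × (∀ i j → suc (i ℕ.+ j) ≡ m → u * w i ≈ bar (w j))

  twisted-glue : ∀ {u m a w z} → Twisted u m w → u * a ≈ bar z → u * z ≈ bar a → Twisted u (suc (suc m)) (glue m a w z)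
  twisted-glue {u} {m} {a} {w} {z} (_ , tw) ua uz =
    (λ where (suc i) (s≤s le) → snoc-Deg< m w z i le) , λ where
      zero zero ()
      zero (suc j) ≡.refl → trans ua (bar-cong (reflexive (≡.sym (snoc-top m w z))))
      (suc i) zero e → top i (≡.trans (≡.sym (ℕP.+-identityʳ i)) (ℕP.suc-injective (ℕP.suc-injective e)))
      (suc i) (suc j) e → inner i j (≡.trans (≡.sym (ℕP.+-suc i j)) (ℕP.suc-injective (ℕP.suc-injective e)))
    where
    top : ∀ i → i ≡ m → u * snoc m w z i ≈ bar a
    top i ≡.refl = trans (*-congˡ (reflexive (snoc-top m w z))) uz
    inner : ∀ i j → suc (i ℕ.+ j) ≡ m → u * snoc m w z i ≈ bar (snoc m w z j)
    inner i j e = trans (*-congˡ (reflexive (snoc-< w z (i<m e)))) (trans (tw i j e) (bar-cong (reflexive (≡.sym (snoc-< w z (j<m e))))))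

  twisted-unglue : ∀ {u m f} → Twisted u (suc (suc m)) f → Twisted u m (truncate m (tail f))
  twisted-unglue {u} {m} {f} (df , tw) = truncate-Deg< m (tail f) , λ i j e →
    trans (*-congˡ (reflexive (snoc-< (tail f) 0# (i<m e))))
      (trans (tw (suc i) (suc j) (≡.cong suc (≡.trans (≡.cong suc (ℕP.+-suc i j)) (≡.cong suc e))))
        (bar-cong (reflexive (≡.sym (snoc-< (tail f) 0# (j<m e))))))

  twisted-cong : ∀ {u u′ m w w′} → u ≈ u′ → w ≋ w′ → Twisted u m w → Twisted u′ m w′
  twisted-cong e e′ (dw , tw) = Deg<-cong e′ dw , λ i j s →
    trans (*-cong (sym e) (sym (at e′ i))) (trans (tw i j s) (bar-cong (at e′ j)))

  -- An outer pair has one free member and contributes the order q² of the field, as much as two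
  -- coefficients with q choices each; hence one formula for both parities of `m`.
  card-twisted : ∀ u → norm u ≈ 1# → ∀ m → Card S.setoid (Twisted u m) (q ℕ.^ m)
  card-twisted u nu zero = card-singleton S.setoid {x = 𝟘} ((λ _ _ → refl) , λ _ _ ()) (λ (d , _) → mk λ n → d n z≤n)
  card-twisted u nu (suc zero) = ≡.subst (Card S.setoid _) (≡.sym (ℕP.*-identityʳ q))
    (card-map setoid S.setoid (_∙ 𝟙) (λ _ _ e → ∙-cong e S.refl)
      (λ _ _ e → trans (sym (*-identityʳ _)) (trans (at e 0) (*-identityʳ _)))
      (λ e tw → trans (*-congˡ (sym e)) (trans tw (bar-cong e)))
      (λ tw → (λ where (suc m) _ → zeroʳ _) , λ where
        zero zero _ → trans (*-congˡ (*-identityʳ _)) (trans tw (bar-cong (sym (*-identityʳ _))))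
        zero (suc _) ()
        (suc _) _ ())
      (λ {w} (dw , tw) → w 0 , tw 0 0 ≡.refl , mk λ where
        zero → sym (*-identityʳ _)
        (suc n) → trans (dw (suc n) (s≤s z≤n)) (sym (zeroʳ _)))
      (card-twisted-fixed u nu))
  card-twisted u nu (suc (suc m)) = ≡.subst (Card S.setoid _) (ℕP.*-assoc q q (q ℕ.^ m))
    (card-Σ setoid S.setoid S.setoid φ (λ e e′ → glue-cong m e e′ (*-congˡ (bar-cong e)))
      (λ _ (d , _) _ (d′ , _) e → glue-inj d d′ e) (λ _ tw → tw)
      (λ {a} _ tw → twisted-glue tw (end₁ a) (end₂ a))
      (λ {f} tw → f 0 , truncate m (tail f) , tt , twisted-unglue tw ,
        S.trans (unglue (proj₁ tw)) (glue-cong m refl S.refl (last tw)))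
      (≡.subst (Card setoid _) order≡q² card-F) (λ _ → card-twisted u nu m))
    where
    -- The coefficient z facing `a` must satisfy u z = bar a, and the inverse of `u` is `bar u`.
    φ : Carrier → Series → Series
    φ a w = glue m a w (bar u * bar a)
    u*bar-u*bar : ∀ x → u * (bar u * x) ≈ x
    u*bar-u*bar x = trans (sym (*-assoc _ _ _)) (trans (*-congʳ nu) (*-identityˡ _))
    end₁ : ∀ a → u * a ≈ bar (bar u * bar a)
    end₁ a = sym (trans (bar-* _ _) (*-cong (bar-bar u) (bar-bar a)))
    end₂ : ∀ a → u * (bar u * bar a) ≈ bar a
    end₂ a = u*bar-u*bar (bar a)
    last : ∀ {f} → Twisted u (suc (suc m)) f → f (suc m) ≈ bar u * bar (f 0)
    last {f} (_ , tw) = *-cancelˡ-≉0 u (unit≉0 nu)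
      (trans (tw (suc m) 0 (≡.cong (suc ∘ suc) (ℕP.+-identityʳ m))) (sym (u*bar-u*bar (bar (f 0)))))

  isDual⇒twisted : ∀ {n f} → Deg< (suc n) f → IsDual n f f → Twisted (bar (f 0)) (suc n) f
  isDual⇒twisted {n} {f} df D = df , λ i j e → trans (at D i) (bar-cong (reflexive (≡.trans (rev-∸ {n} {i} f (ℕ.s≤s⁻¹ (i<m {i} {j} e)))
    (≡.cong f (≡.trans (≡.cong (ℕ._∸ i) (≡.sym (ℕP.suc-injective e))) (ℕP.m+n∸m≡n i j))))))

  twisted⇒isDual : ∀ {n f} → Twisted (bar (f 0)) (suc n) f → IsDual n f f
  twisted⇒isDual {n} {f} (df , tw) = mk go
    where
    go : ∀ i → bar (f 0) * f i ≈ bar (rev n f i)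
    go i with i ℕP.≤? n
    ... | yes i≤n = trans (tw i (n ℕ.∸ i) (≡.cong suc (ℕP.m+[n∸m]≡n i≤n))) (bar-cong (reflexive (≡.sym (rev-∸ f i≤n))))
    ... | no i≰n = trans (trans (*-congˡ (df i (ℕP.≰⇒> i≰n))) (zeroʳ _))
      (sym (trans (bar-cong (rev-Deg< n f i (ℕP.≰⇒> i≰n))) bar-0))

  norm-bar : ∀ {a} → norm a ≈ 1# → norm (bar a) ≈ 1#
  norm-bar {a} e = trans (*-congˡ (bar-bar a)) (trans (*-comm _ _) e)

  selfDualCount : ℕ → ℕ
  selfDualCount zero = 1
  selfDualCount (suc n) = suc q ℕ.* q ℕ.^ n

  selfDual-𝟙 : SelfDual 0 𝟙
  selfDual-𝟙 = 𝟙-monic , 1≉0 , mk λ where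
    zero → trans (*-congʳ bar-1) (trans (*-identityˡ _) (sym bar-1))
    (suc n) → trans (zeroʳ _) (sym bar-0)

  -- In degree n + 1 the end coefficients are `f 0` and 1, whose mirror condition is that `f 0` has
  -- norm 1; the n coefficients between them are twisted by `bar (f 0)`.
  card-selfDual : ∀ n → Card S.setoid (SelfDual n) (selfDualCount n)
  card-selfDual zero = card-singleton S.setoid selfDual-𝟙 (λ (mf , _) → monic0⇒𝟙 mf)
  card-selfDual (suc n) = card-Σ setoid S.setoid S.setoid {P = λ a → norm a ≈ 1#} {Q = λ a → Twisted (bar a) n} φ
    (λ e e′ → glue-cong n e e′ refl)
    (λ _ (d , _) _ (d′ , _) e → glue-inj d d′ e)
    (λ e → twisted-cong (bar-cong e) S.refl)
    (λ {a} {w} na tw → let tw′ = twisted-glue tw (trans (*-comm _ _) (trans na (sym bar-1))) (*-identityʳ _) in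
      (reflexive (snoc-top n w 1#) , proj₁ tw′) , unit≉0 na , twisted⇒isDual tw′)
    (λ {f} (mf , nz , D) → f 0 , truncate n (tail f) , trans (*-comm _ _) (dual-const mf D) ,
      twisted-unglue (isDual⇒twisted (proj₂ mf) D) , S.trans (unglue (proj₂ mf)) (glue-cong n refl S.refl (proj₁ mf)))
    card-norm1 (λ {a} na → card-twisted (bar a) (norm-bar na) n)
    where
    φ : Carrier → Series → Series
    φ a w = glue n a w 1#

  -- Agreement with the list-based polynomials and Boolean tests of the statement.

  coeffs : List Carrier → Series
  coeffs [] = 𝟘
  coeffs (a ∷ as) zero = a
  coeffs (a ∷ as) (suc n) = coeffs as n

  poly : ∀ {d} → Vec Carrier d → Series
  poly v = coeffs (full v)

  poly-const : ∀ {d} (v : Vec Carrier d) → const v ≡ poly v 0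
  poly-const [] = ≡.refl
  poly-const (_ ∷ _) = ≡.refl

  poly-monic : ∀ {d} (v : Vec Carrier d) → Monic d (poly v)
  poly-monic [] = refl , λ where (suc m) _ → refl
  poly-monic (a ∷ v) = proj₁ (poly-monic v) , λ where (suc m) (s≤s le) → proj₂ (poly-monic v) m le

  length-full : ∀ {d} (v : Vec Carrier d) → length (full v) ≡ suc d
  length-full [] = ≡.refl
  length-full (a ∷ v) = ≡.cong suc (length-full v)

  coeffs-addP : ∀ as bs → coeffs (addP as bs) ≋ coeffs as ⊕ coeffs bs
  coeffs-addP as bs = mk (go as bs)
    where
    go : ∀ as bs n → coeffs (addP as bs) n ≈ coeffs as n + coeffs bs n
    go [] bs n = sym (+-identityˡ _)
    go (a ∷ as) [] n = sym (+-identityʳ _)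
    go (a ∷ as) (b ∷ bs) zero = refl
    go (a ∷ as) (b ∷ bs) (suc n) = go as bs n

  coeffs-scale : ∀ a bs → coeffs (map (a *_) bs) ≋ a ∙ coeffs bs
  coeffs-scale a bs = mk (go bs)
    where
    go : ∀ bs n → coeffs (map (a *_) bs) n ≈ a * coeffs bs n
    go [] n = sym (zeroʳ a)
    go (b ∷ bs) zero = refl
    go (b ∷ bs) (suc n) = go bs n

  coeffs-bar : ∀ bs → coeffs (map bar bs) ≋ conj (coeffs bs)
  coeffs-bar bs = mk (go bs)
    where
    go : ∀ bs n → coeffs (map bar bs) n ≈ bar (coeffs bs n)
    go [] n = sym bar-0
    go (b ∷ bs) zero = refl
    go (b ∷ bs) (suc n) = go bs n

  coeffs-shift : ∀ as → coeffs (0# ∷ as) ≋ X (coeffs as)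
  coeffs-shift as = mk λ where
    zero → refl
    (suc n) → refl

  coeffs-mulP : ∀ as bs → coeffs (mulP as bs) ≋ coeffs as ✶ coeffs bs
  coeffs-mulP [] bs = S.sym (𝟘-✶ (coeffs bs))
  coeffs-mulP (a ∷ as) bs = S.trans (coeffs-addP (map (a *_) bs) (0# ∷ mulP as bs))
    (S.trans (S.+-cong (coeffs-scale a bs) (S.trans (coeffs-shift (mulP as bs)) (X-cong (coeffs-mulP as bs))))
      (S.sym (S.trans (✶-cong (split (coeffs (a ∷ as))) S.refl)
        (S.trans (✶-distribʳ (coeffs bs) (a ∙ 𝟙) (X (coeffs as)))
          (S.+-cong (const-✶ a (coeffs bs)) (X-✶ (coeffs as) (coeffs bs)))))))

  length-addP : ∀ as bs → length as ≤ length bs → length (addP as bs) ≡ length bs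
  length-addP [] bs le = ≡.refl
  length-addP (a ∷ as) (b ∷ bs) (s≤s le) = ≡.cong suc (length-addP as bs le)

  length-addP′ : ∀ as bs → length bs ≤ length as → length (addP as bs) ≡ length as
  length-addP′ [] [] le = ≡.refl
  length-addP′ (a ∷ as) [] le = ≡.refl
  length-addP′ (a ∷ as) (b ∷ bs) (s≤s le) = ≡.cong suc (length-addP′ as bs le)

  length-mulP : ∀ a as b bs → length (mulP (a ∷ as) (b ∷ bs)) ≡ suc (length as ℕ.+ length bs)
  length-mulP a [] b bs = ≡.trans (length-addP′ (map (a *_) (b ∷ bs)) (0# ∷ []) (s≤s z≤n)) (length-map (a *_) (b ∷ bs))
  length-mulP a (a′ ∷ as) b bs = ≡.trans (length-addP (map (a *_) (b ∷ bs)) (0# ∷ mulP (a′ ∷ as) (b ∷ bs))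
      (≡.subst₂ _≤_ (≡.sym (length-map (a *_) (b ∷ bs))) (≡.cong suc (≡.sym (length-mulP a′ as b bs)))
        (s≤s (ℕP.≤-trans (ℕP.m≤n+m (length bs) (length as)) (ℕP.n≤1+n _)))))
    (≡.cong suc (length-mulP a′ as b bs))

  -- `listEq` separates lists that differ by trailing zeros, so equality of coefficients yields it
  -- only once the lengths are known to agree.
  length-mulP-full : ∀ {a b} (g : Vec Carrier a) (h : Vec Carrier b) → length (mulP (full g) (full h)) ≡ suc (a ℕ.+ b)
  length-mulP-full {a} {b} g h with full g | length-full g | full h | length-full h
  ... | x ∷ xs | ≡.refl | y ∷ ys | ≡.refl = length-mulP x xs y ys

  listEq⇒≋ : ∀ as bs → T (listEq as bs) → coeffs as ≋ coeffs bs
  listEq⇒≋ as bs t = mk (go as bs t)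
    where
    go : ∀ as bs → T (listEq as bs) → ∀ n → coeffs as n ≈ coeffs bs n
    go [] [] _ n = refl
    go (a ∷ as) (b ∷ bs) t zero = toWitness (proj₁ (T-∧⁻ {a == b} t))
    go (a ∷ as) (b ∷ bs) t (suc n) = go as bs (proj₂ (T-∧⁻ {a == b} t)) n

  ≋⇒listEq : ∀ as bs → length as ≡ length bs → coeffs as ≋ coeffs bs → T (listEq as bs)
  ≋⇒listEq [] [] _ _ = _
  ≋⇒listEq (a ∷ as) (b ∷ bs) len e =
    T-∧⁺ (fromWitness {a? = a ≟ b} (at e 0) , ≋⇒listEq as bs (ℕP.suc-injective len) (mk λ n → at e (suc n)))

  coeffs-∷ʳ : ∀ as x → coeffs (as ++ [ x ]) ≋ x ∙ X^ (length as) 𝟙 ⊕ coeffs as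
  coeffs-∷ʳ as x = mk (go as)
    where
    go : ∀ as n → coeffs (as ++ [ x ]) n ≈ x * X^ (length as) 𝟙 n + coeffs as n
    go [] zero = sym (trans (+-identityʳ _) (*-identityʳ _))
    go [] (suc n) = sym (trans (+-identityʳ _) (zeroʳ _))
    go (a ∷ as) zero = sym (trans (+-congʳ (zeroʳ _)) (+-identityˡ _))
    go (a ∷ as) (suc n) = go as n

  coeffs-reverse : ∀ d as → length as ≡ suc d → coeffs (reverse as) ≋ rev d (coeffs as)
  coeffs-reverse zero (a ∷ []) _ = mk λ where
    zero → refl
    (suc n) → refl
  coeffs-reverse (suc d) (a ∷ as) len = S.trans (S.reflexive (≡.cong coeffs (unfold-reverse a as)))
    (S.trans (coeffs-∷ʳ (reverse as) a) (S.trans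
      (S.+-cong (S.reflexive (≡.cong (λ k → a ∙ X^ k 𝟙) (≡.trans (length-reverse as) (ℕP.suc-injective len))))
        (coeffs-reverse d as (ℕP.suc-injective len)))
      (S.sym (rev-suc d (coeffs (a ∷ as))))))

  coeffs-dual : ∀ {d} (v : Vec Carrier d) → coeffs (dual v) ≋ star d (poly v)
  coeffs-dual {d} v = S.trans (coeffs-scale _ (reverse (map bar (full v))))
    (∙-cong (reflexive (≡.cong (λ z → bar z ⁻¹) (poly-const v)))
      (S.trans (coeffs-reverse d (map bar (full v)) (≡.trans (length-map bar (full v)) (length-full v)))
        (S.trans (rev-cong d (coeffs-bar (full v))) (rev-conj d (poly v)))))

  selfDual⁻ : ∀ {d} (v : Vec Carrier d) → ¬ poly v 0 ≈ 0# → T (selfDual v) → IsDual d (poly v) (poly v)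
  selfDual⁻ {d} v nz t = dual-cong S.refl (S.trans (S.sym (coeffs-dual v)) (listEq⇒≋ (dual v) (full v) t)) (star-dual d nz)

  selfDual⁺ : ∀ {d} (v : Vec Carrier d) → ¬ poly v 0 ≈ 0# → IsDual d (poly v) (poly v) → T (selfDual v)
  selfDual⁺ {d} v nz D = ≋⇒listEq (dual v) (full v)
    (≡.trans (length-map _ (reverse (map bar (full v)))) (≡.trans (length-reverse (map bar (full v))) (length-map bar (full v))))
    (S.trans (coeffs-dual v) (dual-unique nz (star-dual d nz) D))

  nonzeroConst⁻ : ∀ {d} (v : Vec Carrier d) → T (nonzeroConst v) → ¬ poly v 0 ≈ 0#
  nonzeroConst⁻ v t z = T-not⁻ {const v == 0#} t (fromWitness {a? = const v ≟ 0#} (trans (reflexive (poly-const v)) z))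

  nonzeroConst⁺ : ∀ {d} (v : Vec Carrier d) → ¬ poly v 0 ≈ 0# → T (nonzeroConst v)
  nonzeroConst⁺ v nz = T-not⁺ {const v == 0#} (λ t → nz (trans (reflexive (≡.sym (poly-const v))) (toWitness t)))

  monics-unique : ∀ d → AllPairs (λ v w → ¬ poly v ≋ poly w) (monics d)
  monics-unique zero = [] ∷ []
  monics-unique (suc d) = AllPairsP.concat⁺ (AllP.map⁺ (All.universal block elements))
      (AllPairsP.map⁺ (AllPairs.map separate distinct))
    where
    block : ∀ a → AllPairs (λ v w → ¬ poly v ≋ poly w) (map (a Vec.∷_) (monics d))
    block a = AllPairsP.map⁺ (AllPairs.map (λ ne e → ne (mk λ n → at e (suc n))) (monics-unique d))
    separate : ∀ {a b} → ¬ a ≈ b → All (λ v → All (λ w → ¬ poly v ≋ poly w) (map (b Vec.∷_) (monics d))) (map (a Vec.∷_) (monics d))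
    separate a≉b = AllP.map⁺ (All.universal (λ v → AllP.map⁺ (All.universal (λ w e → a≉b (at e 0)) (monics d))) (monics d))

  monics-complete : ∀ d {f} → Monic d f → Any (λ v → f ≋ poly v) (monics d)
  monics-complete zero mf = here (S.trans (monic0⇒𝟙 mf) (mk λ where
    zero → refl
    (suc n) → refl))
  monics-complete (suc d) {f} (lf , df) = AnyP.concatMap⁺ _ (Any.map extend (complete (f 0)))
    where
    extend : ∀ {a} → f 0 ≈ a → Any (λ v → f ≋ poly v) (map (a Vec.∷_) (monics d))
    extend f0≈a = AnyP.map⁺ (Any.map (λ e → mk λ where
      zero → f0≈a
      (suc n) → at e n) (monics-complete d (lf , λ m le → df (suc m) (s≤s le))))

  -- The bridge from the Boolean counts of the statement to counts of properties of series:
  -- `monics d` represents each monic polynomial of degree d exactly once.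
  card-filter : ∀ {p} d (b : Vec Carrier d → Bool) (P : Series → Set p) → (∀ {f g} → f ≋ g → P f → P g) →
    (∀ v → T (b v) → P (poly v)) → (∀ v → P (poly v) → T (b v)) →
    Card S.setoid (λ f → Monic d f × P f) (length (filterᵇ b (monics d)))
  card-filter d b P resp to from = card (map poly (filterᵇ b (monics d))) (length-map poly (filterᵇ b (monics d)))
    (AllPairsP.map⁺ (AllPairsP.filter⁺ (T? ∘ b) (monics-unique d)))
    (AllP.map⁺ (All.map (λ {v} t → poly-monic v , to v t) (AllP.all-filter (T? ∘ b) (monics d))))
    λ (mf , pf) → let i = monics-complete d mf in
      AnyP.map⁺ (Sum.[ id , (λ ¬b → ⊥-elim (¬b (from _ (resp (AnyP.lookup-result i) pf)))) ]′ (AnyP.filter⁺ (T? ∘ b) i))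

  Factorization : ℕ → Series → Set _
  Factorization d f = ∃₂ λ a b → ∃₂ λ h k → Monic a h × Monic b k × 1 ≤ a × 1 ≤ b × a ℕ.+ b ≡ d × h ✶ k ≋ f

  reducible⁻ : ∀ {d} (v : Vec Carrier d) → T (reducible v) → Factorization d (poly v)
  reducible⁻ {d} v t with find (AnyP.any⁻ _ (upTo d) t)
  ... | a , a∈ , t₁ with T-∧⁻ {1 ℕ.≤ᵇ a} t₁
  ... | 1≤a , t₂ with satisfied (AnyP.any⁻ _ (monics a) t₂)
  ... | g , t₃ with satisfied (AnyP.any⁻ _ (monics (d ℕ.∸ a)) t₃)
  ... | h , t₄ = a , d ℕ.∸ a , poly g , poly h , poly-monic g , poly-monic h , ℕP.≤ᵇ⇒≤ 1 a 1≤a , ℕP.m<n⇒0<n∸m a<d ,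
      ℕP.m+[n∸m]≡n (ℕP.<⇒≤ a<d) ,
      S.trans (S.sym (coeffs-mulP (full g) (full h))) (listEq⇒≋ (mulP (full g) (full h)) (full v) t₄)
    where
    a<d : a < d
    a<d = ∈-upTo⁻ a∈

  reducible⁺ : ∀ {d} (v : Vec Carrier d) → Factorization d (poly v) → T (reducible v)
  reducible⁺ {d} v (a , b , h , k , mh , mk′ , 1≤a , 1≤b , ≡.refl , e) =
    AnyP.any⁺ _ (lose (∈-upTo⁺ (ℕP.m<m+n a 1≤b)) (T-∧⁺ {1 ℕ.≤ᵇ a} (ℕP.≤⇒≤ᵇ 1≤a ,
      AnyP.any⁺ _ (Any.map (λ {g} h≋g → AnyP.any⁺ _ (Any.map (λ {g′} k≋g′ → ≋⇒listEq (mulP (full g) (full g′)) (full v)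
          (≡.trans (length-mulP-full g g′) (≡.trans (≡.cong suc (ℕP.m+[n∸m]≡n (ℕP.m≤m+n a b))) (≡.sym (length-full v))))
          (S.trans (coeffs-mulP (full g) (full g′)) (S.trans (✶-cong (S.sym h≋g) (S.sym k≋g′)) e)))
        (monics-complete (a ℕ.+ b ℕ.∸ a) (≡.subst (λ n → Monic n k) (≡.sym (ℕP.m+n∸m≡n a b)) mk′))))
      (monics-complete a mh)))))

  irreducible⁻ : ∀ {d} (v : Vec Carrier d) → T (irreducible v) → Irreducible d (poly v)
  irreducible⁻ {d} v t = record
    { monic = poly-monic v ; positive = ℕP.≤ᵇ⇒≤ 1 d (proj₁ (T-∧⁻ t))
    ; no-factors = λ mh mk′ 1≤a 1≤b s e → T-not⁻ (proj₂ (T-∧⁻ {1 ℕ.≤ᵇ d} t)) (reducible⁺ v (_ , _ , _ , _ , mh , mk′ , 1≤a , 1≤b , s , e)) }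

  irreducible⁺ : ∀ {d} (v : Vec Carrier d) → Irreducible d (poly v) → T (irreducible v)
  irreducible⁺ {d} v I = T-∧⁺ {1 ℕ.≤ᵇ d} (ℕP.≤⇒≤ᵇ (Irreducible.positive I) , T-not⁺ λ t →
    let (_ , _ , _ , _ , mh , mk′ , 1≤a , 1≤b , s , e) = reducible⁻ v t in Irreducible.no-factors I mh mk′ 1≤a 1≤b s e)

  -- The alternative is constructive because `reducible` searches exhaustively among finitely many
  -- factors.
  factor? : ∀ {d f} → 1 ≤ d → Monic d f → Irreducible d f ⊎ Factorization d f
  factor? {d} {f} 1≤d mf with satisfied (monics-complete d mf)
  ... | v , f≋v with T? (reducible v)
  ... | yes t = let (a , b , h , k , mh , mk′ , 1≤a , 1≤b , s , e) = reducible⁻ v t in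
    inj₂ (a , b , h , k , mh , mk′ , 1≤a , 1≤b , s , S.trans e (S.sym f≋v))
  ... | no ¬t = inj₁ (irreducible-cong (S.sym f≋v) (irreducible⁻ v (T-∧⁺ {1 ℕ.≤ᵇ d} (ℕP.≤⇒≤ᵇ 1≤d , T-not⁺ ¬t))))

  -- Irreducible polynomials and the atoms of self-dual factorization.

  IrreducibleUnit : ℕ → Series → Set _
  IrreducibleUnit d f = Irreducible d f × (¬ f 0 ≈ 0#)

  irreducibleUnit-cong : ∀ {d f g} → f ≋ g → IrreducibleUnit d f → IrreducibleUnit d g
  irreducibleUnit-cong e (I , nz) = irreducible-cong e I , λ z → nz (trans (at e 0) z)

  card-SDIM⁻ : ∀ d → Card S.setoid (λ f → IrreducibleUnit d f × IsDual d f f) (SDIM⁻ d)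
  card-SDIM⁻ d = card-⇔ S.setoid proj₂ (λ p@((I , _) , _) → Irreducible.monic I , p)
    (card-filter d _ (λ f → IrreducibleUnit d f × IsDual d f f)
      (λ e (I , D) → irreducibleUnit-cong e I , dual-cong e e D)
      (λ v t → let (i , t′) = T-∧⁻ {irreducible v} t
                   (n , s) = T-∧⁻ {nonzeroConst v} t′
                   nz = nonzeroConst⁻ v n
               in (irreducible⁻ v i , nz) , selfDual⁻ v nz s)
      (λ v ((I , nz) , D) → T-∧⁺ {irreducible v} (irreducible⁺ v I , T-∧⁺ {nonzeroConst v} (nonzeroConst⁺ v nz , selfDual⁺ v nz D))))

  -- The halving is left as it stands in the definition; that `n` is even appears only once duality
  -- is seen to pair the polynomials.
  card-SDIM⁺ : ∀ d → ∃ λ n → (SDIM⁺ d ≡ n ℕ./ 2) × Card S.setoid (λ f → IrreducibleUnit d f × (¬ IsDual d f f)) n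
  card-SDIM⁺ d = _ , ≡.refl , card-⇔ S.setoid proj₂ (λ p@((I , _) , _) → Irreducible.monic I , p)
    (card-filter d _ (λ f → IrreducibleUnit d f × (¬ IsDual d f f))
      (λ e (I , ¬D) → irreducibleUnit-cong e I , λ D → ¬D (dual-cong (S.sym e) (S.sym e) D))
      (λ v t → let (i , t′) = T-∧⁻ {irreducible v} t
                   (n , s) = T-∧⁻ {nonzeroConst v} t′
                   nz = nonzeroConst⁻ v n
               in (irreducible⁻ v i , nz) , λ D → T-not⁻ {selfDual v} s (selfDual⁺ v nz D))
      (λ v ((I , nz) , ¬D) → T-∧⁺ {irreducible v} (irreducible⁺ v I ,
        T-∧⁺ {nonzeroConst v} (nonzeroConst⁺ v nz , T-not⁺ {selfDual v} (λ s → ¬D (selfDual⁻ v nz s))))))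

  -- `prime` is a test for the atom: a self-dual polynomial divisible by it is divisible by the
  -- whole atom. `size` is the degree of the atom and `degree` that of its prime; they differ for g
  -- g~, where one of the two factors serves as `prime`.
  record Atom : Set (c ⊔ ℓ) where
    field
      size             : ℕ
      atom             : Series
      atom-selfDual    : SelfDual size atom
      degree           : ℕ
      prime            : Series
      prime-irr        : Irreducible degree prime
      prime∣atom       : prime ∣ atom
      prime∣⇒atom∣     : ∀ {n f} → SelfDual n f → prime ∣ f → atom ∣ f
      primes-of-atom   : ∀ {e h} → Irreducible e h → h ∣ atom → e ≡ degree × (h ≋ prime ⊎ h ≋ star degree prime)
  open Atom

  -- Through `primes-of-atom`, this prevents the prime of `B` from dividing the atom of `A`.
  Separate : Rel Atom _
  Separate A B = ¬ (degree B ≡ degree A × (prime B ≋ prime A ⊎ prime B ≋ star (degree A) (prime A)))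

  Sifted : List Atom → ℕ → Series → Set _
  Sifted As n f = SelfDual n f × All (λ A → ¬ prime A ∣ f) As

  truncate-≋ : ∀ {m f} → Deg< m f → truncate m f ≋ f
  truncate-≋ {m} {f} df = mk go
    where
    go : ∀ i → truncate m f i ≈ f i
    go i with i ℕP.<? m
    ... | yes i<m = reflexive (snoc-< f 0# i<m)
    ... | no i≮m = trans (truncate-Deg< m f i (ℕP.≮⇒≥ i≮m)) (sym (df i (ℕP.≮⇒≥ i≮m)))

  sifted-cong : ∀ {As n f g} → f ≋ g → Sifted As n f → Sifted As n g
  sifted-cong e (sd , nd) = selfDual-cong e sd , All.map (λ ¬d d → ¬d (∣-respʳ (S.sym e) d)) nd

  module _ (A : Atom) (As : List Atom) (sep : All (Separate A) As) where

    -- Euclid's lemma: multiplying by the atom A does not affect divisibility by the primes of the other atoms.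
    sifted-✶ : ∀ {m f} → Sifted As m f → Sifted As (m ℕ.+ size A) (f ✶ atom A) × prime A ∣ f ✶ atom A
    sifted-✶ {m} {f} (sd , nd) = (selfDual-✶ sd (atom-selfDual A) , All.zipWith (λ {B} → coprime {B}) (sep , nd)) ,
        ∣-✶ f finite (prime∣atom A)
      where
      finite = monic⇒finite (proj₁ sd)
      coprime : ∀ {B} → Separate A B × (¬ prime B ∣ f) → ¬ prime B ∣ f ✶ atom A
      coprime {B} (s , nd) d with euclid (prime-irr B) finite (monic⇒finite (proj₁ (atom-selfDual A))) d
      ... | inj₁ d′ = nd d′
      ... | inj₂ d′ = s (primes-of-atom A (prime-irr B) d′)

    sifted-quotient : ∀ {n f} → Sifted As n f → prime A ∣ f →
      ∃₂ λ m g → (m ℕ.+ size A ≡ n) × Sifted As m g × f ≋ g ✶ atom A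
    sifted-quotient {n} {f} (sd , nd) d with prime∣⇒atom∣ A sd d
    ... | a∣f with selfDual-cofactor sd (atom-selfDual A) a∣f
    ... | m , m+s≡n , sd′ = m , cofactor a∣f , m+s≡n ,
      (sd′ , All.map (λ ¬d d′ → ¬d (∣-respʳ (S.sym (equality a∣f)) (∣-✶ʳ (atom A) (monic⇒finite (proj₁ (atom-selfDual A))) d′))) nd) ,
      equality a∣f

    -- The quotient may contain the same atom again, so it ranges over all of `Sifted As` in degree
    -- m; this is why a sieve step amounts to a single factor 1 - X^s.
    card-multiples : ∀ {m k} → Card S.setoid (Sifted As m) k →
      Card S.setoid (λ f → Sifted As (m ℕ.+ size A) f × prime A ∣ f) k
    card-multiples {m} = card-map S.setoid S.setoid (_✶ atom A) (λ _ _ e → ✶-cong e S.refl)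
      (λ ((mf , _) , _) ((mg , _) , _) → ✶-cancelʳ (monic⇒finite mf) (monic⇒finite mg) (proj₁ (atom-selfDual A)))
      sifted-cong sifted-✶ onto
      where
      onto : ∀ {f} → Sifted As (m ℕ.+ size A) f × prime A ∣ f → ∃ λ g → Sifted As m g × f ≋ g ✶ atom A
      onto (sf , d) with sifted-quotient sf d
      ... | m′ , g , e , sg , eq = g , ≡.subst (λ m → Sifted As m g) (ℕP.+-cancelʳ-≡ (size A) m′ m e) sg , eq

    sift : ∀ {n k} → Card S.setoid (Sifted As n) k →
      ∃₂ λ a b → Card S.setoid (λ f → Sifted As n f × prime A ∣ f) a × Card S.setoid (Sifted (A ∷ As) n) b × (a ℕ.+ b ≡ k)
    -- `card-split` wants a decision for every series, whereas divisibility is decided for finitely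
    -- supported ones; truncation changes nothing on polynomials of degree `n`.
    sift {n} C with card-split S.setoid {D = λ f → prime A ∣ truncate (suc n) f}
      (λ f → ∣? (Irreducible.monic (prime-irr A)) (suc n , truncate-Deg< (suc n) f))
      (λ e → ∣-respʳ (snoc-cong (suc n) e refl)) C
    ... | a , b , C₁ , C₂ , a+b≡k = a , b ,
      card-⇔ S.setoid (λ (s , d) → s , ∣-respʳ (whole s) d) (λ (s , d) → s , ∣-respʳ (S.sym (whole s)) d) C₁ ,
      card-⇔ S.setoid (λ (s , ¬d) → proj₁ s , (λ d → ¬d (∣-respʳ (S.sym (whole s)) d)) ∷ proj₂ s)
        (λ { (sd , ¬d ∷ nd) → (sd , nd) , λ d → ¬d (∣-respʳ (whole (sd , nd)) d) }) C₂ ,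
      a+b≡k
      where
      whole : ∀ {f} → Sifted As n f → truncate (suc n) f ≋ f
      whole ((mf , _) , _) = truncate-≋ (proj₂ mf)

  -- The sieve on generating functions.

  count : (ℕ → ℕ) → Q.Series
  count N n = fromℕ (N n)

  -- `K` counts the multiples of an atom of degree `s`: none below `s`, and from there on a copy of
  -- `N` shifted by `s`. Its generating function is X^s times that of `N`.
  sieve-step : ∀ s {N K M} → (∀ n → K n ℕ.+ M n ≡ N n) → (∀ {n} → n < s → K n ≡ 0) → (∀ m → K (m ℕ.+ s) ≡ N m) →
    count M Q.≋ Q.δ s (count N)
  sieve-step s {N} {K} {M} sum small large = Q.mk λ n → ≡.sym (≡.trans
      (≡.cong₂ (λ x y → x ℚ.+ ℚ.- y) (≡.trans (≡.cong fromℕ (≡.sym (sum n))) (fromℕ-+ (K n) (M n))) (≡.sym (multiples n)))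
      (xyx⁻¹≈y (fromℕ (K n)) (fromℕ (M n))))
    where
    open import Algebra.Properties.AbelianGroup ℚP.+-0-abelianGroup using (xyx⁻¹≈y)
    multiples : ∀ n → fromℕ (K n) ≡ Q.X^ s (count N) n
    multiples n with n ℕP.<? s
    ... | yes n<s = ≡.trans (≡.cong fromℕ (small n<s)) (≡.sym (Q.X^-< (count N) n<s))
    ... | no n≮s = ≡.trans (≡.cong fromℕ (≡.trans (≡.cong K (≡.sym m+s≡n)) (large m)))
      (≡.sym (≡.trans (≡.cong (Q.X^ s (count N)) (≡.trans (≡.sym m+s≡n) (ℕP.+-comm m s))) (Q.X^-+ s (count N) m)))
      where
      m = n ℕ.∸ s
      m+s≡n : m ℕ.+ s ≡ n
      m+s≡n = ℕP.m∸n+n≡m (ℕP.≮⇒≥ n≮s)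

  sieve : ∀ As → AllPairs Separate As → ∃ λ N → (∀ n → Card S.setoid (Sifted As n) (N n)) ×
    count N Q.≋ foldr (Q.δ ∘ size) (count selfDualCount) As
  sieve [] [] = selfDualCount , (λ n → card-⇔ S.setoid (_, []) proj₁ (card-selfDual n)) , Q.S.refl
  sieve (A ∷ As) (sep ∷ seps) = extend (sieve As seps)
    where
    combine : ∀ {N} → (∀ n → Card S.setoid (Sifted As n) (N n)) → count N Q.≋ foldr (Q.δ ∘ size) (count selfDualCount) As →
      (K M : ℕ → ℕ) → (∀ n → Card S.setoid (λ f → Sifted As n f × prime A ∣ f) (K n)) →
      (∀ n → Card S.setoid (Sifted (A ∷ As) n) (M n)) → (∀ n → K n ℕ.+ M n ≡ N n) →
      ∃ λ N → (∀ n → Card S.setoid (Sifted (A ∷ As) n) (N n)) × count N Q.≋ foldr (Q.δ ∘ size) (count selfDualCount) (A ∷ As)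
    combine C eq K M CK CM sum = M , CM , Q.S.trans
      (sieve-step (size A) {K = K} sum
        (λ {n} n<s → card-unique S.setoid (CK n) (card-∅ S.setoid λ (s , d) →
          let (m , _ , e , _) = sifted-quotient A As sep s d in ℕP.<⇒≱ n<s (≡.subst (size A ≤_) e (ℕP.m≤n+m (size A) m))))
        (λ m → card-unique S.setoid (CK (m ℕ.+ size A)) (card-multiples A As sep (C m))))
      (Q.δ-cong (size A) eq)
    extend : (∃ λ N → (∀ n → Card S.setoid (Sifted As n) (N n)) × count N Q.≋ foldr (Q.δ ∘ size) (count selfDualCount) As) → _
    extend (N , C , eq) = combine C eq (λ n → proj₁ (sifted n)) (λ n → proj₁ (proj₂ (sifted n)))
      (λ n → proj₁ (proj₂ (proj₂ (sifted n)))) (λ n → proj₁ (proj₂ (proj₂ (proj₂ (sifted n)))))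
      (λ n → proj₂ (proj₂ (proj₂ (proj₂ (sifted n)))))
      where
      sifted : ∀ n → ∃₂ λ a b → Card S.setoid (λ f → Sifted As n f × prime A ∣ f) a × Card S.setoid (Sifted (A ∷ As) n) b × (a ℕ.+ b ≡ N n)
      sifted n = sift A As sep (C n)

  -- Construction of all atoms, degree by degree, and the Euler product.

  irreducible-factor : ∀ n {f} → 1 ≤ n → Monic n f → ∃₂ λ e h → e ≤ n × Irreducible e h × h ∣ f
  irreducible-factor = <-rec (λ n → ∀ {f} → 1 ≤ n → Monic n f → ∃₂ λ e h → e ≤ n × Irreducible e h × h ∣ f) step
    where
    step : ∀ n → (∀ {m} → m < n → ∀ {f} → 1 ≤ m → Monic m f → ∃₂ λ e h → e ≤ m × Irreducible e h × h ∣ f) →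
      ∀ {f} → 1 ≤ n → Monic n f → ∃₂ λ e h → e ≤ n × Irreducible e h × h ∣ f
    step n rec {f} 1≤n mf with factor? 1≤n mf
    ... | inj₁ I = n , f , ℕP.≤-refl , I , ∣-refl
    ... | inj₂ (a , b , h , k , mh , mk′ , 1≤a , 1≤b , ≡.refl , e) with rec (ℕP.m<m+n a 1≤b) 1≤a mh
    ... | e′ , g , le , I , g∣h = e′ , g , ℕP.≤-trans le (ℕP.m≤m+n a b) , I , ∣-respʳ e (∣-✶ʳ k (monic⇒finite mk′) g∣h)

  MinusType PlusType : ℕ → Series → Set _
  MinusType d f = IrreducibleUnit d f × IsDual d f f
  PlusType d f = IrreducibleUnit d f × (¬ IsDual d f f)

  isDual? : ∀ {d f} → IrreducibleUnit d f → Dec (IsDual d f f)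
  isDual? {d} {f} (I , nz) = decide (degree? _ (star d f ⊕ ⊖ f) (proj₂ finite))
    where
    finite = finite-⊕ (monic⇒finite (dual-monic nz (Irreducible.monic I) (star-dual d nz))) (finite-⊖ (monic⇒finite (Irreducible.monic I)))
    decide : star d f ⊕ ⊖ f ≋ 𝟘 ⊎ (∃ λ e → e < _ × HasDegree e (star d f ⊕ ⊖ f)) → Dec (IsDual d f f)
    decide (inj₁ z) = yes (dual-cong S.refl (x∙y⁻¹≈ε⇒x≈y (star d f) f z) (star-dual d nz))
    decide (inj₂ (e , _ , ne , _)) = no λ D → ne (at (x≈y⇒x∙y⁻¹≈ε (dual-unique nz (star-dual d nz) D)) e)

  minusAtom : ∀ {d f} → MinusType d f → Atom
  minusAtom {d} {f} ((I , nz) , D) = record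
    { size = d ; atom = f ; atom-selfDual = Irreducible.monic I , nz , D
    ; degree = d ; prime = f ; prime-irr = I ; prime∣atom = ∣-refl ; prime∣⇒atom∣ = λ _ d → d
    ; primes-of-atom = λ Ih h∣f → let (e , h≋f) = irreducible-∣ Ih I h∣f in e , inj₁ h≋f }

  star-irreducible : ∀ {d f} → IrreducibleUnit d f → Irreducible d (star d f)
  star-irreducible {d} (I , nz) = dual-irreducible nz I (star-dual d nz)

  plusAtom : ∀ {d f} → PlusType d f → Atom
  plusAtom {d} {f} ((I , nz) , ¬D) = record
    { size = d ℕ.+ d ; atom = f ✶ f*
    ; atom-selfDual = monic-✶ m m* , *-≉0 nz nz* ,
        dual-cong {d = d ℕ.+ d} S.refl (✶-comm f* f) (dual-✶ (proj₂ m) (proj₂ m*) (star-dual d nz) (dual-sym m (star-dual d nz)))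
    ; degree = d ; prime = f ; prime-irr = I ; prime∣atom = ∣-✶ʳ f* (monic⇒finite m*) ∣-refl
    ; prime∣⇒atom∣ = both
    ; primes-of-atom = λ Ih h∣ff* → Sum.[ (λ h∣f → let (e , h≋f) = irreducible-∣ Ih I h∣f in e , inj₁ h≋f)
                                         , (λ h∣f* → let (e , h≋f*) = irreducible-∣ Ih I* h∣f* in e , inj₂ h≋f*) ]′
        (euclid Ih (monic⇒finite m) (monic⇒finite m*) h∣ff*) }
    where
    f* = star d f
    I* = star-irreducible (I , nz)
    m = Irreducible.monic I
    m* = Irreducible.monic I*
    nz* = dual-const-≉0 m (star-dual d nz)
    -- Self-duality of `g` makes `f*` divide g = k f as well. Euclid's lemma places `f*` in `k`, as
    -- wanted, or in `f`; the latter forces f* = f, and `f` is not self-dual.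
    both : ∀ {n g} → SelfDual n g → f ∣ g → f ✶ f* ∣ g
    both {n} {g} sd f∣g@(divides k fk eq) with euclid I* fk (monic⇒finite m) (∣-respʳ eq (dual-∣ sd m (star-dual d nz) f∣g))
    ... | inj₁ (divides l fl eq′) = divides l fl (S.trans eq (S.trans (✶-cong eq′ S.refl) (S.trans (✶-assoc l f* f) (✶-cong S.refl (✶-comm f* f)))))
    ... | inj₂ f*∣f = ⊥-elim (¬D (dual-cong S.refl (proj₂ (irreducible-∣ I* I f*∣f)) (star-dual d nz)))

  plus-star : ∀ {d f} → PlusType d f → PlusType d (star d f)
  plus-star {d} {f} ((I , nz) , ¬D) = (star-irreducible (I , nz) , nz*) , λ D* →
      ¬D (dual-cong S.refl (dual-unique nz* D* (dual-sym m (star-dual d nz))) (star-dual d nz))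
    where
    m = Irreducible.monic I
    nz* = dual-const-≉0 m (star-dual d nz)

  star-star : ∀ {d f} → IrreducibleUnit d f → star d (star d f) ≋ f
  star-star {d} (I , nz) = dual-unique nz* (star-dual d nz*) (dual-sym m (star-dual d nz))
    where
    m = Irreducible.monic I
    nz* = dual-const-≉0 m (star-dual d nz)

  star-cong : ∀ {d f g} → ¬ f 0 ≈ 0# → ¬ g 0 ≈ 0# → f ≋ g → star d f ≋ star d g
  star-cong {d} nf ng e = dual-unique ng (dual-cong e S.refl (star-dual d nf)) (star-dual d ng)

  module _ {a p r} {A : Set a} {P : A → Set p} {B : Set r} (f : ∀ {x} → P x → B) where

    length-reduce : ∀ {xs} (ps : All P xs) → length (reduce f ps) ≡ length xs
    length-reduce [] = ≡.refl
    length-reduce (_ ∷ ps) = ≡.cong suc (length-reduce ps)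

    All-reduce : ∀ {q} {Q : B → Set q} → (∀ {x} (px : P x) → Q (f px)) → ∀ {xs} (ps : All P xs) → All Q (reduce f ps)
    All-reduce g [] = []
    All-reduce g (px ∷ ps) = g px ∷ All-reduce g ps

    AllPairs-reduce : ∀ {q s} {R : Rel A s} {Q : Rel B q} → (∀ {x y} (px : P x) (py : P y) → R x y → Q (f px) (f py)) →
      ∀ {xs} (ps : All P xs) → AllPairs R xs → AllPairs Q (reduce f ps)
    AllPairs-reduce {R = R} {Q} g [] [] = []
    AllPairs-reduce {R = R} {Q} g (px ∷ ps) (r ∷ rs) = row ps r ∷ AllPairs-reduce g ps rs
      where
      row : ∀ {xs} (ps : All P xs) → All (R _) xs → All (Q (f px)) (reduce f ps)
      row [] [] = []
      row (py ∷ ps) (r ∷ rs) = g px py r ∷ row ps rs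

    Any-reduce : ∀ {q s} {R : A → Set s} {Q : B → Set q} → (∀ {x} (px : P x) → R x → Q (f px)) →
      ∀ {xs} (ps : All P xs) → Any R xs → Any Q (reduce f ps)
    Any-reduce g (px ∷ ps) (here r) = here (g px r)
    Any-reduce g (px ∷ ps) (there i) = there (Any-reduce g ps i)

  -- `degrees` refers to the primes, which keeps the families of different `d` separated; `covering`
  -- ensures that no irreducible factor of degree d escapes the sieve.
  record AtomFamily (d : ℕ) : Set (c ⊔ ℓ) where
    field
      minus plus    : List Atom
      minus-sizes   : All (λ A → size A ≡ d) minus
      plus-sizes    : All (λ A → size A ≡ d ℕ.+ d) plus
      minus-length  : length minus ≡ SDIM⁻ d
      plus-length   : length plus ≡ SDIM⁺ d
      degrees       : All (λ A → degree A ≡ d) (minus ++ plus)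
      separated     : AllPairs Separate (minus ++ plus)
      covering      : ∀ {h n f} → IrreducibleUnit d h → SelfDual n f → h ∣ f → Any (λ A → prime A ∣ f) (minus ++ plus)

  abstract
    atoms : ∀ d → AtomFamily d
    atoms d with card-SDIM⁺ d
    -- Duality has no fixed points among the non-self-dual irreducibles; one representative per
    -- orbit {f, f~} gives N = 2 · `length rs`, so the halving in `SDIM⁺` is exact.
    ... | N , SDIM⁺≡ , C⁺ = build (card-SDIM⁻ d) (involution-representatives S.setoid (star d) plus-star
          (λ ((_ , nf) , _) ((_ , ng) , _) → star-cong nf ng) (λ (I , _) → star-star I)
          (λ ((_ , nz) , ¬D) e → ¬D (dual-cong S.refl e (star-dual d nz))) C⁺)
      where
      build : Card S.setoid (MinusType d) (SDIM⁻ d) →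
        (∃ λ rs → (N ≡ length rs ℕ.+ length rs) × All (PlusType d) rs ×
          (∀ {x} → PlusType d x → Any (λ z → x ≋ z ⊎ x ≋ star d z) rs) ×
          AllPairs (λ x y → (¬ y ≋ x) × (¬ y ≋ star d x)) rs) → AtomFamily d
      build (card ms len u ps complete⁻) (rs , N≡ , qs , complete⁺ , sep) = record
        { minus = reduce minusAtom ps
        ; plus = reduce plusAtom qs
        ; minus-sizes = All-reduce minusAtom (λ _ → ≡.refl) ps
        ; plus-sizes = All-reduce plusAtom (λ _ → ≡.refl) qs
        ; minus-length = ≡.trans (length-reduce minusAtom ps) len
        ; plus-length = ≡.trans (length-reduce plusAtom qs)
            (≡.sym (≡.trans SDIM⁺≡ (≡.trans (≡.cong (ℕ._/ 2) (≡.trans N≡ n+n≡n*2)) (m*n/n≡m (length rs) 2))))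
        ; degrees = AllP.++⁺ (All-reduce minusAtom (λ _ → ≡.refl) ps) (All-reduce plusAtom (λ _ → ≡.refl) qs)
        ; separated = AllPairsP.++⁺
            (AllPairs-reduce minusAtom (λ px py x≉y → minus-minus px x≉y) ps u)
            (AllPairs-reduce plusAtom (λ _ _ → plus-plus) qs sep)
            (All-reduce minusAtom (λ px → All-reduce plusAtom (λ py → minus-plus px py) qs) ps)
        ; covering = cover }
        where
        n+n≡n*2 : length rs ℕ.+ length rs ≡ length rs ℕ.* 2
        n+n≡n*2 = ≡.trans (≡.cong (length rs ℕ.+_) (≡.sym (ℕP.+-identityʳ _))) (ℕP.*-comm 2 (length rs))
        star-minus : ∀ {x} → MinusType d x → star d x ≋ x
        star-minus ((_ , nz) , D) = dual-unique nz (star-dual d nz) D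
        minus-minus : ∀ {x y} → MinusType d x → ¬ x ≋ y → ¬ (d ≡ d × (y ≋ x ⊎ y ≋ star d x))
        minus-minus px x≉y (_ , inj₁ e) = x≉y (S.sym e)
        minus-minus px x≉y (_ , inj₂ e) = x≉y (S.sym (S.trans e (star-minus px)))
        plus-plus : ∀ {x y} → (¬ y ≋ x) × (¬ y ≋ star d x) → ¬ (d ≡ d × (y ≋ x ⊎ y ≋ star d x))
        plus-plus (ne , ne*) (_ , e) = Sum.[ ne , ne* ]′ e
        minus-plus : ∀ {x y} → MinusType d x → PlusType d y → ¬ (d ≡ d × (y ≋ x ⊎ y ≋ star d x))
        minus-plus px (_ , ¬D) (_ , inj₁ e) = ¬D (dual-cong (S.sym e) (S.sym e) (proj₂ px))
        minus-plus px py (d≡d , inj₂ e) = minus-plus px py (d≡d , inj₁ (S.trans e (star-minus px)))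
        cover : ∀ {h n f} → IrreducibleUnit d h → SelfDual n f → h ∣ f →
          Any (λ A → prime A ∣ f) (reduce minusAtom ps ++ reduce plusAtom qs)
        cover {h} {n} {f} Ih sd h∣f with isDual? Ih
        ... | yes D = AnyP.++⁺ˡ (Any-reduce minusAtom (λ _ h≋x → ∣-respˡ h≋x h∣f) ps (complete⁻ (Ih , D)))
        ... | no ¬D = AnyP.++⁺ʳ (reduce minusAtom ps) (Any-reduce plusAtom member qs (complete⁺ (Ih , ¬D)))
          where
          member : ∀ {x} → PlusType d x → h ≋ x ⊎ h ≋ star d x → x ∣ f
          member _ (inj₁ e) = ∣-respˡ e h∣f
          -- Here `h` is the dual of the chosen representative. It divides the self-dual `f`, and
          -- then so does its own dual, the representative.
          member ((I , nz) , _) (inj₂ e) = dual-∣ sd (Irreducible.monic (star-irreducible (I , nz)))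
            (dual-sym (Irreducible.monic I) (star-dual d nz)) (∣-respˡ e h∣f)

  open AtomFamily

  atomsUpTo : ℕ → List Atom
  atomsUpTo zero = []
  atomsUpTo (suc d) = (minus (atoms (suc d)) ++ plus (atoms (suc d))) ++ atomsUpTo d

  atomsUpTo-degrees : ∀ M → All (λ A → degree A ≤ M) (atomsUpTo M)
  atomsUpTo-degrees zero = []
  atomsUpTo-degrees (suc d) = AllP.++⁺ (All.map ℕP.≤-reflexive (degrees (atoms (suc d))))
    (All.map ℕP.m≤n⇒m≤1+n (atomsUpTo-degrees d))

  atomsUpTo-separated : ∀ M → AllPairs Separate (atomsUpTo M)
  atomsUpTo-separated zero = []
  atomsUpTo-separated (suc d) = AllPairsP.++⁺ (separated (atoms (suc d))) (atomsUpTo-separated d)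
    (All.map (λ dA≡ → All.map (λ dB≤ (dB≡dA , _) → ℕP.<⇒≱ (s≤s dB≤) (ℕP.≤-reflexive (≡.sym (≡.trans dB≡dA dA≡))))
      (atomsUpTo-degrees d)) (degrees (atoms (suc d))))

  atomsUpTo-covering : ∀ M {d h n f} → 1 ≤ d → d ≤ M → IrreducibleUnit d h → SelfDual n f → h ∣ f →
    Any (λ A → prime A ∣ f) (atomsUpTo M)
  atomsUpTo-covering zero 1≤d d≤0 = ⊥-elim (ℕP.<⇒≱ 1≤d d≤0)
  atomsUpTo-covering (suc M) 1≤d d≤M Ih sd h∣f with ℕP.m≤n⇒m<n∨m≡n d≤M
  ... | inj₁ (s≤s d≤M′) = AnyP.++⁺ʳ (minus (atoms (suc M)) ++ plus (atoms (suc M))) (atomsUpTo-covering M 1≤d d≤M′ Ih sd h∣f)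
  ... | inj₂ ≡.refl = AnyP.++⁺ˡ (covering (atoms (suc M)) Ih sd h∣f)

  -- The part of the Euler product in prime degrees up to a bound, as an operator on series:
  -- exponents become iteration counts.
  eulerProduct : ℕ → Q.Series → Q.Series
  eulerProduct zero f = f
  eulerProduct (suc d) f = Q.δ^ (SDIM⁻ (suc d)) (suc d) (Q.δ^ (SDIM⁺ (suc d)) (suc d ℕ.+ suc d) (eulerProduct d f))

  foldr-δ : ∀ {As s k f} → All (λ A → size A ≡ s) As → length As ≡ k → foldr (Q.δ ∘ size) f As ≡ Q.δ^ k s f
  foldr-δ [] ≡.refl = ≡.refl
  foldr-δ {A ∷ _} (≡.refl ∷ ss) ≡.refl = ≡.cong (Q.δ (size A)) (foldr-δ ss ≡.refl)

  foldr-atomsUpTo : ∀ M f → foldr (Q.δ ∘ size) f (atomsUpTo M) ≡ eulerProduct M f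
  foldr-atomsUpTo zero f = ≡.refl
  foldr-atomsUpTo (suc d) f = ≡.trans (foldr-++ (Q.δ ∘ size) f (minus A ++ plus A) (atomsUpTo d))
    (≡.trans (foldr-++ (Q.δ ∘ size) _ (minus A) (plus A))
      (≡.trans (foldr-δ (minus-sizes A) (minus-length A))
        (≡.cong (Q.δ^ (SDIM⁻ (suc d)) (suc d)) (≡.trans (foldr-δ (plus-sizes A) (plus-length A))
          (≡.cong (Q.δ^ (SDIM⁺ (suc d)) (suc d ℕ.+ suc d)) (foldr-atomsUpTo d f))))))
    where A = atoms (suc d)

  -- Every self-dual polynomial of degree between 1 and M is divisible by the prime of an atom, so the sieve leaves only 1.
  euler-identity : ∀ M n → n ≤ M → eulerProduct M (count selfDualCount) n ≡ Q.𝟙 n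
  euler-identity M n n≤M = conclude (sieve (atomsUpTo M) (atomsUpTo-separated M))
    where
    conclude : (∃ λ N → (∀ n → Card S.setoid (Sifted (atomsUpTo M) n) (N n)) ×
      count N Q.≋ foldr (Q.δ ∘ size) (count selfDualCount) (atomsUpTo M)) → _
    conclude (N , C , eq) = ≡.trans (≡.cong-app (≡.sym (foldr-atomsUpTo M (count selfDualCount))) n) (≡.trans (≡.sym (Q.at eq n)) (value n n≤M))
      where
      value : ∀ n → n ≤ M → count N n ≡ Q.𝟙 n
      value zero _ = ≡.cong fromℕ (card-unique S.setoid (C 0) (card-singleton S.setoid
        (selfDual-𝟙 , All.universal (λ A d → let (e , e+d≡0 , _) = monic-cofactor 𝟙-monic (Irreducible.monic (prime-irr A)) d in
            ℕP.<⇒≱ (Irreducible.positive (prime-irr A)) (≡.subst (degree A ≤_) e+d≡0 (ℕP.m≤n+m (degree A) e))) _)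
        (λ ((mf , _) , _) → monic0⇒𝟙 mf)))
      value (suc n) n<M = ≡.cong fromℕ (card-unique S.setoid (C (suc n)) (card-∅ S.setoid λ (sd@(mf , nz , _) , nd) →
        let (e , h , e≤ , I , h∣f) = irreducible-factor (suc n) (s≤s z≤n) mf
            unit = I , const-✶-≉0ʳ (equality h∣f) nz
        in AllP.All¬⇒¬Any nd (atomsUpTo-covering M (Irreducible.positive I) (ℕP.≤-trans e≤ n<M) unit sd h∣f)))

-- Binomial coefficients with integer upper argument as powers of 1 - X.

module Binomial where
  open Rational
  open Q
  open import Data.Rational using (_+_; _*_; -_)
  open ≡ using (refl; sym; trans; cong; cong₂)
  open ≡.≡-Reasoning
  open import Data.Integer as ℤ using (ℤ; +_; _◃_)
  import Data.Integer.Properties as ℤP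
  open import Data.Nat using (NonZero; _!)
  open import Data.Nat.Properties using (_!≢0)
  open import Data.Rational.Solver using (module +-*-Solver)
  open import Data.Rational.Unnormalised as ℚᵘ using (mkℚᵘ; *≡*)
  import Data.Rational.Unnormalised.Properties as ℚᵘP

  falling : ℤ → ℕ → ℚ
  falling m k = prodℚ (map (λ i → fromℤ (m ℤ.- + i)) (upTo k))

  falling-suc : ∀ m k → falling (ℤ.suc m) (suc k) ≡ fromℤ (ℤ.suc m) * falling m k
  falling-suc m k = cong₂ _*_ (cong fromℤ (ℤP.+-identityʳ (ℤ.suc m)))
    (trans (cong prodℚ (map-applyUpTo suc (λ i → fromℤ (ℤ.suc m ℤ.- + i)) k))
      (trans (pointwise k (λ i → i)) (cong prodℚ (sym (map-applyUpTo (λ i → i) (λ i → fromℤ (m ℤ.- + i)) k)))))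
    where
    shift : ∀ i → ℤ.suc m ℤ.- + suc i ≡ m ℤ.- + i
    shift i = trans (cong (λ z → ℤ.suc m ℤ.+ z) (ℤP.neg-distrib-+ (+ 1) (+ i)))
      (trans (cong (ℤ._+ (ℤ.- + 1 ℤ.+ ℤ.- + i)) (ℤP.+-comm (+ 1) m))
        (trans (ℤP.+-assoc m (+ 1) _) (cong (λ z → m ℤ.+ z) (trans (sym (ℤP.+-assoc (+ 1) (ℤ.- + 1) (ℤ.- + i))) (ℤP.+-identityˡ _)))))
    pointwise : ∀ k (g : ℕ → ℕ) → prodℚ (applyUpTo (λ i → fromℤ (ℤ.suc m ℤ.- + suc (g i))) k) ≡ prodℚ (applyUpTo (λ i → fromℤ (m ℤ.- + g i)) k)
    pointwise zero g = refl
    pointwise (suc k) g = cong₂ _*_ (cong fromℤ (shift (g 0))) (pointwise k (g ∘ suc))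

  falling-suc′ : ∀ m k → falling m (suc k) ≡ fromℤ m * falling (ℤ.pred m) k
  falling-suc′ m k = ≡.subst (λ z → falling z (suc k) ≡ fromℤ z * falling (ℤ.pred m) k) (ℤP.suc-pred m) (falling-suc (ℤ.pred m) k)

  -- `falling-suc` splits off the first factor of a falling factorial, this one the last; Pascal's
  -- rule compares the two.
  falling-last : ∀ k m → falling m (suc k) ≡ falling m k * fromℤ (m ℤ.- + k)
  falling-last zero m = ℚP.*-comm (fromℤ (m ℤ.- + 0)) 1ℚ
  falling-last (suc k) m = begin
    falling m (suc (suc k))                                          ≡⟨ falling-suc′ m (suc k) ⟩
    fromℤ m * falling (ℤ.pred m) (suc k)                             ≡⟨ cong (fromℤ m *_) (falling-last k (ℤ.pred m)) ⟩
    fromℤ m * (falling (ℤ.pred m) k * fromℤ (ℤ.pred m ℤ.- + k))      ≡⟨ sym (ℚP.*-assoc (fromℤ m) _ _) ⟩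
    fromℤ m * falling (ℤ.pred m) k * fromℤ (ℤ.pred m ℤ.- + k)        ≡⟨ cong₂ _*_ (sym (falling-suc′ m k)) (cong fromℤ shift) ⟩
    falling m (suc k) * fromℤ (m ℤ.- + suc k)                        ∎
    where
    shift : ℤ.pred m ℤ.- + k ≡ m ℤ.- + suc k
    shift = trans (cong (ℤ._- + k) (ℤP.+-comm (ℤ.- + 1) m))
      (trans (ℤP.+-assoc m _ _) (cong (λ z → m ℤ.+ z) (sym (ℤP.neg-distrib-+ (+ 1) (+ k)))))

  recip : ∀ n .{{_ : NonZero n}} → (+ 1 ℚ./ n) * fromℕ n ≡ 1ℚ
  recip (suc n) = ℚP.toℚᵘ-injective (ℚᵘP.≃-trans (ℚP.toℚᵘ-homo-* (+ 1 ℚ./ suc n) (fromℕ (suc n)))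
    (ℚᵘP.≃-trans (ℚᵘP.*-cong (ℚP.toℚᵘ-fromℚᵘ (mkℚᵘ (+ 1) n)) (ℚP.toℚᵘ-fromℚᵘ (mkℚᵘ (+ suc n) 0)))
      (*≡* (trans (ℤP.*-identityʳ _) (trans (ℤP.*-identityˡ _) (sym (trans (ℤP.*-identityˡ _) (ℤP.*-identityʳ (+ suc n)))))))))

  1/! : ℕ → ℚ
  1/! k = (+ 1 ℚ./ (k !)) {{k !≢0}}

  1/!-suc : ∀ k → 1/! (suc k) * fromℕ (suc k) ≡ 1/! k
  1/!-suc k = begin
    1/! (suc k) * fromℕ (suc k)                             ≡⟨ sym (ℚP.*-identityʳ _) ⟩
    1/! (suc k) * fromℕ (suc k) * 1ℚ                        ≡⟨ cong (1/! (suc k) * fromℕ (suc k) *_) (sym (recip (k !) {{k !≢0}})) ⟩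
    1/! (suc k) * fromℕ (suc k) * (1/! k * fromℕ (k !))
      ≡⟨ solve 4 (λ a b c d → a :* b :* (c :* d) := a :* (b :* d) :* c) refl (1/! (suc k)) (fromℕ (suc k)) (1/! k) (fromℕ (k !)) ⟩
    1/! (suc k) * (fromℕ (suc k) * fromℕ (k !)) * 1/! k
      ≡⟨ cong (λ z → 1/! (suc k) * z * 1/! k) (sym (fromℕ-* (suc k) (k !))) ⟩
    1/! (suc k) * fromℕ (suc k !) * 1/! k                   ≡⟨ cong (_* 1/! k) (recip (suc k !) {{suc k !≢0}}) ⟩
    1ℚ * 1/! k                                              ≡⟨ ℚP.*-identityˡ _ ⟩
    1/! k                                                   ∎
    where open +-*-Solver

  -- The leading factor is m + 1 = (m - k) + (k + 1): the first summand extends the falling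
  -- factorial of `m` by one factor, the second cancels a factor of (k + 1)!. The sign of `m` is
  -- irrelevant.
  pascal : ∀ m k → binom (ℤ.suc m) (suc k) ≡ binom m (suc k) + binom m k
  pascal m k = begin
    falling (ℤ.suc m) (suc k) * 1/! (suc k)                                  ≡⟨ cong (_* 1/! (suc k)) (falling-suc m k) ⟩
    fromℤ (ℤ.suc m) * falling m k * 1/! (suc k)                              ≡⟨ cong (λ z → z * falling m k * 1/! (suc k)) split-suc ⟩
    (fromℤ (m ℤ.- + k) + fromℕ (suc k)) * falling m k * 1/! (suc k)
      ≡⟨ solve 4 (λ a b f r → (a :+ b) :* f :* r := f :* a :* r :+ f :* (r :* b)) refl (fromℤ (m ℤ.- + k)) (fromℕ (suc k)) (falling m k) (1/! (suc k)) ⟩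
    falling m k * fromℤ (m ℤ.- + k) * 1/! (suc k) + falling m k * (1/! (suc k) * fromℕ (suc k))
      ≡⟨ cong₂ _+_ (cong (_* 1/! (suc k)) (sym (falling-last k m))) (cong (falling m k *_) (1/!-suc k)) ⟩
    binom m (suc k) + binom m k                                              ∎
    where
    open +-*-Solver
    split-suc : fromℤ (ℤ.suc m) ≡ fromℤ (m ℤ.- + k) + fromℕ (suc k)
    split-suc = trans (cong fromℤ eq) (fromℤ-+ (m ℤ.- + k) (+ suc k))
      where
      eq : ℤ.suc m ≡ (m ℤ.- + k) ℤ.+ + suc k
      eq = sym (trans (cong (λ z → (m ℤ.- + k) ℤ.+ z) (ℤP.+-comm (+ 1) (+ k)))
        (trans (ℤP.+-assoc m (ℤ.- + k) (+ k ℤ.+ + 1)) (trans (cong (λ z → m ℤ.+ z) (trans (sym (ℤP.+-assoc (ℤ.- + k) (+ k) (+ 1)))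
          (trans (cong (ℤ._+ + 1) (ℤP.+-inverseˡ (+ k))) (ℤP.+-identityˡ (+ 1))))) (ℤP.+-comm m (+ 1)))))

  -- With alternating signs, Pascal's rule becomes (1 - X)^(m+1) = (1 - X)(1 - X)^m.
  binomNeg-suc : ∀ m → binomNeg (ℤ.suc m) ≋ δ 1 (binomNeg m)
  binomNeg-suc m = mk go
    where
    open +-*-Solver
    go : ∀ k → binomNeg (ℤ.suc m) k ≡ δ 1 (binomNeg m) k
    go zero = refl
    go (suc k) = begin
      - signPow k * binom (ℤ.suc m) (suc k)                       ≡⟨ cong (- signPow k *_) (pascal m k) ⟩
      - signPow k * (binom m (suc k) + binom m k)
        ≡⟨ solve 3 (λ s a b → (:- s) :* (a :+ b) := (:- s) :* a :+ (:- (s :* b))) refl (signPow k) (binom m (suc k)) (binom m k) ⟩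
      - signPow k * binom m (suc k) + - (signPow k * binom m k)   ∎

  binomNeg-0 : binomNeg (+ 0) ≋ 𝟙
  binomNeg-0 = mk λ where
      zero → refl
      (suc k) → trans (cong (λ z → signPow (suc k) * (z * 1/! (suc k))) (ℚP.*-zeroˡ (prodℚ (map (λ i → fromℤ (+ 0 ℤ.- + i)) (applyUpTo suc k)))))
        (trans (cong (signPow (suc k) *_) (ℚP.*-zeroˡ (1/! (suc k)))) (ℚP.*-zeroʳ (signPow (suc k))))

  dilate-binomNeg⁺ : ∀ e s → dilate e (binomNeg (Sign.+ ◃ s)) ≋ δ^ s (suc e) 𝟙
  dilate-binomNeg⁺ e zero = S.trans (spread-cong e 0 binomNeg-0) (dilate-𝟙 e)
  dilate-binomNeg⁺ e (suc s) = S.trans (spread-cong e 0 (S.trans (S.reflexive (cong binomNeg (lem s))) (binomNeg-suc (Sign.+ ◃ s))))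
    (S.trans (dilate-δ e (binomNeg (Sign.+ ◃ s))) (δ-cong (suc e) (dilate-binomNeg⁺ e s)))
    where
    lem : ∀ s → Sign.+ ◃ suc s ≡ ℤ.suc (Sign.+ ◃ s)
    lem zero = refl
    lem (suc s) = refl

  δ^-shift : ∀ k s f → δ^ (suc k) s f ≋ δ^ k s (δ s f)
  δ^-shift zero s f = S.refl
  δ^-shift (suc k) s f = δ-cong s (δ^-shift k s f)

  -- A negative power is described by what inverts it: by `binomNeg-suc` each factor 1 - X^(e+1)
  -- raises the exponent from -(s+1) to -s.
  dilate-binomNeg⁻ : ∀ e s → δ^ s (suc e) (dilate e (binomNeg (Sign.- ◃ s))) ≋ 𝟙
  dilate-binomNeg⁻ e zero = S.trans (spread-cong e 0 binomNeg-0) (dilate-𝟙 e)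
  dilate-binomNeg⁻ e (suc s) = S.trans (δ^-shift s (suc e) (dilate e (binomNeg (Sign.- ◃ suc s))))
    (S.trans (δ^-cong s (suc e) (S.trans (S.sym (dilate-δ e (binomNeg (Sign.- ◃ suc s))))
      (spread-cong e 0 (S.trans (S.sym (binomNeg-suc (Sign.- ◃ suc s))) (S.reflexive (cong binomNeg (lem s)))))))
      (dilate-binomNeg⁻ e s))
    where
    lem : ∀ s → ℤ.suc (Sign.- ◃ suc s) ≡ Sign.- ◃ s
    lem zero = refl
    lem (suc s) = refl

-- Sums over partitions as products over part sizes.

module Partition where
  open Counting using (fold-map-support)
  open Q
  open import Data.Rational using (_+_; _*_)
  open ≡ using (refl; sym; trans; cong; cong₂)
  open import Data.List.Membership.DecPropositional ℕ._≟_ using (_∈?_)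
  open import Data.List.Membership.Propositional using (_∈_)
  open import Data.List.Relation.Binary.Disjoint.Propositional using (Disjoint)
  import Data.List.Relation.Unary.Unique.DecPropositional.Properties ℕ._≟_ as DecUniqueP
  open import Data.List.Relation.Unary.Unique.Propositional using (Unique)
  import Data.List.Relation.Unary.Unique.Propositional.Properties as UniqueP

  E-∷-≡ : ∀ d l → E (d ∷ l) d ≡ suc (E l d)
  E-∷-≡ d l with d ℕ.≡ᵇ d in eq
  ... | true = refl
  ... | false = ⊥-elim (≡.subst T eq (ℕP.≡⇒≡ᵇ d d refl))

  E-∷-≢ : ∀ {x d} l → x ≢ d → E (x ∷ l) d ≡ E l d
  E-∷-≢ {x} {d} l x≢d with x ℕ.≡ᵇ d in eq
  ... | true = ⊥-elim (x≢d (ℕP.≡ᵇ⇒≡ x d (≡.subst T (sym eq) _)))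
  ... | false = refl

  E-absent : ∀ {l d} → All (_≢ d) l → E l d ≡ 0
  E-absent [] = refl
  E-absent {x ∷ l} (x≢d ∷ ne) = trans (E-∷-≢ l x≢d) (E-absent ne)

  Parts : ℕ → List ℕ → Set
  Parts M = All (λ x → 1 ≤ x × x ≤ M)

  -- The common specification of two enumerations: `partitions` from the statement, and `enumerate`,
  -- whose recursion follows the largest part. `M` bounds the parts.
  record IsPartition (M n : ℕ) (l : List ℕ) : Set where
    constructor isPartition
    field
      parts  : Parts M l
      sorted : T (nonIncreasing l)
      total  : sumℕ l ≡ n

  sorted-head : ∀ x l → T (nonIncreasing (x ∷ l)) → All (_≤ x) l
  sorted-head x [] _ = []
  sorted-head x (y ∷ l) s = y≤x ∷ All.map (λ z≤y → ℕP.≤-trans z≤y y≤x) (sorted-head y l (proj₂ (T-∧⁻ {y ℕ.≤ᵇ x} s)))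
    where y≤x = ℕP.≤ᵇ⇒≤ y x (proj₁ (T-∧⁻ s))

  sorted-tail : ∀ x l → T (nonIncreasing (x ∷ l)) → T (nonIncreasing l)
  sorted-tail x [] _ = _
  sorted-tail x (y ∷ l) s = proj₂ (T-∧⁻ {y ℕ.≤ᵇ x} s)

  sorted-∷ : ∀ x l → All (_≤ x) l → T (nonIncreasing l) → T (nonIncreasing (x ∷ l))
  sorted-∷ x [] _ _ = _
  sorted-∷ x (y ∷ l) (y≤x ∷ _) s = T-∧⁺ (ℕP.≤⇒≤ᵇ y≤x , s)

  part≤sum : ∀ {l} → All (λ x → x ≤ sumℕ l) l
  part≤sum {[]} = []
  part≤sum {x ∷ l} = ℕP.m≤m+n x (sumℕ l) ∷ All.map (λ le → ℕP.≤-trans le (ℕP.m≤n+m (sumℕ l) x)) part≤sum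

  length≤sum : ∀ {l} → All (1 ≤_) l → length l ≤ sumℕ l
  length≤sum [] = z≤n
  length≤sum (1≤x ∷ ps) = ℕP.+-mono-≤ 1≤x (length≤sum ps)

  listsOver⁺ : ∀ n l → Parts n l → l ∈ listsOver n (length l)
  listsOver⁺ n [] [] = here refl
  listsOver⁺ n (suc x ∷ l) ((_ , x<n) ∷ ps) =
    ∈-concatMap⁺ _ (Any.map (λ { refl → ∈-map⁺ (suc x ∷_) (listsOver⁺ n l ps) }) (∈-upTo⁺ x<n))

  listsOver⁻ : ∀ n k {l} → l ∈ listsOver n k → Parts n l × length l ≡ k
  listsOver⁻ n zero (here refl) = [] , refl
  listsOver⁻ n (suc k) l∈ with find (∈-concatMap⁻ _ {xs = upTo n} l∈)
  ... | j , j∈ , i with ∈-map⁻ (suc j ∷_) i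
  ... | l′ , l′∈ , refl with listsOver⁻ n k l′∈
  ... | ps , len = (s≤s z≤n , ∈-upTo⁻ j∈) ∷ ps , cong suc len

  listsOver-unique : ∀ n k → Unique (listsOver n k)
  listsOver-unique n zero = [] ∷ []
  listsOver-unique n (suc k) = UniqueP.concat⁺
    (AllP.map⁺ (All.universal (λ j → UniqueP.map⁺ ∷-injectiveʳ (listsOver-unique n k)) (upTo n)))
    (AllPairsP.map⁺ (AllPairs.map disjoint (UniqueP.upTo⁺ n)))
    where
    heads : ∀ {i j l} → (∃ λ x → x ∈ listsOver n k × l ≡ suc i ∷ x) → (∃ λ x → x ∈ listsOver n k × l ≡ suc j ∷ x) → i ≡ j
    heads (_ , _ , refl) (_ , _ , e) = ℕP.suc-injective (∷-injectiveˡ e)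
    disjoint : ∀ {i j} → i ≢ j → Disjoint (map (suc i ∷_) (listsOver n k)) (map (suc j ∷_) (listsOver n k))
    disjoint i≢j (i , j) = i≢j (heads (∈-map⁻ _ i) (∈-map⁻ _ j))

  private
    partition? : ∀ n (l : List ℕ) → Dec (T (nonIncreasing l ∧ (sumℕ l ℕ.≡ᵇ n)))
    partition? n l = T? (nonIncreasing l ∧ (sumℕ l ℕ.≡ᵇ n))

  partitions-unique : ∀ n → Unique (partitions n)
  partitions-unique n = UniqueP.filter⁺ (partition? n) (UniqueP.concat⁺
    (AllP.map⁺ (All.universal (listsOver-unique n) (upTo (suc n))))
    (AllPairsP.map⁺ (AllPairs.map disjoint (UniqueP.upTo⁺ (suc n)))))
    where
    disjoint : ∀ {i j} → i ≢ j → Disjoint (listsOver n i) (listsOver n j)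
    disjoint {i} {j} i≢j (l∈i , l∈j) = i≢j (trans (sym (proj₂ (listsOver⁻ n i l∈i))) (proj₂ (listsOver⁻ n j l∈j)))

  partitions⁻ : ∀ {M n l} → n ≤ M → l ∈ partitions n → IsPartition M n l
  partitions⁻ {M} {n} {l} n≤M l∈ with ∈-filter⁻ (partition? n) {xs = concatMap (listsOver n) (upTo (suc n))} l∈
  ... | i , t with find (∈-concatMap⁻ (listsOver n) {xs = upTo (suc n)} i)
  ... | k , _ , j = isPartition (All.map (λ (a , b) → a , ℕP.≤-trans b n≤M) (proj₁ (listsOver⁻ n k j))) (proj₁ (T-∧⁻ {nonIncreasing l} t))
    (ℕP.≡ᵇ⇒≡ (sumℕ l) n (proj₂ (T-∧⁻ {nonIncreasing l} t)))

  -- Parts are positive with sum n, so there are at most n of them and each is at most n: the search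
  -- behind `partitions` reaches them all.
  partitions⁺ : ∀ {M n l} → IsPartition M n l → l ∈ partitions n
  partitions⁺ {M} {n} {l} (isPartition ps so refl) = ∈-filter⁺ (partition? n)
    (∈-concatMap⁺ (listsOver n) (Any.map (λ { refl → listsOver⁺ n l (All.zipWith (λ ((a , _) , b) → a , b) (ps , part≤sum)) })
      (∈-upTo⁺ (s≤s (length≤sum (All.map proj₁ ps))))))
    (T-∧⁺ {nonIncreasing l} (so , ℕP.≡⇒≡ᵇ n n refl))

  -- The first argument is fuel for the recursion on n; any bound on n will do.
  enumerate : ℕ → ℕ → ℕ → List (List ℕ)
  withLargest : ℕ → ℕ → ℕ → List (List ℕ)
  enumerate fuel zero zero = [] ∷ []
  enumerate fuel zero (suc n) = []
  enumerate fuel (suc e) n = enumerate fuel e n ++ withLargest fuel e n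
  withLargest zero e n = []
  withLargest (suc fuel) e n with suc e ℕP.≤? n
  ... | yes _ = map (suc e ∷_) (enumerate fuel (suc e) (n ℕ.∸ suc e))
  ... | no _ = []

  enumerate⁻ : ∀ fuel M n {l} → l ∈ enumerate fuel M n → IsPartition M n l
  withLargest⁻ : ∀ fuel e n {l} → l ∈ withLargest fuel e n → IsPartition (suc e) n l × (∃ λ l′ → l ≡ suc e ∷ l′)
  enumerate⁻ fuel zero zero (here refl) = isPartition [] _ refl
  enumerate⁻ fuel (suc e) n l∈ with ∈-++⁻ (enumerate fuel e n) l∈
  ... | inj₂ i = proj₁ (withLargest⁻ fuel e n i)
  ... | inj₁ i with enumerate⁻ fuel e n i
  ... | isPartition ps so to = isPartition (All.map (λ (a , b) → a , ℕP.m≤n⇒m≤1+n b) ps) so to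
  withLargest⁻ (suc fuel) e n l∈ with suc e ℕP.≤? n
  ... | yes le with ∈-map⁻ (suc e ∷_) l∈
  ... | l′ , i , refl with enumerate⁻ fuel (suc e) (n ℕ.∸ suc e) i
  ... | isPartition ps so to = isPartition ((s≤s z≤n , ℕP.≤-refl) ∷ ps) (sorted-∷ (suc e) l′ (All.map proj₂ ps) so)
    (trans (cong (suc e ℕ.+_) to) (ℕP.m+[n∸m]≡n le)) , l′ , refl

  enumerate⁺ : ∀ fuel M n {l} → n ≤ fuel → IsPartition M n l → l ∈ enumerate fuel M n
  withLargest⁺ : ∀ fuel e n {l} → n ≤ fuel → IsPartition (suc e) n (suc e ∷ l) → suc e ∷ l ∈ withLargest fuel e n
  enumerate⁺ fuel zero n {[]} le (isPartition [] _ refl) = here refl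
  enumerate⁺ fuel zero n {x ∷ l} le (isPartition ((1≤x , x≤0) ∷ _) _ _) = ⊥-elim (ℕP.<⇒≱ 1≤x x≤0)
  enumerate⁺ fuel (suc e) n {[]} le (isPartition [] s t) = ∈-++⁺ˡ (enumerate⁺ fuel e n le (isPartition [] s t))
  enumerate⁺ fuel (suc e) n {x ∷ l} le p@(isPartition ((1≤x , x≤M) ∷ ps) s t) with ℕP.m≤n⇒m<n∨m≡n x≤M
  ... | inj₂ refl = ∈-++⁺ʳ (enumerate fuel e n) (withLargest⁺ fuel e n le p)
  ... | inj₁ (s≤s x≤e) = ∈-++⁺ˡ (enumerate⁺ fuel e n le (isPartition
    ((1≤x , x≤e) ∷ All.zipWith (λ ((a , _) , b) → a , ℕP.≤-trans b x≤e) (ps , sorted-head x l s)) s t))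
  withLargest⁺ zero e n z≤n (isPartition _ _ ())
  withLargest⁺ (suc fuel) e n {l} le (isPartition (_ ∷ ps) s t) with suc e ℕP.≤? n
  ... | no nle = ⊥-elim (nle (≡.subst (suc e ≤_) t (ℕP.m≤m+n (suc e) (sumℕ l))))
  ... | yes _ = ∈-map⁺ (suc e ∷_) (enumerate⁺ fuel (suc e) (n ℕ.∸ suc e) (smaller n le) (isPartition ps (sorted-tail (suc e) l s)
      (trans (sym (ℕP.m+n∸m≡n (suc e) (sumℕ l))) (cong (ℕ._∸ suc e) t))))
    where
    smaller : ∀ n → n ≤ suc fuel → n ℕ.∸ suc e ≤ fuel
    smaller zero _ = z≤n
    smaller (suc n) (s≤s n≤f) = ℕP.≤-trans (ℕP.m∸n≤m n e) n≤f

  enumerate-unique : ∀ fuel M n → Unique (enumerate fuel M n)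
  withLargest-unique : ∀ fuel e n → Unique (withLargest fuel e n)
  enumerate-unique fuel zero zero = [] ∷ []
  enumerate-unique fuel zero (suc n) = []
  enumerate-unique fuel (suc e) n = UniqueP.++⁺ (enumerate-unique fuel e n) (withLargest-unique fuel e n) disjoint
    where
    disjoint : ∀ {l} → ¬ (l ∈ enumerate fuel e n × l ∈ withLargest fuel e n)
    disjoint (i , j) with withLargest⁻ fuel e n j
    ... | _ , l′ , refl with enumerate⁻ fuel e n i
    ... | isPartition ((_ , le) ∷ _) _ _ = ℕP.<-irrefl refl le
  withLargest-unique zero e n = []
  withLargest-unique (suc fuel) e n with suc e ℕP.≤? n
  ... | yes _ = UniqueP.map⁺ ∷-injectiveʳ (enumerate-unique fuel (suc e) (n ℕ.∸ suc e))
  ... | no _ = []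

  downTo : ℕ → List ℕ
  downTo zero = []
  downTo (suc e) = suc e ∷ downTo e

  downTo⁺ : ∀ {x M} → 1 ≤ x → x ≤ M → x ∈ downTo M
  downTo⁺ {x} {zero} 1≤x x≤M = ⊥-elim (ℕP.<⇒≱ 1≤x x≤M)
  downTo⁺ {x} {suc M} 1≤x x≤M with ℕP.m≤n⇒m<n∨m≡n x≤M
  ... | inj₁ (s≤s le) = there (downTo⁺ 1≤x le)
  ... | inj₂ refl = here refl

  downTo-≤ : ∀ M → All (_≤ M) (downTo M)
  downTo-≤ zero = []
  downTo-≤ (suc M) = ℕP.≤-refl ∷ All.map ℕP.m≤n⇒m≤1+n (downTo-≤ M)

  downTo-unique : ∀ M → Unique (downTo M)
  downTo-unique zero = []
  downTo-unique (suc M) = All.map (λ le e → ℕP.<-irrefl (sym e) (s≤s le)) (downTo-≤ M) ∷ downTo-unique M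

  module _ (b : ℕ → Series) (b-0 : ∀ d → b d 0 ≡ 1ℚ) where

    weight : List ℕ → ℚ
    weight l = prodℚ (map (λ d → b d (E l d)) (B l))

    weightUpTo : ℕ → List ℕ → ℚ
    weightUpTo M l = prodℚ (map (λ d → b d (E l d)) (downTo M))

    -- A size that does not occur has multiplicity 0 and contributes `b d 0`, which is 1; so the
    -- product may run over all sizes up to `M`, independently of the partition.
    weight≡weightUpTo : ∀ {M l} → Parts M l → weight l ≡ weightUpTo M l
    weight≡weightUpTo {M} {l} ps = fold-map-support ℚP.*-1-commutativeMonoid (λ d → b d (E l d)) (B l) (downTo M)
      (DecUniqueP.deduplicate-! l) (downTo-unique M)
      (All.tabulate (λ i → let (1≤ , ≤M) = All.lookup ps (∈-deduplicate⁻ ℕ._≟_ l i) in downTo⁺ 1≤ ≤M))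
      (All.universal outside (downTo M))
      where
      outside : ∀ d → d ∈ B l ⊎ b d (E l d) ≡ 1ℚ
      outside d with d ∈? l
      ... | yes i = inj₁ (∈-deduplicate⁺ ℕ._≟_ i)
      ... | no ∉l = inj₂ (trans (cong (b d) (E-absent (All.tabulate (λ { i refl → ∉l i })))) (b-0 d))

    weightUpTo-∷ : ∀ {e x} l → e < x → weightUpTo e (x ∷ l) ≡ weightUpTo e l
    weightUpTo-∷ {zero} l lt = refl
    weightUpTo-∷ {suc e} {x} l lt = cong₂ _*_ (cong (b (suc e)) (E-∷-≢ {x} l (λ { refl → ℕP.<-irrefl refl lt })))
      (weightUpTo-∷ l (ℕP.<-trans ℕP.≤-refl lt))

    -- The product over d from 1 to the bound of the series b_d(X^d).
    productUpTo : ℕ → Series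
    productUpTo zero = 𝟙
    productUpTo (suc e) = dilate e (b (suc e)) ✶ productUpTo e

    -- The weight with k further parts of size e + 1.
    offsetWeight : ℕ → ℕ → List ℕ → ℚ
    offsetWeight e k l = b (suc e) (k ℕ.+ E l (suc e)) * weightUpTo e l

    sum-++ : ∀ xs ys → sumℚ (xs ++ ys) ≡ sumℚ xs + sumℚ ys
    sum-++ [] ys = sym (ℚP.+-identityˡ _)
    sum-++ (x ∷ xs) ys = trans (cong (x +_) (sum-++ xs ys)) (sym (ℚP.+-assoc x _ _))

    sum-scale : ∀ {A : Set} a (w : A → ℚ) xs → sumℚ (map (λ x → a * w x) xs) ≡ a * sumℚ (map w xs)
    sum-scale a w [] = sym (ℚP.*-zeroʳ a)
    sum-scale a w (x ∷ xs) = trans (cong (a * w x +_) (sum-scale a w xs)) (sym (ℚP.*-distribˡ-+ a _ _))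

    sum-cong : ∀ {A : Set} {v w : A → ℚ} xs → (∀ {x} → x ∈ xs → v x ≡ w x) → sumℚ (map v xs) ≡ sumℚ (map w xs)
    sum-cong [] e = refl
    sum-cong (x ∷ xs) e = cong₂ _+_ (e (here refl)) (sum-cong xs (e ∘ there))

    shift : ℕ → Series → Series
    shift k f n = f (k ℕ.+ n)

    dilate-✶-step : ∀ e f g n → (dilate e f ✶ g) n ≡ f 0 * g n + X^ (suc e) (dilate e (tail f) ✶ g) n
    dilate-✶-step e f g n = trans (at (✶-cong (dilate-tail e f) (S.refl {g})) n)
      (trans (at (✶-distribʳ g (f 0 ∙ 𝟙) (X^ (suc e) (dilate e (tail f)))) n)
        (cong₂ _+_ (trans (at (∙-✶ (f 0) 𝟙 g) n) (cong (f 0 *_) (at (✶-identityˡ g) n)))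
          (at (X^-✶ (suc e) (dilate e (tail f)) g) n)))

    sum-enumerate : ∀ fuel M n → n ≤ fuel → sumℚ (map (weightUpTo M) (enumerate fuel M n)) ≡ productUpTo M n
    -- Either no part e + 1 is left, which accounts for the constant term of `shift k (b (suc e))`,
    -- or one is removed and the offset grows to k + 1, which accounts for the tail times X^(e+1).
    -- The offset is needed because the weight depends on the whole multiplicity and not
    -- multiplicatively on single parts.
    sum-offset : ∀ fuel e k n → n ≤ fuel →
      sumℚ (map (offsetWeight e k) (enumerate fuel (suc e) n)) ≡ (dilate e (shift k (b (suc e))) ✶ productUpTo e) n
    sum-largest : ∀ fuel e k n → n ≤ fuel → sumℚ (map (offsetWeight e k) (withLargest fuel e n))
      ≡ X^ (suc e) (dilate e (tail (shift k (b (suc e)))) ✶ productUpTo e) n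

    sum-enumerate fuel zero zero le = refl
    sum-enumerate fuel zero (suc n) le = refl
    sum-enumerate fuel (suc e) n le = sum-offset fuel e 0 n le

    sum-offset fuel e k n le = trans (cong sumℚ (map-++ (offsetWeight e k) (enumerate fuel e n) (withLargest fuel e n)))
      (trans (sum-++ (map (offsetWeight e k) (enumerate fuel e n)) _)
        (trans (cong₂ _+_ (trans (sum-cong (enumerate fuel e n) small)
              (trans (sum-scale (b (suc e) (k ℕ.+ 0)) (weightUpTo e) (enumerate fuel e n))
                (cong (b (suc e) (k ℕ.+ 0) *_) (sum-enumerate fuel e n le))))
            (sum-largest fuel e k n le))
          (sym (dilate-✶-step e (shift k (b (suc e))) (productUpTo e) n))))
      where
      small : ∀ {l} → l ∈ enumerate fuel e n → offsetWeight e k l ≡ b (suc e) (k ℕ.+ 0) * weightUpTo e l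
      small {l} i = cong (λ z → b (suc e) (k ℕ.+ z) * weightUpTo e l)
        (E-absent (All.map (λ { (_ , le) refl → ℕP.<-irrefl refl le }) (IsPartition.parts (enumerate⁻ fuel e n i))))

    sum-largest zero e k zero le = refl
    sum-largest (suc fuel) e k n le with suc e ℕP.≤? n
    ... | no nle = sym (X^-< _ (ℕP.≰⇒> nle))
    ... | yes le′ = trans (cong sumℚ (sym (map-∘ (enumerate fuel (suc e) m))))
        (trans (sum-cong (enumerate fuel (suc e) m) (λ {l} _ → cong₂ _*_ (cong (b (suc e)) (trans (cong (k ℕ.+_) (E-∷-≡ (suc e) l)) (ℕP.+-suc k _)))
            (weightUpTo-∷ {e} l ℕP.≤-refl)))
          (trans (sum-offset fuel e (suc k) m (smaller n le))
            (trans (at (✶-cong (spread-cong e 0 (mk λ i → cong (b (suc e)) (sym (ℕP.+-suc k i)))) S.refl) m)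
              (sym (trans (cong (X^ (suc e) _) (sym (ℕP.m+[n∸m]≡n le′))) (X^-+ (suc e) _ m))))))
      where
      m = n ℕ.∸ suc e
      smaller : ∀ n → n ≤ suc fuel → n ℕ.∸ suc e ≤ fuel
      smaller zero _ = z≤n
      smaller (suc n) (s≤s n≤f) = ℕP.≤-trans (ℕP.m∸n≤m n e) n≤f

    sum-partitions : ∀ {M n} → n ≤ M → sumℚ (map weight (partitions n)) ≡ productUpTo M n
    sum-partitions {M} {n} n≤M = trans
      (fold-map-support ℚP.+-0-commutativeMonoid weight (partitions n) (enumerate n M n) (partitions-unique n) (enumerate-unique n M n)
        (All.tabulate (λ i → enumerate⁺ n M n ℕP.≤-refl (partitions⁻ n≤M i)))
        (All.tabulate (λ i → inj₁ (partitions⁺ (enumerate⁻ n M n i)))))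
      (trans (sum-cong (enumerate n M n) (λ i → weight≡weightUpTo (IsPartition.parts (enumerate⁻ n M n i)))) (sum-enumerate n M n ℕP.≤-refl))

    productUpTo-0 : ∀ M → productUpTo M 0 ≡ 1ℚ
    productUpTo-0 zero = refl
    productUpTo-0 (suc e) = cong₂ _*_ (b-0 (suc e)) (productUpTo-0 e)

-- Assembly of the identity of power series.

module GeneratingFunction where
  open Rational
  open Binomial
  open Partition
  open Q
  open ≡ using (refl; sym; trans; cong; cong₂)
  open import Data.Integer using (_◃_)
  open import Algebra.Properties.CommutativeSemigroup S.*-commutativeSemigroup using (interchange)

  ⊛≡✶ : ∀ f g n → (f ⊛ g) n ≡ (f ✶ g) n
  ⊛≡✶ f g n = trans (cong sumℚ (map-applyUpTo id (λ i → f i ℚ.* g (n ℕ.∸ i)) (suc n))) (go f n)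
    where
    go : ∀ f n → sumℚ (applyUpTo (λ i → f i ℚ.* g (n ℕ.∸ i)) (suc n)) ≡ (f ✶ g) n
    go f zero = ℚP.+-identityʳ _
    go f (suc n) = cong (f 0 ℚ.* g (suc n) ℚ.+_) (go (tail f) n)

  inX²-local : ∀ {f g} n → (∀ m → m ≤ n → f m ≡ g m) → inX² f n ≡ inX² g n
  inX²-local zero e = e 0 z≤n
  inX²-local (suc zero) e = refl
  inX²-local (suc (suc n)) e = inX²-local n (λ m m≤n → e (suc m) (s≤s (ℕP.m≤n⇒m≤1+n m≤n)))

  inX²-cong : ∀ {f g} → f ≋ g → inX² f ≋ inX² g
  inX²-cong e = mk λ n → inX²-local n (λ m _ → at e m)

  inX²-⊕ : ∀ f g → inX² (f ⊕ g) ≋ inX² f ⊕ inX² g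
  inX²-⊕ f g = mk (go f g)
    where
    go : ∀ f g n → inX² (f ⊕ g) n ≡ inX² f n ℚ.+ inX² g n
    go f g zero = refl
    go f g (suc zero) = refl
    go f g (suc (suc n)) = go (tail f) (tail g) n

  inX²-⊖ : ∀ f → inX² (⊖ f) ≋ ⊖ inX² f
  inX²-⊖ f = mk (go f)
    where
    go : ∀ f n → inX² (⊖ f) n ≡ ℚ.- inX² f n
    go f zero = refl
    go f (suc zero) = refl
    go f (suc (suc n)) = go (tail f) n

  inX²-X^ : ∀ s f → inX² (X^ s f) ≋ X^ (s ℕ.+ s) (inX² f)
  inX²-X^ zero f = S.refl
  inX²-X^ (suc s) f = S.trans (mk λ where
      zero → refl
      (suc zero) → refl
      (suc (suc n)) → at (inX²-X^ s f) n)
    (S.reflexive (cong (λ k → X^ (suc k) (inX² f)) (sym (ℕP.+-suc s s))))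

  inX²-δ^ : ∀ k s f → inX² (δ^ k s f) ≋ δ^ k (s ℕ.+ s) (inX² f)
  inX²-δ^ zero s f = S.refl
  inX²-δ^ (suc k) s f = S.trans (inX²-⊕ (δ^ k s f) (⊖ X^ s (δ^ k s f)))
    (S.trans (S.+-congˡ {inX² (δ^ k s f)} (S.trans (inX²-⊖ (X^ s (δ^ k s f))) (S.-‿cong (inX²-X^ s (δ^ k s f)))))
      (δ-cong (s ℕ.+ s) (inX²-δ^ k s f)))

  inX²-𝟙 : inX² 𝟙 ≋ 𝟙
  inX²-𝟙 = mk λ where
      zero → refl
      (suc zero) → refl
      (suc (suc n)) → inX²-𝟘 n
    where
    inX²-𝟘 : ∀ n → inX² 𝟘 n ≡ 0ℚ
    inX²-𝟘 zero = refl
    inX²-𝟘 (suc zero) = refl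
    inX²-𝟘 (suc (suc n)) = inX²-𝟘 n

  -- binomNeg m is the expansion of (1 - X)^m.
  truncated : Sign → (ℕ → ℕ) → ℕ → Series
  truncated ε s = productUpTo (λ d → binomNeg (ε ◃ s d)) (λ _ → refl)

  partitionSeries-truncated : ∀ ε s {M n} → n ≤ M → partitionSeries ε s n ≡ truncated ε s M n
  partitionSeries-truncated ε s {M} {zero} _ = sym (productUpTo-0 (λ d → binomNeg (ε ◃ s d)) (λ _ → refl) M)
  partitionSeries-truncated ε s {M} {suc n} n≤M = sum-partitions (λ d → binomNeg (ε ◃ s d)) (λ _ → refl) n≤M

  truncated⁺-suc : ∀ s e → truncated Sign.+ s (suc e) ≋ δ^ (s (suc e)) (suc e) (truncated Sign.+ s e)
  truncated⁺-suc s e = S.trans (✶-cong (dilate-binomNeg⁺ e (s (suc e))) S.refl)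
    (S.trans (δ^-✶ˡ (s (suc e)) (suc e) 𝟙 (truncated Sign.+ s e)) (δ^-cong (s (suc e)) (suc e) (✶-identityˡ (truncated Sign.+ s e))))

  -- For negative exponents the recursion runs backwards: multiplying by powers of 1 - X^(e+1)
  -- cancels the last factor of the product.
  truncated⁻-suc : ∀ s e → δ^ (s (suc e)) (suc e) (truncated Sign.- s (suc e)) ≋ truncated Sign.- s e
  truncated⁻-suc s e = S.trans (S.sym (δ^-✶ˡ (s (suc e)) (suc e) (dilate e (binomNeg (Sign.- ◃ s (suc e)))) (truncated Sign.- s e)))
    (S.trans (✶-cong (dilate-binomNeg⁻ e (s (suc e))) S.refl) (✶-identityˡ (truncated Sign.- s e)))

  -- The factor (1 - X^s)^k gained by one series is lost by the other, and it can be moved across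
  -- the product.
  δ^-inverse : ∀ k s {f f′ g g′} → f′ ≋ δ^ k s f → δ^ k s g′ ≋ g → f′ ✶ g′ ≋ f ✶ g
  δ^-inverse k s {f} {f′} {g} {g′} e e′ = S.trans (✶-cong e S.refl) (S.trans (δ^-✶ˡ k s f g′)
    (S.trans (S.sym (δ^-✶ʳ k s f g′)) (✶-cong S.refl e′)))

  truncated-inverse : ∀ s M → truncated Sign.+ s M ✶ truncated Sign.- s M ≋ 𝟙
  truncated-inverse s zero = ✶-identityˡ 𝟙
  truncated-inverse s (suc e) = S.trans (δ^-inverse (s (suc e)) (suc e) (truncated⁺-suc s e) (truncated⁻-suc s e)) (truncated-inverse s e)

  inX²-truncated⁺-suc : ∀ s e → inX² (truncated Sign.+ s (suc e)) ≋ δ^ (s (suc e)) (suc e ℕ.+ suc e) (inX² (truncated Sign.+ s e))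
  inX²-truncated⁺-suc s e = S.trans (inX²-cong (truncated⁺-suc s e)) (inX²-δ^ (s (suc e)) (suc e) (truncated Sign.+ s e))

  inX²-truncated-inverse : ∀ s M → inX² (truncated Sign.+ s M) ✶ inX² (truncated Sign.- s M) ≋ 𝟙
  inX²-truncated-inverse s zero = S.trans (✶-cong inX²-𝟙 inX²-𝟙) (✶-identityˡ 𝟙)
  inX²-truncated-inverse s (suc e) = S.trans (δ^-inverse (s (suc e)) (suc e ℕ.+ suc e) (inX²-truncated⁺-suc s e)
    (S.trans (S.sym (inX²-δ^ (s (suc e)) (suc e) (truncated Sign.- s (suc e)))) (inX²-cong (truncated⁻-suc s e)))) (inX²-truncated-inverse s e)

  linear-tail : ∀ a b → tail (linear a b) ≋ b ∙ 𝟙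
  linear-tail a b = mk λ where
    zero → sym (ℚP.*-identityʳ b)
    (suc n) → sym (ℚP.*-zeroʳ b)

  linear-✶ : ∀ b g n → (linear 1ℚ b ✶ g) (suc n) ≡ g (suc n) ℚ.+ b ℚ.* g n
  linear-✶ b g n = cong₂ ℚ._+_ (ℚP.*-identityˡ (g (suc n))) (at (S.trans (✶-cong (linear-tail 1ℚ b) (S.refl {g}))
    (S.trans (∙-✶ b 𝟙 g) (∙-cong {b} refl (✶-identityˡ g)))) n)

  geometric-inverse : ∀ r → linear 1ℚ (ℚ.- r) ✶ geometric r ≋ 𝟙
  geometric-inverse r = mk λ where
    zero → refl
    (suc n) → trans (linear-✶ (ℚ.- r) (geometric r) n)
      (trans (cong (r ℚ.* geometric r n ℚ.+_) (sym (ℚP.neg-distribˡ-* r (geometric r n)))) (ℚP.+-inverseʳ (r ℚ.* geometric r n)))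

  rhs✶ : ℕ → Sign → Series
  rhs✶ q Sign.+ = linear 1ℚ (ℚ.- fromℕ q) ✶ geometric (ℚ.- 1ℚ)
  rhs✶ q Sign.- = linear 1ℚ 1ℚ ✶ geometric (fromℕ q)

  rhsSeries≡ : ∀ q ε n → rhsSeries q ε n ≡ rhs✶ q ε n
  rhsSeries≡ q Sign.+ n = ⊛≡✶ (linear 1ℚ (ℚ.- fromℕ q)) (geometric (ℚ.- 1ℚ)) n
  rhsSeries≡ q Sign.- n = ⊛≡✶ (linear 1ℚ 1ℚ) (geometric (fromℕ q)) n

  rhs-inverse : ∀ q → rhs✶ q Sign.- ✶ rhs✶ q Sign.+ ≋ 𝟙
  rhs-inverse q = S.trans (✶-comm _ _) (S.trans (✶-cong (S.refl {rhs✶ q Sign.+}) (✶-comm (linear 1ℚ 1ℚ) (geometric (fromℕ q))))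
    (S.trans (interchange (linear 1ℚ (ℚ.- fromℕ q)) (geometric (ℚ.- 1ℚ)) (geometric (fromℕ q)) (linear 1ℚ 1ℚ))
      (S.trans (✶-cong (geometric-inverse (fromℕ q)) (S.trans (✶-comm _ _) (geometric-inverse (ℚ.- 1ℚ)))) (✶-identityˡ 𝟙))))

  fromℕ-^ : ∀ q n → fromℕ (q ℕ.^ n) ≡ geometric (fromℕ q) n
  fromℕ-^ q zero = refl
  fromℕ-^ q (suc n) = trans (fromℕ-* q (q ℕ.^ n)) (cong (fromℕ q ℚ.*_) (fromℕ-^ q n))

  module _ {c ℓ : Level} (q : ℕ) (q-pp : IsPrimePower q) (F : FiniteField c ℓ) (order≡q² : FiniteField.order F ≡ q ℕ.* q) where
    open Poly F q using (SDIM⁻; SDIM⁺)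
    open SelfDualPolynomials F q q-pp order≡q² using (eulerProduct; euler-identity; count; selfDualCount)

    -- (q + 1) q^n = q^(n+1) + q^n is the coefficient of X^(n+1) in (1 + X) / (1 - q X).
    selfDual-series : count selfDualCount ≋ rhs✶ q Sign.-
    selfDual-series = mk λ where
      zero → refl
      (suc n) → trans (fromℕ-+ (q ℕ.^ n) (q ℕ.* q ℕ.^ n)) (trans (ℚP.+-comm (fromℕ (q ℕ.^ n)) (fromℕ (q ℕ.* q ℕ.^ n)))
        (trans (cong₂ ℚ._+_ (fromℕ-^ q (suc n)) (trans (fromℕ-^ q n) (sym (ℚP.*-identityˡ (geometric (fromℕ q) n)))))
          (sym (linear-✶ 1ℚ (geometric (fromℕ q)) n))))

    L : Sign → ℕ → Series
    L ε M = truncated ε SDIM⁻ M ✶ inX² (truncated ε SDIM⁺ M)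

    -- The substitution of X² doubles the exponent in each factor counted by `SDIM⁺`, just as g g~
    -- has twice the degree of g; so both sides collect the same factors.
    L⁺-euler : ∀ M f → L Sign.+ M ✶ f ≋ eulerProduct M f
    L⁺-euler zero f = S.trans (✶-cong (S.trans (✶-identityˡ (inX² 𝟙)) inX²-𝟙) S.refl) (✶-identityˡ f)
    L⁺-euler (suc e) f = S.trans (✶-cong (S.trans (✶-cong (truncated⁺-suc SDIM⁻ e) (inX²-truncated⁺-suc SDIM⁺ e))
        (S.trans (δ^-✶ˡ s⁻ (suc e) U (δ^ s⁺ (suc e ℕ.+ suc e) V)) (δ^-cong s⁻ (suc e) (δ^-✶ʳ s⁺ (suc e ℕ.+ suc e) U V)))) S.refl)
      (S.trans (δ^-✶ˡ s⁻ (suc e) (δ^ s⁺ (suc e ℕ.+ suc e) (U ✶ V)) f)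
        (δ^-cong s⁻ (suc e) (S.trans (δ^-✶ˡ s⁺ (suc e ℕ.+ suc e) (U ✶ V) f) (δ^-cong s⁺ (suc e ℕ.+ suc e) (L⁺-euler e f)))))
      where
      s⁻ = SDIM⁻ (suc e)
      s⁺ = SDIM⁺ (suc e)
      U = truncated Sign.+ SDIM⁻ e
      V = inX² (truncated Sign.+ SDIM⁺ e)

    L-inverse : ∀ M → L Sign.+ M ✶ L Sign.- M ≋ 𝟙
    L-inverse M = S.trans (interchange (truncated Sign.+ SDIM⁻ M) (inX² (truncated Sign.+ SDIM⁺ M))
        (truncated Sign.- SDIM⁻ M) (inX² (truncated Sign.- SDIM⁺ M)))
      (S.trans (✶-cong (truncated-inverse SDIM⁻ M) (inX²-truncated-inverse SDIM⁺ M)) (✶-identityˡ 𝟙))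

    L⁺-rhs⁻ : ∀ {M n} → n ≤ M → (L Sign.+ M ✶ rhs✶ q Sign.-) n ≡ 𝟙 n
    L⁺-rhs⁻ {M} {n} n≤M = trans (at (✶-cong (S.refl {L Sign.+ M}) (S.sym selfDual-series)) n)
      (trans (at (L⁺-euler M (count selfDualCount)) n) (euler-identity M n n≤M))

    -- The usual h = h (f g) = g, read in degree n only. Sieving finitely many atoms yields f g = 1
    -- just up to a given degree, and by locality of the product this is enough.
    inverse-unique : ∀ {f g h} n → (∀ m → m ≤ n → (f ✶ g) m ≡ 𝟙 m) → f ✶ h ≋ 𝟙 → h n ≡ g n
    inverse-unique {f} {g} {h} n fg fh = sym (trans (sym (at (✶-identityˡ g) n)) (trans (at (✶-cong (S.trans (S.sym fh) (✶-comm f h)) (S.refl {g})) n)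
      (trans (at (✶-assoc h f g) n) (trans (✶-local n (λ _ _ → refl) fg) (at (S.trans (✶-comm h 𝟙) (✶-identityˡ h)) n)))))

    -- For `Sign.-`, both sides invert `L Sign.+`; for `Sign.+`, both sides invert (1 + X) / (1 - q
    -- X). In each case one of the two inverses is known only up to degree n, from the level M = n.
    L≡rhs : ∀ ε n → L ε n n ≡ rhs✶ q ε n
    L≡rhs Sign.- n = inverse-unique n (λ m m≤n → L⁺-rhs⁻ m≤n) (L-inverse n)
    L≡rhs Sign.+ n = sym (inverse-unique n (λ m m≤n → trans (at (✶-comm (rhs✶ q Sign.-) (L Sign.+ n)) m) (L⁺-rhs⁻ m≤n)) (rhs-inverse q))

    partition-identity : ∀ ε n → (partitionSeries ε SDIM⁻ ⊛ inX² (partitionSeries ε SDIM⁺)) n ≡ rhsSeries q ε n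
    partition-identity ε n = trans (⊛≡✶ (partitionSeries ε SDIM⁻) (inX² (partitionSeries ε SDIM⁺)) n)
      (trans (✶-local n (λ m m≤n → partitionSeries-truncated ε SDIM⁻ m≤n)
        (λ m m≤n → inX²-local m (λ k k≤m → partitionSeries-truncated ε SDIM⁺ (ℕP.≤-trans k≤m m≤n))))
      (trans (L≡rhs ε n) (sym (rhsSeries≡ q ε n))))

open import Data.Nat using (_*_)

theorem6p5 : ∀ {c ℓ : Level} (q : ℕ) → IsPrimePower q →
    (F : FiniteField c ℓ) → FiniteField.order F ≡ q * q →
    (ε : Sign) → (n : ℕ) →
    (partitionSeries ε (Poly.SDIM⁻ F q) ⊛ inX² (partitionSeries ε (Poly.SDIM⁺ F q))) n
    ≡ rhsSeries q ε n
theorem6p5 q q-pp F order≡q² = GeneratingFunction.partition-identity q q-pp F order≡q²
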